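{- There exists $\epsilon\in\mathbb{R}_{>0}$ such that for every sufficiently large $n\in\mathbb{N}$ and every $k\in[n]$, every Sums-of-Squares (SOS) refutation of $\mathrm{KS}_{n,k}$ has monomial size at least $2^{\epsilon k^2/n}$.
   Context: $[n]=\{1,\ldots,n\}$. $\mathrm{KS}_{n,k}$ denotes the Knapsack equation $2x_1+\cdots+2x_n=k$ on Boolean variables $x_1,\ldots,x_n$ (it is unsatisfiable for odd integers $k$), regarded as the single polynomial equality constraint $2x_1+\cdots+2x_n-k=0$. SOS proofs: polynomials are real polynomials in $2n$ commuting variables $x_1,\ldots,x_n,\bar{x}_1,\ldots,\bar{x}_n$ ($n$ pairs of twin variables); $B_n=\{x_i^2-x_i,\ \bar{x}_i^2-\bar{x}_i,\ x_i+\bar{x}_i-1 : i\in[n]\}$. For an indexed set of constraints $q_1\geq 0,\ldots,q_\ell\geq 0$, $p_1=0,\ldots,p_m=0$, an SOS refutation is a formal identity $$-1=s_0+\sum_{j\in[\ell]}s_jq_j+\sum_{j\in[m]}t_jp_j+\sum_{q\in B_n}u_qq,$$ where each $s_j=\sum_{i=1}^{k_j}r_{i,j}^2$ is given as a sum of squares of polynomials ($j\in\{0\}\cup[\ell]$) and $t_j,u_q$ are arbitrary polynomials. Its monomial size is $\sum_{j\in\{0\}\cup[\ell]}\sum_{i=1}^{k_j}\mathrm{size}(r_{i,j})+\sum_{j\in[m]}\mathrm{size}(t_j)$, where $\mathrm{size}(p)$ is the number of (nonzero) terms of $p$. (Here $\ell=0$ and $m=1$.) -}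

module Defs where

open import Data.Bool.Base using (if_then_else_)
open import Data.Fin.Base using (Fin; _↑ˡ_; _↑ʳ_)
open import Data.Integer.Base using (+_; -[1+_])
open import Data.List.Base using (List; []; _∷_; map; foldr; length; cartesianProductWith)
  renaming (_++_ to _++ˡ_)
open import Data.List.Membership.Propositional using (_∈_)
open import Data.List.Relation.Binary.Pointwise.Base using (Pointwise)
open import Data.List.Relation.Unary.Unique.Propositional using (Unique)
open import Data.Nat.Base as ℕ using (ℕ; suc; _⊔_)
import Data.Nat.Properties as ℕ
open import Data.Nat.ListAction using (sum)
open import Data.Product.Base using (∃-syntax; _×_; _,_; proj₁; proj₂)
open import Data.Rational.Base
  using (ℚ; 0ℚ; 1ℚ; ½; _+_; _*_; -_; _-_; ∣_∣; _<_; _≤_; _/_; 1/_; ↥_; ↧ₙ_; Positive; NonZero; positive)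
open import Data.Rational.Properties
open import Data.Rational.Solver using (module +-*-Solver)
open import Data.Vec.Base using (Vec; replicate; zipWith; _[_]≔_)
open import Data.Vec.Functional using (Vector; _++_)
import Data.Vec.Functional as Vector
open import Data.Vec.Properties using (≡-dec)
open import Function.Bundles using (_⇔_)
open import Relation.Binary.PropositionalEquality
open import Relation.Nullary.Decidable.Core using (does)
open import Relation.Nullary.Negation.Core using (¬_)

------------------------------------------------------------------------
-- Real numbers: Cauchy sequences of rationals, with the setoid equality
-- "the difference tends to 0".

Cauchy : (ℕ → ℚ) → Set
Cauchy x = ∀ ε → 0ℚ < ε →
  ∃[ N ] (∀ m n → N ℕ.≤ m → N ℕ.≤ n → ∣ x m - x n ∣ < ε)

record ℝ : Set where
  constructor mkℝ
  field
    seq    : ℕ → ℚ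
    cauchy : Cauchy seq

open ℝ public

infix 4 _≃_ _<ℝ_

record _≃_ (x y : ℝ) : Set where
  constructor mk≃
  field
    close : ∀ ε → 0ℚ < ε →
      ∃[ N ] (∀ n → N ℕ.≤ n → ∣ seq x n - seq y n ∣ < ε)

_<ℝ_ : ℝ → ℝ → Set
x <ℝ y = ∃[ δ ] (0ℚ < δ) × ∃[ N ] (∀ n → N ℕ.≤ n → seq x n + δ < seq y n)

private
  open module ≤-R = ≤-Reasoning

-- Only the existence of the moduli matters, and unfolding them is expensive.
abstract
  scale-pos : ∀ r .{{_ : Positive r}} {ε} → 0ℚ < ε → 0ℚ < r * ε
  scale-pos r {ε} 0<ε = subst (_< r * ε) (*-zeroʳ r) (*-monoʳ-<-pos r {0ℚ} {ε} 0<ε)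

  half-pos : ∀ {ε} → 0ℚ < ε → 0ℚ < ½ * ε
  half-pos = scale-pos ½

  half+half : ∀ ε → ½ * ε + ½ * ε ≡ ε
  half+half ε = trans (sym (*-distribʳ-+ ε ½ ½)) (*-identityˡ ε)

  +-cauchy : ∀ x y → Cauchy x → Cauchy y → Cauchy (λ n → x n + y n)
  +-cauchy x y cx cy ε 0<ε = combine (cx (½ * ε) (half-pos 0<ε)) (cy (½ * ε) (half-pos 0<ε))
    where
    rearrange : ∀ a b c d → (a + b) - (c + d) ≡ (a - c) + (b - d)
    rearrange = solve 4 (λ a b c d → (a :+ b) :- (c :+ d) := (a :- c) :+ (b :- d)) refl
      where open +-*-Solver

    combine :
      ∃[ M ] (∀ m n → M ℕ.≤ m → M ℕ.≤ n → ∣ x m - x n ∣ < ½ * ε) →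
      ∃[ N ] (∀ m n → N ℕ.≤ m → N ℕ.≤ n → ∣ y m - y n ∣ < ½ * ε) →
      ∃[ N ] (∀ m n → N ℕ.≤ m → N ℕ.≤ n → ∣ (x m + y m) - (x n + y n) ∣ < ε)
    combine (M , hx) (N , hy) = M ⊔ N , λ m n m≥ n≥ → begin-strict
      ∣ (x m + y m) - (x n + y n) ∣    ≡⟨ cong ∣_∣ (rearrange (x m) (y m) (x n) (y n)) ⟩
      ∣ (x m - x n) + (y m - y n) ∣    ≤⟨ ∣p+q∣≤∣p∣+∣q∣ (x m - x n) (y m - y n) ⟩
      ∣ x m - x n ∣ + ∣ y m - y n ∣    <⟨ +-mono-<
        (hx m n (ℕ.m⊔n≤o⇒m≤o M N m≥) (ℕ.m⊔n≤o⇒m≤o M N n≥))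
        (hy m n (ℕ.m⊔n≤o⇒n≤o M N m≥) (ℕ.m⊔n≤o⇒n≤o M N n≥)) ⟩
      ½ * ε + ½ * ε                    ≡⟨ half+half ε ⟩
      ε                                ∎

  neg-cauchy : ∀ x → Cauchy x → Cauchy (λ n → - x n)
  neg-cauchy x cx ε 0<ε = proj₁ (cx ε 0<ε) , λ m n m≥ n≥ →
    subst (λ d → ∣ d ∣ < ε) (sym (rearrange (x m) (x n))) (proj₂ (cx ε 0<ε) n m n≥ m≥)
    where
    rearrange : ∀ a b → - a - (- b) ≡ b - a
    rearrange = solve 2 (λ a b → :- a :- (:- b) := b :- a) refl
      where open +-*-Solver

  EventuallyBounded : (ℕ → ℚ) → ℚ → Set
  EventuallyBounded x K = ∃[ N ] (∀ n → N ℕ.≤ n → ∣ x n ∣ ≤ K)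

  bounded : ∀ x → Cauchy x → ∃[ K ] Positive K × EventuallyBounded x K
  bounded x cx = go (cx 1ℚ (positive⁻¹ 1ℚ))
    where
    split : ∀ a b → a ≡ b + (a - b)
    split = solve 2 (λ a b → a := b :+ (a :- b)) refl
      where open +-*-Solver

    bound-pos : ∀ q → Positive (∣ q ∣ + 1ℚ)
    bound-pos q = nonNeg+pos⇒pos ∣ q ∣ {{∣-∣-nonNeg q}} 1ℚ

    go : ∃[ N ] (∀ m n → N ℕ.≤ m → N ℕ.≤ n → ∣ x m - x n ∣ < 1ℚ) →
         ∃[ K ] Positive K × EventuallyBounded x K
    go (N , h) = ∣ x N ∣ + 1ℚ , bound-pos (x N) , N , λ n n≥ → begin
      ∣ x n ∣                    ≡⟨ cong ∣_∣ (split (x n) (x N)) ⟩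
      ∣ x N + (x n - x N) ∣      ≤⟨ ∣p+q∣≤∣p∣+∣q∣ (x N) (x n - x N) ⟩
      ∣ x N ∣ + ∣ x n - x N ∣    ≤⟨ +-monoʳ-≤ ∣ x N ∣ (<⇒≤ (h n N n≥ ℕ.≤-refl)) ⟩
      ∣ x N ∣ + 1ℚ               ∎

  *-small : ∀ K → Positive K → ∀ ε → 0ℚ < ε →
    ∃[ δ ] (0ℚ < δ) × (∀ a d → ∣ a ∣ ≤ K → ∣ d ∣ < δ → ∣ a * d ∣ < ε)
  *-small K K>0 ε 0<ε = 1/ K * ε , scale-pos (1/ K) 0<ε , λ a d a≤ d< → begin-strict
    ∣ a * d ∣         ≡⟨ ∣p*q∣≡∣p∣*∣q∣ a d ⟩
    ∣ a ∣ * ∣ d ∣     ≤⟨ *-monoʳ-≤-nonNeg ∣ d ∣ {{∣-∣-nonNeg d}} a≤ ⟩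
    K * ∣ d ∣         <⟨ *-monoʳ-<-pos K d< ⟩
    K * (1/ K * ε)    ≡⟨ *-assoc K (1/ K) ε ⟨
    K * 1/ K * ε      ≡⟨ cong (_* ε) (*-inverseʳ K) ⟩
    1ℚ * ε            ≡⟨ *-identityˡ ε ⟩
    ε                 ∎
    where
    instance
      K-positive : Positive K
      K-positive = K>0
      K-nonZero : NonZero K
      K-nonZero = pos⇒nonZero K
      1/K-positive : Positive (1/ K)
      1/K-positive = 1/pos⇒pos K

  bounded*small : ∀ x y → Cauchy y → ∀ {K} → Positive K → EventuallyBounded x K →
    ∀ ε → 0ℚ < ε →
    ∃[ N ] (∀ k m n → N ℕ.≤ k → N ℕ.≤ m → N ℕ.≤ n → ∣ x k * (y m - y n) ∣ < ε)
  bounded*small x y cy {K} K>0 (M , hK) ε 0<ε = go (*-small K K>0 ε 0<ε)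
    where
    go : ∃[ δ ] (0ℚ < δ) × (∀ a d → ∣ a ∣ ≤ K → ∣ d ∣ < δ → ∣ a * d ∣ < ε) →
         ∃[ N ] (∀ k m n → N ℕ.≤ k → N ℕ.≤ m → N ℕ.≤ n → ∣ x k * (y m - y n) ∣ < ε)
    go (δ , 0<δ , small) = M ⊔ N , λ k m n k≥ m≥ n≥ →
      small (x k) (y m - y n)
        (hK k (ℕ.m⊔n≤o⇒m≤o M N k≥))
        (proj₂ (cy δ 0<δ) m n (ℕ.m⊔n≤o⇒n≤o M N m≥) (ℕ.m⊔n≤o⇒n≤o M N n≥))
      where
      N : ℕ
      N = proj₁ (cy δ 0<δ)

  *-cauchy : ∀ x y → Cauchy x → Cauchy y → Cauchy (λ n → x n * y n)
  *-cauchy x y cx cy ε 0<ε = combine (bounded x cx) (bounded y cy)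
    where
    rearrange : ∀ a b c d → a * b - c * d ≡ a * (b - d) + d * (a - c)
    rearrange = solve 4 (λ a b c d → a :* b :- c :* d := a :* (b :- d) :+ d :* (a :- c)) refl
      where open +-*-Solver

    Goal : Set
    Goal = ∃[ N ] (∀ m n → N ℕ.≤ m → N ℕ.≤ n → ∣ x m * y m - x n * y n ∣ < ε)

    add :
      ∃[ M ] (∀ k m n → M ℕ.≤ k → M ℕ.≤ m → M ℕ.≤ n → ∣ x k * (y m - y n) ∣ < ½ * ε) →
      ∃[ N ] (∀ k m n → N ℕ.≤ k → N ℕ.≤ m → N ℕ.≤ n → ∣ y k * (x m - x n) ∣ < ½ * ε) →
      Goal
    add (M , hx) (N , hy) = M ⊔ N , λ m n m≥ n≥ → begin-strict
      ∣ x m * y m - x n * y n ∣                        ≡⟨ cong ∣_∣ (rearrange (x m) (y m) (x n) (y n)) ⟩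
      ∣ x m * (y m - y n) + y n * (x m - x n) ∣        ≤⟨ ∣p+q∣≤∣p∣+∣q∣ (x m * (y m - y n)) (y n * (x m - x n)) ⟩
      ∣ x m * (y m - y n) ∣ + ∣ y n * (x m - x n) ∣    <⟨ +-mono-<
        (hx m m n (ℕ.m⊔n≤o⇒m≤o M N m≥) (ℕ.m⊔n≤o⇒m≤o M N m≥) (ℕ.m⊔n≤o⇒m≤o M N n≥))
        (hy n m n (ℕ.m⊔n≤o⇒n≤o M N n≥) (ℕ.m⊔n≤o⇒n≤o M N m≥) (ℕ.m⊔n≤o⇒n≤o M N n≥)) ⟩
      ½ * ε + ½ * ε                                    ≡⟨ half+half ε ⟩
      ε                                                ∎

    combine : ∃[ K ] Positive K × EventuallyBounded x K →
              ∃[ L ] Positive L × EventuallyBounded y L → Goal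
    combine (K , K>0 , hK) (L , L>0 , hL) = add
      (bounded*small x y cy K>0 hK (½ * ε) (half-pos 0<ε))
      (bounded*small y x cx L>0 hL (½ * ε) (half-pos 0<ε))

  const-cauchy : ∀ q → Cauchy (λ _ → q)
  const-cauchy q ε 0<ε = 0 , λ _ _ _ _ → subst (λ d → ∣ d ∣ < ε) (sym (+-inverseʳ q)) 0<ε

fromℚ : ℚ → ℝ
fromℚ q = mkℝ (λ _ → q) (const-cauchy q)

fromℕ : ℕ → ℝ
fromℕ n = fromℚ (+ n / 1)

0ℝ : ℝ
0ℝ = fromℚ 0ℚ

1ℝ : ℝ
1ℝ = fromℚ 1ℚ

infixl 6 _+ℝ_
infixl 7 _*ℝ_
infix  8 -ℝ_

_+ℝ_ : ℝ → ℝ → ℝ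
x +ℝ y = mkℝ (λ n → seq x n + seq y n) (+-cauchy (seq x) (seq y) (cauchy x) (cauchy y))

-ℝ_ : ℝ → ℝ
-ℝ x = mkℝ (λ n → - seq x n) (neg-cauchy (seq x) (cauchy x))

_*ℝ_ : ℝ → ℝ → ℝ
x *ℝ y = mkℝ (λ n → seq x n * seq y n) (*-cauchy (seq x) (seq y) (cauchy x) (cauchy y))

-- The real power 2ˣ is the supremum of the rational powers 2ᵗ, t < x,
-- and 2^(a/b) is the positive b-th root of 2^a.  So 2ˣ ≤ s means that
-- every 2ᵗ with t < x is at most s, and 2^(a/b) ≤ s means 2^a ≤ s^b.

infix 4 2^ℚ_≤_ 2^_≤_

2^ℚ_≤_ : ℚ → ℕ → Set
2^ℚ t ≤ s with ↥ t
... | + a      = 2 ℕ.^ a ℕ.≤ s ℕ.^ ↧ₙ t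
... | -[1+ a ] = 1 ℕ.≤ 2 ℕ.^ suc a ℕ.* s ℕ.^ ↧ₙ t

2^_≤_ : ℝ → ℕ → Set
2^ x ≤ s = ∀ t → fromℚ t <ℝ x → 2^ℚ t ≤ s

------------------------------------------------------------------------
-- Real polynomials in v commuting variables, as formal sums of terms.
-- Monomials may repeat and coefficients may vanish in the sum; equality
-- and size only look at the collected coefficients.

Monomial : ℕ → Set
Monomial v = Vec ℕ v

Poly : ℕ → Set
Poly v = List (ℝ × Monomial v)

coeff : ∀ {v} → Poly v → Monomial v → ℝ
coeff []             m = 0ℝ
coeff ((c , a) ∷ p)  m =
  if does (≡-dec ℕ._≟_ a m) then c +ℝ coeff p m else coeff p m

infix 4 _≈_

record _≈_ {v} (p q : Poly v) : Set where
  constructor mk≈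
  field
    coeff-≃ : ∀ m → coeff p m ≃ coeff q m

infixl 6 _+ₚ_ _-ₚ_
infixl 7 _*ₚ_

const : ∀ {v} → ℝ → Poly v
const {v} c = (c , replicate v 0) ∷ []

var : ∀ {v} → Fin v → Poly v
var {v} i = (1ℝ , replicate v 0 [ i ]≔ 1) ∷ []

0ₚ : ∀ {v} → Poly v
0ₚ = []

_+ₚ_ : ∀ {v} → Poly v → Poly v → Poly v
_+ₚ_ = _++ˡ_

_*ₚ_ : ∀ {v} → Poly v → Poly v → Poly v
_*ₚ_ = cartesianProductWith λ (c , a) (d , b) → c *ℝ d , zipWith ℕ._+_ a b

-ₚ_ : ∀ {v} → Poly v → Poly v
-ₚ_ = map λ (c , a) → -ℝ c , a

_-ₚ_ : ∀ {v} → Poly v → Poly v → Poly v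
p -ₚ q = p +ₚ (-ₚ q)

∑ : ∀ {v k} → Vector (Poly v) k → Poly v
∑ = Vector.foldr _+ₚ_ 0ₚ

sumOfSquares : ∀ {v} → List (Poly v) → Poly v
sumOfSquares = foldr (λ r s → r *ₚ r +ₚ s) 0ₚ

-- The number of monomials with nonzero coefficient.  This is a relation
-- rather than a function because equality of reals is undecidable.
record HasSize {v} (p : Poly v) (s : ℕ) : Set where
  field
    support      : List (Monomial v)
    unique       : Unique support
    nonzero      : ∀ m → m ∈ support ⇔ (¬ coeff p m ≃ 0ℝ)
    size≡length  : s ≡ length support

------------------------------------------------------------------------
-- Sums-of-squares refutations over n pairs of twin variables: the first
-- n variables are the xᵢ, the last n are the x̄ᵢ.

module _ {n : ℕ} where

  x : Fin n → Poly (n ℕ.+ n)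
  x i = var (i ↑ˡ n)

  x̄ : Fin n → Poly (n ℕ.+ n)
  x̄ i = var (n ↑ʳ i)

B : ∀ n → Vector (Poly (n ℕ.+ n)) (n ℕ.+ (n ℕ.+ n))
B n = (λ i → x {n} i *ₚ x {n} i -ₚ x {n} i)
   ++ (λ i → x̄ {n} i *ₚ x̄ {n} i -ₚ x̄ {n} i)
   ++ (λ i → x {n} i +ₚ x̄ {n} i -ₚ const 1ℝ)

-- Refutations of the constraints q j ≥ 0 (j < ℓ) and p j = 0 (j < m).
record SOSRefutation {n ℓ m : ℕ}
    (q : Vector (Poly (n ℕ.+ n)) ℓ) (p : Vector (Poly (n ℕ.+ n)) m) : Set where
  field
    r₀ : List (Poly (n ℕ.+ n))
    r  : Vector (List (Poly (n ℕ.+ n))) ℓ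
    t  : Vector (Poly (n ℕ.+ n)) m
    u  : Vector (Poly (n ℕ.+ n)) (n ℕ.+ (n ℕ.+ n))
    identity : const (-ℝ 1ℝ) ≈
      sumOfSquares r₀
        +ₚ ∑ (λ j → sumOfSquares (r j) *ₚ q j)
        +ₚ ∑ (λ j → t j *ₚ p j)
        +ₚ ∑ (λ i → u i *ₚ B n i)

∑ℕ : ∀ {k} → Vector ℕ k → ℕ
∑ℕ = Vector.foldr ℕ._+_ 0

record HasMonomialSize {n ℓ m : ℕ}
    {q : Vector (Poly (n ℕ.+ n)) ℓ} {p : Vector (Poly (n ℕ.+ n)) m}
    (π : SOSRefutation {n} q p) (s : ℕ) : Set where
  open SOSRefutation π
  field
    size-r₀ : List ℕ
    size-r  : Vector (List ℕ) ℓ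
    size-t  : Vector ℕ m
    r₀-size : Pointwise HasSize r₀ size-r₀
    r-size  : ∀ j → Pointwise HasSize (r j) (size-r j)
    t-size  : ∀ j → HasSize (t j) (size-t j)
    total   : s ≡ sum size-r₀ ℕ.+ ∑ℕ (λ j → sum (size-r j)) ℕ.+ ∑ℕ size-t

knapsack : ∀ n → ℕ → Poly (n ℕ.+ n)
knapsack n k = ∑ (λ i → const (fromℕ 2) *ₚ x {n} i) -ₚ const (fromℕ k)

-- KS n k has no inequality constraints and one equality constraint.
KSRefutation : ℕ → ℕ → Set
KSRefutation n k = SOSRefutation {n} Vector.[] (knapsack n k Vector.∷ Vector.[])

{-# OPTIONS --safe #-}

-- A refutation with few monomials is first restricted.  Each wide monomial contains at least D of
-- the 2n literals, so some literal lies in a D/2n fraction of the wide monomials; falsifying it kills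
-- them.  With D and t proportional to k, after t steps no wide monomial is left, unless there were
-- (1 − D/2n)⁻ᵗ ≥ 2^(εk²/n) of them to begin with.
--
-- What remains is a refutation of degree at most d = D − 1 of a knapsack equation Σ xᵢ = κ/2 in N free
-- variables, with κ ≥ 4d − 2.  Grigoriev's functional L(x_A) = ∏_{i<|A|} (κ/2 − i)/(N − i) respects
-- all the axioms, so it only has to be positive on squares.  Modulo the knapsack equation every
-- polynomial of degree ≤ d is a combination of the x_I with |I| = d, and expanding L(x_I x_J) as if the
-- common variables of I and J had independent copies gives L(x_I x_J) = Σ_{K ⊆ I ∩ J} c_|K|, where
-- c_j is the value of L on a product of 2d − j variables and j negated ones.  All c_j are nonnegative
-- since κ/2 ≥ 2d − 1, hence L(f²) = Σ_K c_|K| (Σ_{I ⊇ K} f_I)².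
module Submission where

open import Defs
open import Algebra.Bundles using (CommutativeRing; CommutativeSemiring)
open import Algebra.Structures using (IsCommutativeRing)
open import Data.Bool.Base as Bool using (Bool; true; false; if_then_else_)
import Data.Bool.Properties as Bool
open import Data.Empty using (⊥; ⊥-elim)
open import Data.Fin.Base using (Fin; zero; suc; _↑ˡ_; _↑ʳ_; splitAt)
import Data.Fin.Properties as Fin
open import Data.Integer.Base as ℤ using (ℤ; +_)
import Data.Integer.Properties as ℤ
open import Data.List.Base using (List; []; _∷_; map; _++_; length)
import Data.List.Membership.DecPropositional as DecMembership
import Data.List.Properties as List
open import Data.List.Relation.Binary.Pointwise.Base using (Pointwise; []; _∷_)
open import Data.List.Relation.Unary.All as All using (All; []; _∷_)
open import Data.List.Relation.Unary.All.Properties using (map⁺; map⁻; ++⁺; ++⁻)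
open import Data.Nat.Base as ℕ using (ℕ; zero; suc; NonZero; _≤_)
open import Data.Nat.DivMod using (m/n*n≤m; m%n<n; m≡m%n+[m/n]*n)
open import Data.Nat.ListAction using (sum)
import Data.Nat.Properties as ℕ
open import Data.Product.Base using (_×_; Σ-syntax; ∃-syntax; _,_; proj₁; proj₂)
open import Data.Rational.Base as ℚ using (ℚ; mkℚ; 0ℚ; 1ℚ; ½; _/_; Positive)
import Data.Rational.Properties as ℚ
import Data.Rational.Solver as ℚ
import Data.Rational.Unnormalised.Base as ℚᵘ
import Data.Rational.Unnormalised.Properties as ℚᵘ
open import Data.Sum.Base using (_⊎_; inj₁; inj₂)
open import Data.Unit.Base using (⊤; tt)
open import Data.Vec.Base as Vec
  using (Vec; []; _∷_; lookup; replicate; tabulate; updateAt; zipWith; _[_]≔_)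
import Data.Vec.Functional as Vector
import Data.Vec.Properties as Vec
open import Data.Vec.Properties using (≡-dec)
open import Function.Base using (_∘_)
open import Function.Bundles using (Equivalence)
open import Level using (0ℓ)
open import Relation.Binary.Definitions using (DecidableEquality)
open import Relation.Binary.PropositionalEquality
  using (_≡_; _≢_; refl; sym; trans; cong; cong₂; subst; module ≡-Reasoning)
open import Relation.Nullary.Decidable.Core using (Dec; yes; no; does; toWitness)
open import Relation.Nullary.Negation.Core using (¬_)

-- The refutation itself is never rewritten. The restriction lives in the functional: `E ρ`
-- evaluates the monomials of the original refutation and gives 0 to those that ρ falsifies. Such
-- monomials also get 0 in every linear form of the Gram identity, so only the live monomials in the
-- supports of the squared polynomials and of the knapsack multiplier have to be of low degree. The
-- multipliers of the Boolean axioms do not enter the size and may have any degree; this does no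
-- harm because the functional vanishes on all multiples of these axioms. For the knapsack equation
-- this can fail in high degree: the moment recursion stops at degree N.
--
-- The coefficients of a refutation are arbitrary reals, but the values of the functional on
-- monomials are integers. Scaling by 2^N N! and by the square of `P κ d`, the denominator of
-- homogenization, keeps all identities about it in ℤ; reals enter only through linear extension.
-- Since vanishing of a real is undecidable, what happens on the support of a polynomial is phrased
-- through collected coefficients.

-- Finite sums in a commutative semiring, used for ℝ, ℤ and ℕ.

module ListSum {c ℓ} (R : CommutativeSemiring c ℓ) where
  open CommutativeSemiring R hiding (zero) renaming (_≈_ to _≋_; refl to ≋-refl; sym to ≋-sym; trans to ≋-trans)
  open import Algebra.Properties.CommutativeSemigroup +-commutativeSemigroup using (interchange)

  ∑[_] : ∀ {a} {A : Set a} → List A → (A → Carrier) → Carrier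
  ∑[ [] ]     f = 0#
  ∑[ a ∷ as ] f = f a + ∑[ as ] f

  module _ {a} {A : Set a} where

    ∑-congAll : ∀ {as : List A} {f g} → All (λ a → f a ≋ g a) as → ∑[ as ] f ≋ ∑[ as ] g
    ∑-congAll []       = ≋-refl
    ∑-congAll (e ∷ es) = +-cong e (∑-congAll es)

    ∑-cong : ∀ (as : List A) {f g} → (∀ a → f a ≋ g a) → ∑[ as ] f ≋ ∑[ as ] g
    ∑-cong []       e = ≋-refl
    ∑-cong (a ∷ as) e = +-cong (e a) (∑-cong as e)

    ∑-zero : ∀ (as : List A) {f} → (∀ a → f a ≋ 0#) → ∑[ as ] f ≋ 0#
    ∑-zero []       e = ≋-refl
    ∑-zero (a ∷ as) e = ≋-trans (+-cong (e a) (∑-zero as e)) (+-identityˡ 0#)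

    ∑-++ : ∀ (as bs : List A) f → ∑[ as ++ bs ] f ≋ ∑[ as ] f + ∑[ bs ] f
    ∑-++ []       bs f = ≋-sym (+-identityˡ _)
    ∑-++ (a ∷ as) bs f = ≋-trans (+-cong ≋-refl (∑-++ as bs f)) (≋-sym (+-assoc _ _ _))

    ∑-*ˡ : ∀ (as : List A) f r → ∑[ as ] (λ a → r * f a) ≋ r * ∑[ as ] f
    ∑-*ˡ []       f r = ≋-sym (zeroʳ r)
    ∑-*ˡ (a ∷ as) f r = ≋-trans (+-cong ≋-refl (∑-*ˡ as f r)) (≋-sym (distribˡ r _ _))

    ∑-+ : ∀ (as : List A) f g → ∑[ as ] (λ a → f a + g a) ≋ ∑[ as ] f + ∑[ as ] g
    ∑-+ []       f g = ≋-sym (+-identityˡ 0#)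
    ∑-+ (a ∷ as) f g = ≋-trans (+-cong ≋-refl (∑-+ as f g)) (interchange _ _ _ _)

    ∑-map : ∀ {b} {B : Set b} (h : B → A) bs f → ∑[ map h bs ] f ≋ ∑[ bs ] (λ b → f (h b))
    ∑-map h []       f = ≋-refl
    ∑-map h (b ∷ bs) f = +-cong ≋-refl (∑-map h bs f)

  ∑-swap : ∀ {a b} {A : Set a} {B : Set b} (as : List A) (bs : List B) (f : A → B → Carrier) →
    ∑[ as ] (λ a → ∑[ bs ] (f a)) ≋ ∑[ bs ] (λ b → ∑[ as ] (λ a → f a b))
  ∑-swap []       bs f = ≋-sym (∑-zero bs λ _ → ≋-refl)
  ∑-swap (a ∷ as) bs f =
    ≋-trans (+-cong ≋-refl (∑-swap as bs f)) (≋-sym (∑-+ bs (f a) (λ b → ∑[ as ] (λ a → f a b))))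

  ∑ᶠ : ∀ {n} → (Fin n → Carrier) → Carrier
  ∑ᶠ {zero}  f = 0#
  ∑ᶠ {suc n} f = f zero + ∑ᶠ (f ∘ suc)

  ∑ᶠ-cong : ∀ {n} {f g : Fin n → Carrier} → (∀ i → f i ≋ g i) → ∑ᶠ f ≋ ∑ᶠ g
  ∑ᶠ-cong {zero}  e = ≋-refl
  ∑ᶠ-cong {suc n} e = +-cong (e zero) (∑ᶠ-cong (e ∘ suc))

  ∑ᶠ-zero : ∀ n → ∑ᶠ {n} (λ _ → 0#) ≋ 0#
  ∑ᶠ-zero zero    = ≋-refl
  ∑ᶠ-zero (suc n) = ≋-trans (+-identityˡ _) (∑ᶠ-zero n)

  ∑ᶠ-*ˡ : ∀ {n} c (f : Fin n → Carrier) → ∑ᶠ (λ i → c * f i) ≋ c * ∑ᶠ f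
  ∑ᶠ-*ˡ {zero}  c f = ≋-sym (zeroʳ c)
  ∑ᶠ-*ˡ {suc n} c f = ≋-trans (+-cong ≋-refl (∑ᶠ-*ˡ c (f ∘ suc))) (≋-sym (distribˡ c _ _))

  ∑ᶠ-∑ : ∀ {n} {a} {A : Set a} (as : List A) (f : A → Fin n → Carrier) →
    ∑ᶠ (λ i → ∑[ as ] (λ a → f a i)) ≋ ∑[ as ] (λ a → ∑ᶠ (f a))
  ∑ᶠ-∑ {zero}  as f = ≋-sym (∑-zero as λ _ → ≋-refl)
  ∑ᶠ-∑ {suc n} as f = ≋-trans (+-cong ≋-refl (∑ᶠ-∑ as (λ a → f a ∘ suc))) (≋-sym (∑-+ as _ _))

-- The ring of real numbers

pointwise : ∀ {x y} → (∀ n → seq x n ≡ seq y n) → x ≃ y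
pointwise {x} {y} e = mk≃ λ ε 0<ε → 0 , λ n _ →
  subst (λ d → ℚ.∣ d ∣ ℚ.< ε) (sym (trans (cong (ℚ._- seq y n) (e n)) (ℚ.+-inverseʳ (seq y n)))) 0<ε

-- Equality of reals says this about the difference of the sequences, so the congruence laws become
-- closure properties of null sequences.
Tendsto0 : (ℕ → ℚ) → Set
Tendsto0 z = ∀ ε → 0ℚ ℚ.< ε → ∃[ N ] (∀ n → N ≤ n → ℚ.∣ z n ∣ ℚ.< ε)

tendsto0-ext : ∀ {y z} → (∀ n → y n ≡ z n) → Tendsto0 y → Tendsto0 z
tendsto0-ext e h ε 0<ε with h ε 0<ε
... | N , p = N , λ n n≥ → subst (λ d → ℚ.∣ d ∣ ℚ.< ε) (e n) (p n n≥)

tendsto0-+ : ∀ {y z} → Tendsto0 y → Tendsto0 z → Tendsto0 (λ n → y n ℚ.+ z n)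
tendsto0-+ {y} {z} hy hz ε 0<ε
  with hy (½ ℚ.* ε) (half-pos 0<ε) | hz (½ ℚ.* ε) (half-pos 0<ε)
... | M , p | N , q = M ℕ.⊔ N , λ n n≥ → begin-strict
  ℚ.∣ y n ℚ.+ z n ∣           ≤⟨ ℚ.∣p+q∣≤∣p∣+∣q∣ (y n) (z n) ⟩
  ℚ.∣ y n ∣ ℚ.+ ℚ.∣ z n ∣     <⟨ ℚ.+-mono-< (p n (ℕ.m⊔n≤o⇒m≤o M N n≥)) (q n (ℕ.m⊔n≤o⇒n≤o M N n≥)) ⟩
  ½ ℚ.* ε ℚ.+ ½ ℚ.* ε         ≡⟨ half+half ε ⟩
  ε                           ∎
  where open ℚ.≤-Reasoning

-- `bounded` gives the same fact behind the abstract predicate `EventuallyBounded`, which does not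
-- unfold here, so the bound is derived again in explicit form.
eventually-bounded : ∀ x → ∃[ K ] Positive K × ∃[ N ] (∀ n → N ≤ n → ℚ.∣ seq x n ∣ ℚ.≤ K)
eventually-bounded x with cauchy x 1ℚ (ℚ.positive⁻¹ 1ℚ)
... | N , h = ℚ.∣ seq x N ∣ ℚ.+ 1ℚ
            , ℚ.nonNeg+pos⇒pos ℚ.∣ seq x N ∣ {{ℚ.∣-∣-nonNeg (seq x N)}} 1ℚ
            , N , λ n n≥ → begin
  ℚ.∣ seq x n ∣                                    ≡⟨ cong ℚ.∣_∣ (split (seq x n) (seq x N)) ⟩
  ℚ.∣ seq x N ℚ.+ (seq x n ℚ.- seq x N) ∣          ≤⟨ ℚ.∣p+q∣≤∣p∣+∣q∣ (seq x N) (seq x n ℚ.- seq x N) ⟩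
  ℚ.∣ seq x N ∣ ℚ.+ ℚ.∣ seq x n ℚ.- seq x N ∣      ≤⟨ ℚ.+-monoʳ-≤ ℚ.∣ seq x N ∣ (ℚ.<⇒≤ (h n N n≥ ℕ.≤-refl)) ⟩
  ℚ.∣ seq x N ∣ ℚ.+ 1ℚ                             ∎
  where
  open ℚ.≤-Reasoning
  split : ∀ a b → a ≡ b ℚ.+ (a ℚ.- b)
  split = solve 2 (λ a b → a := b :+ (a :- b)) refl
    where open ℚ.+-*-Solver

tendsto0-* : ∀ x {z} → Tendsto0 z → Tendsto0 (λ n → seq x n ℚ.* z n)
tendsto0-* x {z} hz ε 0<ε = go (eventually-bounded x)
  where
  combine : ∀ {K} → ∃[ M ] (∀ n → M ≤ n → ℚ.∣ seq x n ∣ ℚ.≤ K) →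
    ∃[ δ ] (0ℚ ℚ.< δ) × (∀ a d → ℚ.∣ a ∣ ℚ.≤ K → ℚ.∣ d ∣ ℚ.< δ → ℚ.∣ a ℚ.* d ∣ ℚ.< ε) →
    ∃[ N ] (∀ n → N ≤ n → ℚ.∣ seq x n ℚ.* z n ∣ ℚ.< ε)
  combine (M , b) (δ , 0<δ , small) = M ℕ.⊔ proj₁ (hz δ 0<δ) , λ n n≥ →
    small (seq x n) (z n) (b n (ℕ.m⊔n≤o⇒m≤o M _ n≥)) (proj₂ (hz δ 0<δ) n (ℕ.m⊔n≤o⇒n≤o M _ n≥))
  go : ∃[ K ] Positive K × ∃[ M ] (∀ n → M ≤ n → ℚ.∣ seq x n ∣ ℚ.≤ K) →
    ∃[ N ] (∀ n → N ≤ n → ℚ.∣ seq x n ℚ.* z n ∣ ℚ.< ε)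
  go (K , K>0 , b) = combine b (*-small K K>0 ε 0<ε)

private
  module Rearrange where
    open ℚ.+-*-Solver
    sub-swap : ∀ a b → ℚ.- (a ℚ.- b) ≡ b ℚ.- a
    sub-swap = solve 2 (λ a b → :- (a :- b) := b :- a) refl
    sub-trans : ∀ a b c → (a ℚ.- b) ℚ.+ (b ℚ.- c) ≡ a ℚ.- c
    sub-trans = solve 3 (λ a b c → (a :- b) :+ (b :- c) := a :- c) refl
    sub-+ : ∀ a b c d → (a ℚ.- b) ℚ.+ (c ℚ.- d) ≡ (a ℚ.+ c) ℚ.- (b ℚ.+ d)
    sub-+ = solve 4 (λ a b c d → (a :- b) :+ (c :- d) := (a :+ c) :- (b :+ d)) refl
    sub-* : ∀ a b c d → a ℚ.* (c ℚ.- d) ℚ.+ d ℚ.* (a ℚ.- b) ≡ a ℚ.* c ℚ.- b ℚ.* d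
    sub-* = solve 4 (λ a b c d → a :* (c :- d) :+ d :* (a :- b) := a :* c :- b :* d) refl
    sub-neg : ∀ a b → b ℚ.- a ≡ ℚ.- a ℚ.- (ℚ.- b)
    sub-neg = solve 2 (λ a b → b :- a := :- a :- (:- b)) refl

open Rearrange

≃-sym : ∀ {x y} → x ≃ y → y ≃ x
≃-sym {x} {y} (mk≃ h) = mk≃ λ ε 0<ε → proj₁ (h ε 0<ε) , λ n n≥ →
  subst (ℚ._< ε) (trans (sym (ℚ.∣-p∣≡∣p∣ _)) (cong ℚ.∣_∣ (sub-swap (seq x n) (seq y n))))
    (proj₂ (h ε 0<ε) n n≥)

≃-trans : ∀ {x y z} → x ≃ y → y ≃ z → x ≃ z
≃-trans {x} {y} {z} (mk≃ h) (mk≃ k) = mk≃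
  (tendsto0-ext (λ n → sub-trans (seq x n) (seq y n) (seq z n)) (tendsto0-+ h k))

≃-refl : ∀ {x} → x ≃ x
≃-refl = pointwise λ _ → refl

+ℝ-cong : ∀ {x y u v} → x ≃ y → u ≃ v → x +ℝ u ≃ y +ℝ v
+ℝ-cong {x} {y} {u} {v} (mk≃ h) (mk≃ k) = mk≃
  (tendsto0-ext (λ n → sub-+ (seq x n) (seq y n) (seq u n) (seq v n)) (tendsto0-+ h k))

*ℝ-cong : ∀ {x y u v} → x ≃ y → u ≃ v → x *ℝ u ≃ y *ℝ v
*ℝ-cong {x} {y} {u} {v} (mk≃ h) (mk≃ k) = mk≃
  (tendsto0-ext (λ n → sub-* (seq x n) (seq y n) (seq u n) (seq v n))
    (tendsto0-+ (tendsto0-* x k) (tendsto0-* v h)))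

-ℝ-cong : ∀ {x y} → x ≃ y → -ℝ x ≃ -ℝ y
-ℝ-cong {x} {y} h = mk≃
  (tendsto0-ext (λ n → sub-neg (seq x n) (seq y n)) (_≃_.close (≃-sym h)))

ℝ-isCommutativeRing : IsCommutativeRing _≃_ _+ℝ_ _*ℝ_ -ℝ_ 0ℝ 1ℝ
ℝ-isCommutativeRing = record
  { isRing = record
    { +-isAbelianGroup = record
      { isGroup = record
        { isMonoid = record
          { isSemigroup = record
            { isMagma = record
              { isEquivalence = record { refl = ≃-refl ; sym = ≃-sym ; trans = ≃-trans }
              ; ∙-cong = +ℝ-cong }
            ; assoc = λ x y z → pointwise λ n → ℚ.+-assoc (seq x n) (seq y n) (seq z n) }
          ; identity = (λ x → pointwise λ n → ℚ.+-identityˡ (seq x n))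
                     , (λ x → pointwise λ n → ℚ.+-identityʳ (seq x n)) }
        ; inverse = (λ x → pointwise λ n → ℚ.+-inverseˡ (seq x n))
                  , (λ x → pointwise λ n → ℚ.+-inverseʳ (seq x n))
        ; ⁻¹-cong = -ℝ-cong }
      ; comm = λ x y → pointwise λ n → ℚ.+-comm (seq x n) (seq y n) }
    ; *-cong = *ℝ-cong
    ; *-assoc = λ x y z → pointwise λ n → ℚ.*-assoc (seq x n) (seq y n) (seq z n)
    ; *-identity = (λ x → pointwise λ n → ℚ.*-identityˡ (seq x n))
                 , (λ x → pointwise λ n → ℚ.*-identityʳ (seq x n))
    ; distrib = (λ x y z → pointwise λ n → ℚ.*-distribˡ-+ (seq x n) (seq y n) (seq z n))
              , (λ x y z → pointwise λ n → ℚ.*-distribʳ-+ (seq x n) (seq y n) (seq z n)) }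
  ; *-comm = λ x y → pointwise λ n → ℚ.*-comm (seq x n) (seq y n) }

ℝ-commutativeRing : CommutativeRing 0ℓ 0ℓ
ℝ-commutativeRing = record { isCommutativeRing = ℝ-isCommutativeRing }

-- At a fixed precision ε the question is decidable: past the modulus for ε/4, comparing the single
-- term at N with ε/2 either yields the bound or refutes x ≃ 0. Stability is what turns absence from
-- a `support` into a vanishing coefficient.
≃0-stable : ∀ {x} → ¬ ¬ (x ≃ 0ℝ) → x ≃ 0ℝ
≃0-stable {x} ¬¬h = mk≃ λ ε 0<ε → go ε 0<ε (cauchy x (½ ℚ.* (½ ℚ.* ε)) (half-pos (half-pos 0<ε)))
  where
  open ℚ.≤-Reasoning
  minus0 : ∀ a → a ℚ.- 0ℚ ≡ a
  minus0 = solve 1 (λ a → a :- con 0ℚ := a) refl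
    where open ℚ.+-*-Solver
  split : ∀ a b → a ≡ b ℚ.+ (a ℚ.- b)
  split = solve 2 (λ a b → a := b :+ (a :- b)) refl
    where open ℚ.+-*-Solver
  go : ∀ ε → 0ℚ ℚ.< ε →
    ∃[ N ] (∀ m n → N ≤ m → N ≤ n → ℚ.∣ seq x m ℚ.- seq x n ∣ ℚ.< ½ ℚ.* (½ ℚ.* ε)) →
    ∃[ N ] (∀ n → N ≤ n → ℚ.∣ seq x n ℚ.- 0ℚ ∣ ℚ.< ε)
  go ε 0<ε (N , h) with ℚ.∣ seq x N ∣ ℚ.<? ½ ℚ.* ε
  ... | yes small = N , λ n n≥ → begin-strict
    ℚ.∣ seq x n ℚ.- 0ℚ ∣                            ≡⟨ cong ℚ.∣_∣ (minus0 (seq x n)) ⟩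
    ℚ.∣ seq x n ∣                                   ≡⟨ cong ℚ.∣_∣ (split (seq x n) (seq x N)) ⟩
    ℚ.∣ seq x N ℚ.+ (seq x n ℚ.- seq x N) ∣         ≤⟨ ℚ.∣p+q∣≤∣p∣+∣q∣ (seq x N) (seq x n ℚ.- seq x N) ⟩
    ℚ.∣ seq x N ∣ ℚ.+ ℚ.∣ seq x n ℚ.- seq x N ∣     <⟨ ℚ.+-mono-< small (h n N n≥ ℕ.≤-refl) ⟩
    ½ ℚ.* ε ℚ.+ ½ ℚ.* (½ ℚ.* ε)                     <⟨ ℚ.+-monoʳ-< (½ ℚ.* ε) quarter<half ⟩
    ½ ℚ.* ε ℚ.+ ½ ℚ.* ε                             ≡⟨ half+half ε ⟩
    ε                                               ∎
    where
    quarter<half : ½ ℚ.* (½ ℚ.* ε) ℚ.< ½ ℚ.* ε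
    quarter<half = begin-strict
      ½ ℚ.* (½ ℚ.* ε)                            ≡⟨ ℚ.+-identityʳ _ ⟨
      ½ ℚ.* (½ ℚ.* ε) ℚ.+ 0ℚ                     <⟨ ℚ.+-monoʳ-< (½ ℚ.* (½ ℚ.* ε)) (half-pos (half-pos 0<ε)) ⟩
      ½ ℚ.* (½ ℚ.* ε) ℚ.+ ½ ℚ.* (½ ℚ.* ε)        ≡⟨ half+half (½ ℚ.* ε) ⟩
      ½ ℚ.* ε                                    ∎
  ... | no large = ⊥-elim (¬¬h λ x≃0 → large (contra x≃0))
    where
    contra : x ≃ 0ℝ → ℚ.∣ seq x N ∣ ℚ.< ½ ℚ.* ε
    contra (mk≃ k) with k (½ ℚ.* (½ ℚ.* ε)) (half-pos (half-pos 0<ε))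
    ... | M , p = begin-strict
      ℚ.∣ seq x N ∣                                   ≡⟨ cong ℚ.∣_∣ (split (seq x N) (seq x n)) ⟩
      ℚ.∣ seq x n ℚ.+ (seq x N ℚ.- seq x n) ∣         ≤⟨ ℚ.∣p+q∣≤∣p∣+∣q∣ (seq x n) (seq x N ℚ.- seq x n) ⟩
      ℚ.∣ seq x n ∣ ℚ.+ ℚ.∣ seq x N ℚ.- seq x n ∣     <⟨ ℚ.+-mono-<
        (subst (λ a → ℚ.∣ a ∣ ℚ.< _) (minus0 (seq x n)) (p n (ℕ.m≤m⊔n M N)))
        (h N n ℕ.≤-refl (ℕ.m≤n⊔m M N)) ⟩
      ½ ℚ.* (½ ℚ.* ε) ℚ.+ ½ ℚ.* (½ ℚ.* ε)             ≡⟨ half+half (½ ℚ.* ε) ⟩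
      ½ ℚ.* ε                                         ∎
      where n = M ℕ.⊔ N

-- Integers inside the reals, and nonnegativity.

fromℤ : ℤ → ℝ
fromℤ z = fromℚ (z / 1)

private
  toℚᵘ-/1 : ∀ z → ℚ.toℚᵘ (z / 1) ℚᵘ.≃ ℚᵘ.mkℚᵘ z 0
  toℚᵘ-/1 z = ℚ.toℚᵘ-fromℚᵘ (ℚᵘ.mkℚᵘ z 0)

/1-+ : ∀ a b → (a ℤ.+ b) / 1 ≡ a / 1 ℚ.+ b / 1
/1-+ a b = ℚ.toℚᵘ-injective (begin
  ℚ.toℚᵘ ((a ℤ.+ b) / 1)                     ≈⟨ toℚᵘ-/1 (a ℤ.+ b) ⟩
  ℚᵘ.mkℚᵘ (a ℤ.+ b) 0                        ≈⟨ ℚᵘ.*≡* (cong (ℤ._* + 1) (sym (cong₂ ℤ._+_ (ℤ.*-identityʳ a) (ℤ.*-identityʳ b)))) ⟩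
  ℚᵘ.mkℚᵘ a 0 ℚᵘ.+ ℚᵘ.mkℚᵘ b 0               ≈⟨ ℚᵘ.+-cong (toℚᵘ-/1 a) (toℚᵘ-/1 b) ⟨
  ℚ.toℚᵘ (a / 1) ℚᵘ.+ ℚ.toℚᵘ (b / 1)         ≈⟨ ℚ.toℚᵘ-homo-+ (a / 1) (b / 1) ⟨
  ℚ.toℚᵘ (a / 1 ℚ.+ b / 1)                   ∎)
  where open ℚᵘ.≃-Reasoning

/1-* : ∀ a b → (a ℤ.* b) / 1 ≡ a / 1 ℚ.* (b / 1)
/1-* a b = ℚ.toℚᵘ-injective (begin
  ℚ.toℚᵘ ((a ℤ.* b) / 1)                     ≈⟨ toℚᵘ-/1 (a ℤ.* b) ⟩
  ℚᵘ.mkℚᵘ a 0 ℚᵘ.* ℚᵘ.mkℚᵘ b 0               ≈⟨ ℚᵘ.*-cong (toℚᵘ-/1 a) (toℚᵘ-/1 b) ⟨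
  ℚ.toℚᵘ (a / 1) ℚᵘ.* ℚ.toℚᵘ (b / 1)         ≈⟨ ℚ.toℚᵘ-homo-* (a / 1) (b / 1) ⟨
  ℚ.toℚᵘ (a / 1 ℚ.* (b / 1))                 ∎)
  where open ℚᵘ.≃-Reasoning

fromℤ-+ : ∀ a b → fromℤ (a ℤ.+ b) ≃ fromℤ a +ℝ fromℤ b
fromℤ-+ a b = pointwise λ _ → /1-+ a b

fromℤ-* : ∀ a b → fromℤ (a ℤ.* b) ≃ fromℤ a *ℝ fromℤ b
fromℤ-* a b = pointwise λ _ → /1-* a b

module ∑ℝ = ListSum (CommutativeRing.commutativeSemiring ℝ-commutativeRing)
module ∑ℤ = ListSum ℤ.+-*-commutativeSemiring
module ∑ⁿ = ListSum ℕ.+-*-commutativeSemiring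

fromℤ-∑ : ∀ {a} {A : Set a} (as : List A) f →
  fromℤ (∑ℤ.∑[ as ] f) ≃ ∑ℝ.∑[ as ] (λ a → fromℤ (f a))
fromℤ-∑ []       f = ≃-refl
fromℤ-∑ (a ∷ as) f = ≃-trans (fromℤ-+ (f a) _) (+ℝ-cong ≃-refl (fromℤ-∑ as f))

-- Termwise nonnegativity of the chosen sequence is stronger than x ≥ 0 and not invariant under `≃`.
-- It holds literally for squares and for integer constants, so a limit is needed only in the final
-- comparison with a negative number.
Nonneg : ℝ → Set
Nonneg x = ∀ n → 0ℚ ℚ.≤ seq x n

+-nonneg : ∀ x y → Nonneg x → Nonneg y → Nonneg (x +ℝ y)
+-nonneg x y hx hy n = subst (ℚ._≤ (seq x n ℚ.+ seq y n)) (ℚ.+-identityˡ 0ℚ) (ℚ.+-mono-≤ (hx n) (hy n))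

*-nonneg : ∀ x y → Nonneg x → Nonneg y → Nonneg (x *ℝ y)
*-nonneg x y hx hy n = ℚ.nonNegative⁻¹ _
  {{ℚ.nonNeg*nonNeg⇒nonNeg (seq x n) {{ℚ.nonNegative (hx n)}} (seq y n) {{ℚ.nonNegative (hy n)}}}}

square-nonneg : ∀ x → Nonneg (x *ℝ x)
square-nonneg x n with ℚ.≤-total 0ℚ (seq x n)
... | inj₁ 0≤a = *-nonneg (fromℚ (seq x n)) (fromℚ (seq x n)) (λ _ → 0≤a) (λ _ → 0≤a) n
... | inj₂ a≤0 = ℚ.nonNegative⁻¹ _
  {{ℚ.nonPos*nonPos⇒nonPos (seq x n) {{ℚ.nonPositive a≤0}} (seq x n) {{ℚ.nonPositive a≤0}}}}

∑-nonneg : ∀ {a} {A : Set a} (as : List A) {f} → (∀ a → Nonneg (f a)) → Nonneg (∑ℝ.∑[ as ] f)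
∑-nonneg []       h n = ℚ.≤-refl
∑-nonneg (a ∷ as) {f} h n = +-nonneg (f a) (∑ℝ.∑[ as ] f) (h a) (∑-nonneg as h) n

fromℤ-nonneg : ∀ {z} → + 0 ℤ.≤ z → Nonneg (fromℤ z)
fromℤ-nonneg {+ m} _ n = ℚ.nonNegative⁻¹ _ {{ℚ.normalize-nonNeg m 1}}

-- A nonnegative term is at distance at least l from -l, while closeness with ε = l would produce
-- one that is nearer.
nonneg⇒≄negative : ∀ {l x} → Nonneg x → 0ℚ ℚ.< l → fromℚ (ℚ.- l) ≃ x → ⊥
nonneg⇒≄negative {l} {x} x≥0 0<l (mk≃ h) = go (h l 0<l)
  where
  open ℚ.≤-Reasoning
  go : ∃[ N ] (∀ n → N ≤ n → ℚ.∣ ℚ.- l ℚ.- seq x n ∣ ℚ.< l) → ⊥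
  go (N , close) = ℚ.<-irrefl refl (begin-strict
    l                                ≡⟨ ℚ.+-identityʳ l ⟨
    l ℚ.+ 0ℚ                         ≤⟨ ℚ.+-monoʳ-≤ l (x≥0 N) ⟩
    l ℚ.+ seq x N                    ≡⟨ ℚ.0≤p⇒∣p∣≡p (ℚ.≤-trans (x≥0 N)
      (subst (ℚ._≤ l ℚ.+ seq x N) (ℚ.+-identityˡ (seq x N)) (ℚ.+-monoˡ-≤ (seq x N) (ℚ.<⇒≤ 0<l)))) ⟨
    ℚ.∣ l ℚ.+ seq x N ∣              ≡⟨ ℚ.∣-p∣≡∣p∣ (l ℚ.+ seq x N) ⟨
    ℚ.∣ ℚ.- (l ℚ.+ seq x N) ∣        ≡⟨ cong ℚ.∣_∣ (ℚ.neg-distrib-+ l (seq x N)) ⟩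
    ℚ.∣ ℚ.- l ℚ.- seq x N ∣          <⟨ close N ℕ.≤-refl ⟩
    l                                ∎)

-- Linear functionals on formal polynomials.

module LinearFunctionals where

  module ℝ-Ring where
    open CommutativeRing ℝ-commutativeRing public
      using (setoid; ring; +-group; +-commutativeSemigroup; +-assoc; +-comm; +-identityˡ; +-identityʳ; -‿inverseʳ;
             *-assoc; *-comm; *-identityˡ; zeroˡ; zeroʳ; distribˡ; distribʳ)
    open import Algebra.Properties.Ring ring public using (-‿distribˡ-*; -‿distribʳ-*; -0#≈0#; -‿+-comm)
    open import Algebra.Properties.Group +-group public using (x∙y⁻¹≈ε⇒x≈y)
    open import Relation.Binary.Reasoning.Setoid setoid public

  open ℝ-Ring

  module _ {v : ℕ} where

    Lin : (Monomial v → ℝ) → Poly v → ℝ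
    Lin φ p = ∑ℝ.∑[ p ] λ (c , a) → c *ℝ φ a

    Lin-cong : ∀ {φ ψ} → (∀ a → φ a ≃ ψ a) → ∀ p → Lin φ p ≃ Lin ψ p
    Lin-cong e p = ∑ℝ.∑-cong p λ (c , a) → *ℝ-cong ≃-refl (e a)

    Lin-zero : ∀ {φ} → (∀ a → φ a ≃ 0ℝ) → ∀ p → Lin φ p ≃ 0ℝ
    Lin-zero e p = ∑ℝ.∑-zero p λ (c , a) → ≃-trans (*ℝ-cong ≃-refl (e a)) (zeroʳ c)

    Lin-+ₚ : ∀ φ p q → Lin φ (p +ₚ q) ≃ Lin φ p +ℝ Lin φ q
    Lin-+ₚ φ p q = ∑ℝ.∑-++ p q _

    Lin-neg : ∀ φ p → Lin φ (-ₚ p) ≃ -ℝ Lin φ p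
    Lin-neg φ []            = ≃-sym -0#≈0#
    Lin-neg φ ((c , a) ∷ p) = begin
      -ℝ c *ℝ φ a +ℝ Lin φ (-ₚ p)        ≈⟨ +ℝ-cong (≃-sym (-‿distribˡ-* c (φ a))) (Lin-neg φ p) ⟩
      -ℝ (c *ℝ φ a) +ℝ -ℝ Lin φ p        ≈⟨ -‿+-comm (c *ℝ φ a) (Lin φ p) ⟩
      -ℝ (c *ℝ φ a +ℝ Lin φ p)           ∎

    Lin--ₚ : ∀ φ p q → Lin φ (p -ₚ q) ≃ Lin φ p +ℝ -ℝ Lin φ q
    Lin--ₚ φ p q = ≃-trans (Lin-+ₚ φ p (-ₚ q)) (+ℝ-cong ≃-refl (Lin-neg φ q))

    Lin-*ₚ : ∀ φ p q → Lin φ (p *ₚ q) ≃ Lin (λ a → Lin (λ b → φ (zipWith ℕ._+_ a b)) q) p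
    Lin-*ₚ φ []            q = ≃-refl
    Lin-*ₚ φ ((c , a) ∷ p) q = ≃-trans (Lin-+ₚ φ (map times q) (p *ₚ q)) (+ℝ-cong head (Lin-*ₚ φ p q))
      where
      times : ℝ × Monomial v → ℝ × Monomial v
      times (d , b) = c *ℝ d , zipWith ℕ._+_ a b
      head : Lin φ (map times q) ≃ c *ℝ Lin (λ b → φ (zipWith ℕ._+_ a b)) q
      head = begin
        Lin φ (map times q)
          ≈⟨ ∑ℝ.∑-map times q _ ⟩
        ∑ℝ.∑[ q ] (λ (d , b) → c *ℝ d *ℝ φ (zipWith ℕ._+_ a b))
          ≈⟨ ∑ℝ.∑-cong q (λ (d , b) → *-assoc c d _) ⟩
        ∑ℝ.∑[ q ] (λ (d , b) → c *ℝ (d *ℝ φ (zipWith ℕ._+_ a b)))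
          ≈⟨ ∑ℝ.∑-*ˡ q _ c ⟩
        c *ℝ Lin (λ b → φ (zipWith ℕ._+_ a b)) q
          ∎

    Lin-scale : ∀ x φ p → Lin (λ a → x *ℝ φ a) p ≃ x *ℝ Lin φ p
    Lin-scale x φ p = ≃-trans (∑ℝ.∑-cong p λ (c , a) → swap c (φ a)) (∑ℝ.∑-*ˡ p _ x)
      where
      swap : ∀ c y → c *ℝ (x *ℝ y) ≃ x *ℝ (c *ℝ y)
      swap c y = ≃-trans (≃-sym (*-assoc c x y)) (≃-trans (*ℝ-cong (*-comm c x) ≃-refl) (*-assoc x c y))

    Lin-∑ : ∀ {a} {A : Set a} (as : List A) (φ : A → Monomial v → ℝ) p →
      Lin (λ m → ∑ℝ.∑[ as ] (λ a → φ a m)) p ≃ ∑ℝ.∑[ as ] (λ a → Lin (φ a) p)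
    Lin-∑ as φ p = ≃-trans
      (∑ℝ.∑-cong p λ (c , m) → ≃-sym (∑ℝ.∑-*ˡ as (λ a → φ a m) c))
      (∑ℝ.∑-swap p as λ (c , m) a → c *ℝ φ a m)

    -- Removes every copy of a monomial at once, so that a formal sum can be collected monomial by
    -- monomial.
    erase : Monomial v → Poly v → Poly v
    erase m []            = []
    erase m ((c , a) ∷ p) = if does (≡-dec ℕ._≟_ a m) then erase m p else (c , a) ∷ erase m p

    length-erase : ∀ m p → length (erase m p) ≤ length p
    length-erase m []            = ℕ.z≤n
    length-erase m ((c , a) ∷ p) with ≡-dec ℕ._≟_ a m
    ... | yes _ = ℕ.m≤n⇒m≤1+n (length-erase m p)
    ... | no  _ = ℕ.s≤s (length-erase m p)

    coeff-erase-≡ : ∀ m p → coeff (erase m p) m ≡ 0ℝ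
    coeff-erase-≡ m []            = refl
    coeff-erase-≡ m ((c , a) ∷ p) with ≡-dec ℕ._≟_ a m
    ... | yes _ = coeff-erase-≡ m p
    ... | no a≢m with ≡-dec ℕ._≟_ a m
    ...   | yes a≡m = ⊥-elim (a≢m a≡m)
    ...   | no _    = coeff-erase-≡ m p

    coeff-erase-≢ : ∀ m {m′} p → (m ≡ m′ → ⊥) → coeff (erase m p) m′ ≡ coeff p m′
    coeff-erase-≢ m      []            m≢ = refl
    coeff-erase-≢ m {m′} ((c , a) ∷ p) m≢ with ≡-dec ℕ._≟_ a m
    ... | yes refl with ≡-dec ℕ._≟_ a m′
    ...   | yes a≡m′ = ⊥-elim (m≢ a≡m′)
    ...   | no _     = coeff-erase-≢ m p m≢
    coeff-erase-≢ m {m′} ((c , a) ∷ p) m≢ | no _ with ≡-dec ℕ._≟_ a m′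
    ... | yes _ = cong (c +ℝ_) (coeff-erase-≢ m p m≢)
    ... | no _  = coeff-erase-≢ m p m≢

    Lin-erase : ∀ φ m p → Lin φ p ≃ coeff p m *ℝ φ m +ℝ Lin φ (erase m p)
    Lin-erase φ m [] = ≃-sym (≃-trans (+-identityʳ (0ℝ *ℝ φ m)) (zeroˡ (φ m)))
    Lin-erase φ m ((c , a) ∷ p) = go (≡-dec ℕ._≟_ a m)
      where
      open import Algebra.Properties.CommutativeSemigroup +-commutativeSemigroup using (x∙yz≈y∙xz)
      go : (a≟m : Dec (a ≡ m)) → Lin φ ((c , a) ∷ p)
        ≃ (if does a≟m then c +ℝ coeff p m else coeff p m) *ℝ φ m
          +ℝ Lin φ (if does a≟m then erase m p else (c , a) ∷ erase m p)
      go (yes refl) = begin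
        c *ℝ φ a +ℝ Lin φ p                                      ≈⟨ +ℝ-cong ≃-refl (Lin-erase φ a p) ⟩
        c *ℝ φ a +ℝ (coeff p a *ℝ φ a +ℝ Lin φ (erase a p))      ≈⟨ +-assoc (c *ℝ φ a) (coeff p a *ℝ φ a) (Lin φ (erase a p)) ⟨
        c *ℝ φ a +ℝ coeff p a *ℝ φ a +ℝ Lin φ (erase a p)        ≈⟨ +ℝ-cong (≃-sym (distribʳ (φ a) c (coeff p a))) ≃-refl ⟩
        (c +ℝ coeff p a) *ℝ φ a +ℝ Lin φ (erase a p)             ∎
      go (no _) = begin
        c *ℝ φ a +ℝ Lin φ p                                      ≈⟨ +ℝ-cong ≃-refl (Lin-erase φ m p) ⟩
        c *ℝ φ a +ℝ (coeff p m *ℝ φ m +ℝ Lin φ (erase m p))      ≈⟨ x∙yz≈y∙xz (c *ℝ φ a) (coeff p m *ℝ φ m) (Lin φ (erase m p)) ⟩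
        coeff p m *ℝ φ m +ℝ (c *ℝ φ a +ℝ Lin φ (erase m p))      ∎

    -- `Lin` runs over uncollected terms while the hypothesis speaks of collected coefficients.
    -- Erasing all copies of the head monomial bridges the two; the recursion is on a length bound
    -- because the erased list is not a structural part of `p`.
    Lin-vanish : ∀ φ p → (∀ m → coeff p m *ℝ φ m ≃ 0ℝ) → Lin φ p ≃ 0ℝ
    Lin-vanish φ p h = go (length p) p ℕ.≤-refl h
      where
      go : ∀ n p → length p ≤ n → (∀ m → coeff p m *ℝ φ m ≃ 0ℝ) → Lin φ p ≃ 0ℝ
      go n       []            _            h = ≃-refl
      go (suc n) ((c , a) ∷ p) (ℕ.s≤s p≤n) h = begin
        Lin φ q                                        ≈⟨ Lin-erase φ a q ⟩
        coeff q a *ℝ φ a +ℝ Lin φ (erase a q)          ≈⟨ +ℝ-cong (h a) (go n (erase a q) short h′) ⟩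
        0ℝ +ℝ 0ℝ                                       ≈⟨ +-identityˡ 0ℝ ⟩
        0ℝ                                             ∎
        where
        q : Poly v
        q = (c , a) ∷ p
        short : length (erase a q) ≤ n
        short with ≡-dec ℕ._≟_ a a
        ... | yes _  = ℕ.≤-trans (length-erase a p) p≤n
        ... | no a≢a = ⊥-elim (a≢a refl)
        h′ : ∀ m → coeff (erase a q) m *ℝ φ m ≃ 0ℝ
        h′ m with ≡-dec ℕ._≟_ a m
        ... | yes refl = subst (λ x → x *ℝ φ a ≃ 0ℝ) (sym (coeff-erase-≡ a q)) (zeroˡ (φ a))
        ... | no a≢m   = subst (λ x → x *ℝ φ m ≃ 0ℝ) (sym (coeff-erase-≢ a q a≢m)) (h m)

    coeff-+ₚ : ∀ (p q : Poly v) m → coeff (p +ₚ q) m ≃ coeff p m +ℝ coeff q m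
    coeff-+ₚ []            q m = ≃-sym (+-identityˡ (coeff q m))
    coeff-+ₚ ((c , a) ∷ p) q m with ≡-dec ℕ._≟_ a m
    ... | yes _ = ≃-trans (+ℝ-cong ≃-refl (coeff-+ₚ p q m)) (≃-sym (+-assoc c (coeff p m) (coeff q m)))
    ... | no  _ = coeff-+ₚ p q m

    coeff-neg : ∀ (p : Poly v) m → coeff (-ₚ p) m ≃ -ℝ coeff p m
    coeff-neg []            m = ≃-sym -0#≈0#
    coeff-neg ((c , a) ∷ p) m with ≡-dec ℕ._≟_ a m
    ... | yes _ = ≃-trans (+ℝ-cong ≃-refl (coeff-neg p m)) (-‿+-comm c (coeff p m))
    ... | no  _ = coeff-neg p m

    Lin-≈ : ∀ φ {p q} → p ≈ q → Lin φ p ≃ Lin φ q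
    Lin-≈ φ {p} {q} (mk≈ p≈q) = x∙y⁻¹≈ε⇒x≈y (Lin φ p) (Lin φ q)
      (≃-trans (≃-sym (Lin--ₚ φ p q)) (Lin-vanish φ (p -ₚ q) vanish))
      where
      vanish : ∀ m → coeff (p -ₚ q) m *ℝ φ m ≃ 0ℝ
      vanish m = begin
        coeff (p -ₚ q) m *ℝ φ m                  ≈⟨ *ℝ-cong (coeff-+ₚ p (-ₚ q) m) ≃-refl ⟩
        (coeff p m +ℝ coeff (-ₚ q) m) *ℝ φ m     ≈⟨ *ℝ-cong (+ℝ-cong (p≈q m) (coeff-neg q m)) ≃-refl ⟩
        (coeff q m +ℝ -ℝ coeff q m) *ℝ φ m       ≈⟨ *ℝ-cong (-‿inverseʳ (coeff q m)) ≃-refl ⟩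
        0ℝ *ℝ φ m                                ≈⟨ zeroˡ (φ m) ⟩
        0ℝ                                       ∎

    -- The two functionals need to agree only where the coefficient does not vanish. The alternative
    -- is handed in as data because it cannot be decided for a real coefficient; the finite supports
    -- provide it later.
    Lin-cong-supp : ∀ φ ψ p → (∀ m → coeff p m ≃ 0ℝ ⊎ φ m ≃ ψ m) → Lin φ p ≃ Lin ψ p
    Lin-cong-supp φ ψ p h = x∙y⁻¹≈ε⇒x≈y (Lin φ p) (Lin ψ p) (begin
      Lin φ p +ℝ -ℝ Lin ψ p                   ≈⟨ +ℝ-cong ≃-refl (≃-sym (Lin-neg ψ p)) ⟩
      Lin φ p +ℝ Lin ψ (-ₚ p)                 ≈⟨ +ℝ-cong ≃-refl (∑ℝ.∑-map _ p _) ⟩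
      Lin φ p +ℝ ∑ℝ.∑[ p ] (λ (c , a) → -ℝ c *ℝ ψ a)            ≈⟨ ∑ℝ.∑-+ p _ _ ⟨
      ∑ℝ.∑[ p ] (λ (c , a) → c *ℝ φ a +ℝ -ℝ c *ℝ ψ a)           ≈⟨ ∑ℝ.∑-cong p (λ (c , a) → collect c a) ⟩
      Lin (λ a → φ a +ℝ -ℝ ψ a) p             ≈⟨ Lin-vanish _ p vanish ⟩
      0ℝ                                      ∎)
      where
      collect : ∀ c a → c *ℝ φ a +ℝ -ℝ c *ℝ ψ a ≃ c *ℝ (φ a +ℝ -ℝ ψ a)
      collect c a = begin
        c *ℝ φ a +ℝ -ℝ c *ℝ ψ a         ≈⟨ +ℝ-cong ≃-refl (≃-sym (-‿distribˡ-* c (ψ a))) ⟩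
        c *ℝ φ a +ℝ -ℝ (c *ℝ ψ a)       ≈⟨ +ℝ-cong ≃-refl (-‿distribʳ-* c (ψ a)) ⟩
        c *ℝ φ a +ℝ c *ℝ (-ℝ ψ a)       ≈⟨ distribˡ c (φ a) (-ℝ ψ a) ⟨
        c *ℝ (φ a +ℝ -ℝ ψ a)            ∎
      vanish : ∀ m → coeff p m *ℝ (φ m +ℝ -ℝ ψ m) ≃ 0ℝ
      vanish m = cases (h m)
        where
        cases : coeff p m ≃ 0ℝ ⊎ φ m ≃ ψ m → coeff p m *ℝ (φ m +ℝ -ℝ ψ m) ≃ 0ℝ
        cases (inj₁ c≃0) = ≃-trans (*ℝ-cong c≃0 ≃-refl) (zeroˡ (φ m +ℝ -ℝ ψ m))
        cases (inj₂ φ≃ψ) = ≃-trans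
          (*ℝ-cong ≃-refl (≃-trans (+ℝ-cong φ≃ψ ≃-refl) (-‿inverseʳ (ψ m)))) (zeroʳ (coeff p m))

    -- A Gram representation of φ on the support of p makes φ (p²) a weighted sum of squares.
    Lin-square : ∀ {A : Set} (φ : Monomial v → ℝ) (Ks : List A) (c : A → ℝ) (w : A → Monomial v → ℝ) (G : Monomial v → Set) →
      (∀ a b → G a → G b → φ (zipWith ℕ._+_ a b) ≃ ∑ℝ.∑[ Ks ] (λ K → c K *ℝ (w K a *ℝ w K b))) →
      ∀ p → (∀ m → coeff p m ≃ 0ℝ ⊎ G m) →
      Lin φ (p *ₚ p) ≃ ∑ℝ.∑[ Ks ] (λ K → c K *ℝ (Lin (w K) p *ℝ Lin (w K) p))
    Lin-square φ Ks c w G gram p supp = begin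
      Lin φ (p *ₚ p)
        ≈⟨ Lin-*ₚ φ p p ⟩
      Lin (λ a → Lin (λ b → φ (zipWith ℕ._+_ a b)) p) p
        ≈⟨ Lin-cong-supp Φ Ψ p (λ a → outer a (supp a)) ⟩
      Lin (λ a → Lin (λ b → ∑ℝ.∑[ Ks ] (λ K → c K *ℝ (w K a *ℝ w K b))) p) p
        ≈⟨ Lin-cong (λ a → Lin-∑ Ks (λ K b → c K *ℝ (w K a *ℝ w K b)) p) p ⟩
      Lin (λ a → ∑ℝ.∑[ Ks ] (λ K → Lin (λ b → c K *ℝ (w K a *ℝ w K b)) p)) p
        ≈⟨ Lin-∑ Ks (λ K a → Lin (λ b → c K *ℝ (w K a *ℝ w K b)) p) p ⟩
      ∑ℝ.∑[ Ks ] (λ K → Lin (λ a → Lin (λ b → c K *ℝ (w K a *ℝ w K b)) p) p)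
        ≈⟨ ∑ℝ.∑-cong Ks factor ⟩
      ∑ℝ.∑[ Ks ] (λ K → c K *ℝ (Lin (w K) p *ℝ Lin (w K) p))
        ∎
      where
      form : Monomial v → Monomial v → ℝ
      form a b = ∑ℝ.∑[ Ks ] (λ K → c K *ℝ (w K a *ℝ w K b))
      Φ Ψ : Monomial v → ℝ
      Φ a = Lin (λ b → φ (zipWith ℕ._+_ a b)) p
      Ψ a = Lin (form a) p
      outer : ∀ a → coeff p a ≃ 0ℝ ⊎ G a → coeff p a ≃ 0ℝ ⊎ Φ a ≃ Ψ a
      outer a (inj₁ z) = inj₁ z
      outer a (inj₂ g) = inj₂ (Lin-cong-supp (λ b → φ (zipWith ℕ._+_ a b)) (form a) p λ b → inner b (supp b))
        where
        inner : ∀ b → coeff p b ≃ 0ℝ ⊎ G b → coeff p b ≃ 0ℝ ⊎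
          φ (zipWith ℕ._+_ a b) ≃ form a b
        inner b (inj₁ z) = inj₁ z
        inner b (inj₂ h) = inj₂ (gram a b g h)
      factor : ∀ K → Lin (λ a → Lin (λ b → c K *ℝ (w K a *ℝ w K b)) p) p ≃ c K *ℝ (Lin (w K) p *ℝ Lin (w K) p)
      factor K = begin
        Lin (λ a → Lin (λ b → c K *ℝ (w K a *ℝ w K b)) p) p
          ≈⟨ Lin-cong inner p ⟩
        Lin (λ a → c K *ℝ (Lin (w K) p *ℝ w K a)) p
          ≈⟨ Lin-scale (c K) (λ a → Lin (w K) p *ℝ w K a) p ⟩
        c K *ℝ Lin (λ a → Lin (w K) p *ℝ w K a) p
          ≈⟨ *ℝ-cong ≃-refl (Lin-scale (Lin (w K) p) (w K) p) ⟩
        c K *ℝ (Lin (w K) p *ℝ Lin (w K) p)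
          ∎
        where
        inner : ∀ a → Lin (λ b → c K *ℝ (w K a *ℝ w K b)) p ≃ c K *ℝ (Lin (w K) p *ℝ w K a)
        inner a = begin
          Lin (λ b → c K *ℝ (w K a *ℝ w K b)) p     ≈⟨ Lin-scale (c K) (λ b → w K a *ℝ w K b) p ⟩
          c K *ℝ Lin (λ b → w K a *ℝ w K b) p       ≈⟨ *ℝ-cong ≃-refl (Lin-scale (w K a) (w K) p) ⟩
          c K *ℝ (w K a *ℝ Lin (w K) p)             ≈⟨ *ℝ-cong ≃-refl (*-comm (w K a) (Lin (w K) p)) ⟩
          c K *ℝ (Lin (w K) p *ℝ w K a)             ∎

    Lin-sumOfSquares : ∀ {A : Set} (φ : Monomial v → ℝ) (Ks : List A) (c : A → ℝ) (w : A → Monomial v → ℝ) (G : Monomial v → Set) →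
      (∀ a b → G a → G b → φ (zipWith ℕ._+_ a b) ≃ ∑ℝ.∑[ Ks ] (λ K → c K *ℝ (w K a *ℝ w K b))) →
      ∀ rs → All (λ r → ∀ m → coeff r m ≃ 0ℝ ⊎ G m) rs →
      Lin φ (sumOfSquares rs) ≃ ∑ℝ.∑[ rs ] (λ r → ∑ℝ.∑[ Ks ] (λ K → c K *ℝ (Lin (w K) r *ℝ Lin (w K) r)))
    Lin-sumOfSquares φ Ks c w G gram []       []         = ≃-refl
    Lin-sumOfSquares φ Ks c w G gram (r ∷ rs) (s ∷ supp) = ≃-trans
      (Lin-+ₚ φ (r *ₚ r) (sumOfSquares rs))
      (+ℝ-cong (Lin-square φ Ks c w G gram r s) (Lin-sumOfSquares φ Ks c w G gram rs supp))

    Lin-∑ₚ : ∀ φ {k} (p : Vector.Vector (Poly v) k) → (∀ i → Lin φ (p i) ≃ 0ℝ) → Lin φ (∑ p) ≃ 0ℝ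
    Lin-∑ₚ φ {zero}  p h = ≃-refl
    Lin-∑ₚ φ {suc k} p h = begin
      Lin φ (p zero +ₚ ∑ (p ∘ suc))              ≈⟨ Lin-+ₚ φ (p zero) (∑ (p ∘ suc)) ⟩
      Lin φ (p zero) +ℝ Lin φ (∑ (p ∘ suc))      ≈⟨ +ℝ-cong (h zero) (Lin-∑ₚ φ (p ∘ suc) (h ∘ suc)) ⟩
      0ℝ +ℝ 0ℝ                                   ≈⟨ +-identityˡ 0ℝ ⟩
      0ℝ                                         ∎

  -- Applying φ to the identity leaves -φ(1) equal to a nonnegative sum, a contradiction once φ(1) >
  -- 0. `G` collects the monomials on which the Gram form and the knapsack relation are known; the
  -- axioms in `B n` have to be annihilated after multiplication by every monomial, since nothing
  -- bounds their multipliers.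
  no-refutation : ∀ {n k} {A : Set} (φ : Monomial (n ℕ.+ n) → ℝ) (Ks : List A) (c : A → ℝ)
    (w : A → Monomial (n ℕ.+ n) → ℝ) (G : Monomial (n ℕ.+ n) → Set) (π : KSRefutation n k) →
    (∀ K → Nonneg (c K)) →
    (∀ a b → G a → G b → φ (zipWith ℕ._+_ a b) ≃ ∑ℝ.∑[ Ks ] (λ K → c K *ℝ (w K a *ℝ w K b))) →
    (∀ i a → Lin (λ b → φ (zipWith ℕ._+_ a b)) (B n i) ≃ 0ℝ) →
    (∀ a → G a → Lin (λ b → φ (zipWith ℕ._+_ a b)) (knapsack n k) ≃ 0ℝ) →
    All (λ r → ∀ m → coeff r m ≃ 0ℝ ⊎ G m) (SOSRefutation.r₀ π) →
    (∀ m → coeff (SOSRefutation.t π zero) m ≃ 0ℝ ⊎ G m) →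
    ∀ l → 0ℚ ℚ.< l → φ (replicate (n ℕ.+ n) 0) ≃ fromℚ l → ⊥
  no-refutation {n} {k} φ Ks c w G π c≥0 gram boolean kn r-good t-good l 0<l φ1≃l = nonneg⇒≄negative S≥0 0<l -l≃S
    where
    open SOSRefutation π
    S : ℝ
    S = ∑ℝ.∑[ r₀ ] λ r → ∑ℝ.∑[ Ks ] (λ K → c K *ℝ (Lin (w K) r *ℝ Lin (w K) r))
    S≥0 : Nonneg S
    S≥0 = ∑-nonneg r₀ λ r → ∑-nonneg Ks λ K → *-nonneg (c K) (Lin (w K) r *ℝ Lin (w K) r) (c≥0 K) (square-nonneg (Lin (w K) r))
    t-vanish : ∀ m → coeff (t zero) m ≃ 0ℝ ⊎ G m →
      coeff (t zero) m ≃ 0ℝ ⊎ Lin (λ b → φ (zipWith ℕ._+_ m b)) (knapsack n k) ≃ 0ℝ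
    t-vanish m (inj₁ z) = inj₁ z
    t-vanish m (inj₂ g) = inj₂ (kn m g)
    T : Poly (n ℕ.+ n)
    T = ∑ (λ j → t j *ₚ (knapsack n k Vector.∷ Vector.[]) j)
    T≃0 : Lin φ T ≃ 0ℝ
    T≃0 = Lin-∑ₚ φ (λ j → t j *ₚ (knapsack n k Vector.∷ Vector.[]) j) λ where
      zero → begin
        Lin φ (t zero *ₚ knapsack n k)   ≈⟨ Lin-*ₚ φ (t zero) (knapsack n k) ⟩
        Lin (λ m → Lin (λ b → φ (zipWith ℕ._+_ m b)) (knapsack n k)) (t zero)
          ≈⟨ Lin-cong-supp (λ m → Lin (λ b → φ (zipWith ℕ._+_ m b)) (knapsack n k)) (λ _ → 0ℝ) (t zero) (λ m → t-vanish m (t-good m)) ⟩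
        Lin (λ _ → 0ℝ) (t zero)           ≈⟨ Lin-zero (λ _ → ≃-refl) (t zero) ⟩
        0ℝ                                ∎
    U : Poly (n ℕ.+ n)
    U = ∑ (λ i → u i *ₚ B n i)
    U≃0 : Lin φ U ≃ 0ℝ
    U≃0 = Lin-∑ₚ φ _ λ i → ≃-trans (Lin-*ₚ φ (u i) (B n i)) (Lin-zero (boolean i) (u i))
    -l≃S : fromℚ (ℚ.- l) ≃ S
    -l≃S = begin
      fromℚ (ℚ.- l)                                      ≈⟨ pointwise (λ _ → trans (sym (ℚ.neg-distribˡ-* 1ℚ l)) (cong ℚ.-_ (ℚ.*-identityˡ l))) ⟨
      -ℝ 1ℝ *ℝ fromℚ l                                    ≈⟨ *ℝ-cong ≃-refl φ1≃l ⟨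
      -ℝ 1ℝ *ℝ φ (replicate (n ℕ.+ n) 0)                  ≈⟨ +-identityʳ _ ⟨
      Lin φ (const (-ℝ 1ℝ))                               ≈⟨ Lin-≈ φ identity ⟩
      -- The summand `0ₚ` is the empty sum over inequality constraints.
      Lin φ (sumOfSquares r₀ +ₚ 0ₚ +ₚ T +ₚ U)             ≈⟨ Lin-+ₚ φ (sumOfSquares r₀ +ₚ 0ₚ +ₚ T) U ⟩
      Lin φ (sumOfSquares r₀ +ₚ 0ₚ +ₚ T) +ℝ Lin φ U       ≈⟨ +ℝ-cong (Lin-+ₚ φ (sumOfSquares r₀ +ₚ 0ₚ) T) U≃0 ⟩
      Lin φ (sumOfSquares r₀ +ₚ 0ₚ) +ℝ Lin φ T +ℝ 0ℝ      ≈⟨ +-identityʳ _ ⟩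
      Lin φ (sumOfSquares r₀ +ₚ 0ₚ) +ℝ Lin φ T            ≈⟨ +ℝ-cong (Lin-+ₚ φ (sumOfSquares r₀) 0ₚ) T≃0 ⟩
      Lin φ (sumOfSquares r₀) +ℝ 0ℝ +ℝ 0ℝ                 ≈⟨ +-identityʳ _ ⟩
      Lin φ (sumOfSquares r₀) +ℝ 0ℝ                       ≈⟨ +-identityʳ _ ⟩
      Lin φ (sumOfSquares r₀)                             ≈⟨ Lin-sumOfSquares φ Ks c w G gram r₀ r-good ⟩
      S                                                   ∎

open LinearFunctionals

-- Monomials modulo the Boolean axioms, and the restricted functional.

module PseudoExpectation where

  open import Data.Integer.Base using (_+_; _-_; _*_)
  open import Data.Integer.Tactic.RingSolver using (solve-∀)
  open ∑ℤ

  ∑ᶠ-- : ∀ {n} (f g : Fin n → ℤ) → ∑ᶠ (λ i → f i - g i) ≡ ∑ᶠ f - ∑ᶠ g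
  ∑ᶠ-- {zero}  f g = refl
  ∑ᶠ-- {suc n} f g = trans (cong (λ u → f zero - g zero + u) (∑ᶠ-- (f ∘ suc) (g ∘ suc))) (rearrange (f zero) (g zero) _ _)
    where
    rearrange : ∀ a b c d → a - b + (c - d) ≡ (a + c) - (b + d)
    rearrange = solve-∀

  -- Modulo the Boolean axioms, a monomial only matters through which of the twin variables xᵢ, x̄ᵢ
  -- occur in it, for each i.

  data State : Set where
    none pos neg both : State

  infixl 6 _⊔ˢ_ _∨_

  _⊔ˢ_ : State → State → State
  none ⊔ˢ t    = t
  pos  ⊔ˢ none = pos
  pos  ⊔ˢ pos  = pos
  pos  ⊔ˢ neg  = both
  pos  ⊔ˢ both = both
  neg  ⊔ˢ none = neg
  neg  ⊔ˢ pos  = both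
  neg  ⊔ˢ neg  = neg
  neg  ⊔ˢ both = both
  both ⊔ˢ t    = both

  ⊔ˢ-comm : ∀ s t → s ⊔ˢ t ≡ t ⊔ˢ s
  ⊔ˢ-comm none none = refl
  ⊔ˢ-comm none pos  = refl
  ⊔ˢ-comm none neg  = refl
  ⊔ˢ-comm none both = refl
  ⊔ˢ-comm pos  none = refl
  ⊔ˢ-comm pos  pos  = refl
  ⊔ˢ-comm pos  neg  = refl
  ⊔ˢ-comm pos  both = refl
  ⊔ˢ-comm neg  none = refl
  ⊔ˢ-comm neg  pos  = refl
  ⊔ˢ-comm neg  neg  = refl
  ⊔ˢ-comm neg  both = refl
  ⊔ˢ-comm both none = refl
  ⊔ˢ-comm both pos  = refl
  ⊔ˢ-comm both neg  = refl
  ⊔ˢ-comm both both = refl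

  addPos : State → State
  addPos none = pos
  addPos pos  = pos
  addPos neg  = both
  addPos both = both

  addPos-⊔ˢ : ∀ s t → addPos (s ⊔ˢ t) ≡ addPos s ⊔ˢ t
  addPos-⊔ˢ none none = refl
  addPos-⊔ˢ none pos  = refl
  addPos-⊔ˢ none neg  = refl
  addPos-⊔ˢ none both = refl
  addPos-⊔ˢ pos  none = refl
  addPos-⊔ˢ pos  pos  = refl
  addPos-⊔ˢ pos  neg  = refl
  addPos-⊔ˢ pos  both = refl
  addPos-⊔ˢ neg  none = refl
  addPos-⊔ˢ neg  pos  = refl
  addPos-⊔ˢ neg  neg  = refl
  addPos-⊔ˢ neg  both = refl
  addPos-⊔ˢ both t    = refl

  -- Product of monomials: since powers collapse, only the union of the occurring literals remains.
  _∨_ : ∀ {n} → Vec State n → Vec State n → Vec State n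
  _∨_ = zipWith _⊔ˢ_

  ∨-comm : ∀ {n} (y z : Vec State n) → y ∨ z ≡ z ∨ y
  ∨-comm []      []      = refl
  ∨-comm (s ∷ y) (t ∷ z) = cong₂ _∷_ (⊔ˢ-comm s t) (∨-comm y z)

  -- Multiplication by the variable xᵢ.
  _⊕_ : ∀ {n} → Vec State n → Fin n → Vec State n
  z ⊕ i = updateAt z i addPos

  ⊕-∨ : ∀ {n} (z y : Vec State n) i → (z ∨ y) ⊕ i ≡ (z ⊕ i) ∨ y
  ⊕-∨ (s ∷ z) (t ∷ y) zero    = cong (_∷ (z ∨ y)) (addPos-⊔ˢ s t)
  ⊕-∨ (s ∷ z) (t ∷ y) (suc i) = cong (s ⊔ˢ t ∷_) (⊕-∨ z y i)

  data Assign : Set where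
    fixed0 fixed1 free : Assign

  count : ∀ {n} → (Assign → State → ℕ) → Vec Assign n → Vec State n → ℕ
  count f []      []      = 0
  count f (r ∷ ρ) (s ∷ z) = f r s ℕ.+ count f ρ z

  isPos isNeg isLit : Assign → State → ℕ
  isPos free pos = 1
  isPos _    _   = 0
  isNeg free neg = 1
  isNeg _    _   = 0
  isLit r s = isPos r s ℕ.+ isNeg r s

  -- Degree after the restriction. A pair in state `both` counts 0, because xᵢx̄ᵢ annihilates the
  -- monomial anyway.
  deg : ∀ {n} → Vec Assign n → Vec State n → ℕ
  deg = count isLit

  #free #ones : ∀ {n} → Vec Assign n → ℕ
  #free []           = 0
  #free (free   ∷ ρ) = suc (#free ρ)
  #free (fixed0 ∷ ρ) = #free ρ
  #free (fixed1 ∷ ρ) = #free ρ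
  #ones []           = 0
  #ones (free   ∷ ρ) = #ones ρ
  #ones (fixed0 ∷ ρ) = #ones ρ
  #ones (fixed1 ∷ ρ) = suc (#ones ρ)

  shift : (ℕ → ℤ) → ℕ → ℤ
  shift g a = g (suc a)

  -- E ρ g is the linear functional that substitutes the fixed variables and sends x_A to g |A| for
  -- a set A of free variables, extended to all literals by x̄ᵢ = 1 − xᵢ.
  E : ∀ {n} → Vec Assign n → (ℕ → ℤ) → Vec State n → ℤ
  E []           g []         = g 0
  E (free   ∷ ρ) g (none ∷ z) = E ρ g z
  E (free   ∷ ρ) g (pos  ∷ z) = E ρ (shift g) z
  E (free   ∷ ρ) g (neg  ∷ z) = E ρ g z - E ρ (shift g) z
  E (free   ∷ ρ) g (both ∷ z) = + 0
  E (fixed0 ∷ ρ) g (none ∷ z) = E ρ g z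
  E (fixed0 ∷ ρ) g (pos  ∷ z) = + 0
  E (fixed0 ∷ ρ) g (neg  ∷ z) = E ρ g z
  E (fixed0 ∷ ρ) g (both ∷ z) = + 0
  E (fixed1 ∷ ρ) g (none ∷ z) = E ρ g z
  E (fixed1 ∷ ρ) g (pos  ∷ z) = E ρ g z
  E (fixed1 ∷ ρ) g (neg  ∷ z) = + 0
  E (fixed1 ∷ ρ) g (both ∷ z) = + 0

  private
    dead-sum : ∀ m (o p f q : ℤ) → + 0 + ∑ᶠ {m} (λ _ → + 0) ≡ (o + p) * + 0 + (f - p - q) * + 0
    dead-sum m o p f q = trans (ℤ.+-identityˡ (∑ᶠ {m} (λ _ → + 0))) (trans (∑ᶠ-zero m)
      (sym (cong₂ _+_ (ℤ.*-zeroʳ (o + p)) (ℤ.*-zeroʳ (f - p - q)))))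

    fixed1-step : ∀ o p e x y → x ≡ (o + p) * e + y → e + x ≡ (+ 1 + o + p) * e + y
    fixed1-step o p e x y refl = step o p e y
      where
      step : ∀ o p e y → e + ((o + p) * e + y) ≡ (+ 1 + o + p) * e + y
      step = solve-∀

  -- Multiplying a live monomial by xᵢ changes nothing if i is fixed to 1 or xᵢ already occurs,
  -- gives 0 if i is fixed to 0 or x̄ᵢ occurs, and otherwise adds one more free variable, which
  -- shifts the moments. If the monomial is dead, both sides are 0.
  ∑-E : ∀ {n} (ρ : Vec Assign n) g z →
    ∑ᶠ (λ i → E ρ g (z ⊕ i)) ≡
      (+ #ones ρ + + count isPos ρ z) * E ρ g z
        + (+ #free ρ - + count isPos ρ z - + count isNeg ρ z) * E ρ (shift g) z
  ∑-E []           g []         = refl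
  ∑-E (free   ∷ ρ) g (none ∷ z) = trans (cong (λ u → E ρ (shift g) z + u) (∑-E ρ g z))
    (step (+ #ones ρ) (+ #free ρ) (+ count isPos ρ z) (+ count isNeg ρ z) (E ρ g z) (E ρ (shift g) z))
    where
    step : ∀ o f p q e e′ → e′ + ((o + p) * e + (f - p - q) * e′) ≡ (o + p) * e + (+ 1 + f - p - q) * e′
    step = solve-∀
  ∑-E (free   ∷ ρ) g (pos  ∷ z) = trans (cong (λ u → E ρ (shift g) z + u) (∑-E ρ (shift g) z))
    (step (+ #ones ρ) (+ #free ρ) (+ count isPos ρ z) (+ count isNeg ρ z) (E ρ (shift g) z) (E ρ (shift (shift g)) z))
    where
    step : ∀ o f p q e e′ → e + ((o + p) * e + (f - p - q) * e′) ≡ (o + (+ 1 + p)) * e + (+ 1 + f - (+ 1 + p) - q) * e′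
    step = solve-∀
  ∑-E (free   ∷ ρ) g (neg  ∷ z) = trans (ℤ.+-identityˡ (∑ᶠ (λ i → E ρ g (z ⊕ i) - E ρ (shift g) (z ⊕ i))))
    (trans (∑ᶠ-- (λ i → E ρ g (z ⊕ i)) (λ i → E ρ (shift g) (z ⊕ i)))
    (trans (cong₂ _-_ (∑-E ρ g z) (∑-E ρ (shift g) z))
    (step (+ #ones ρ) (+ #free ρ) (+ count isPos ρ z) (+ count isNeg ρ z)
      (E ρ g z) (E ρ (shift g) z) (E ρ (shift (shift g)) z))))
    where
    step : ∀ o f p q e e′ e″ → ((o + p) * e + (f - p - q) * e′) - ((o + p) * e′ + (f - p - q) * e″)
      ≡ (o + p) * (e - e′) + (+ 1 + f - p - (+ 1 + q)) * (e′ - e″)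
    step = solve-∀
  ∑-E {suc n} (free   ∷ ρ) g (both ∷ z) = dead-sum n (+ #ones ρ) (+ count isPos ρ z) (+ suc (#free ρ)) (+ count isNeg ρ z)
  ∑-E (fixed0 ∷ ρ) g (none ∷ z) = trans (ℤ.+-identityˡ (∑ᶠ (λ i → E ρ g (z ⊕ i)))) (∑-E ρ g z)
  ∑-E {suc n} (fixed0 ∷ ρ) g (pos  ∷ z) = dead-sum n (+ #ones ρ) (+ count isPos ρ z) (+ #free ρ) (+ count isNeg ρ z)
  ∑-E (fixed0 ∷ ρ) g (neg  ∷ z) = trans (ℤ.+-identityˡ (∑ᶠ (λ i → E ρ g (z ⊕ i)))) (∑-E ρ g z)
  ∑-E {suc n} (fixed0 ∷ ρ) g (both ∷ z) = dead-sum n (+ #ones ρ) (+ count isPos ρ z) (+ #free ρ) (+ count isNeg ρ z)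
  ∑-E (fixed1 ∷ ρ) g (none ∷ z) = fixed1-step (+ #ones ρ) (+ count isPos ρ z) (E ρ g z) (∑ᶠ (λ i → E ρ g (z ⊕ i))) _ (∑-E ρ g z)
  ∑-E (fixed1 ∷ ρ) g (pos  ∷ z) = fixed1-step (+ #ones ρ) (+ count isPos ρ z) (E ρ g z) (∑ᶠ (λ i → E ρ g (z ⊕ i))) _ (∑-E ρ g z)
  ∑-E {suc n} (fixed1 ∷ ρ) g (neg  ∷ z) = dead-sum n (+ suc (#ones ρ)) (+ count isPos ρ z) (+ #free ρ) (+ count isNeg ρ z)
  ∑-E {suc n} (fixed1 ∷ ρ) g (both ∷ z) = dead-sum n (+ suc (#ones ρ)) (+ count isPos ρ z) (+ #free ρ) (+ count isNeg ρ z)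

  private
    dead-ratio : ∀ κ f p q → (κ - + 2 * p) * + 0 ≡ + 2 * (f - p - q) * + 0
    dead-ratio κ f p q = trans (ℤ.*-zeroʳ (κ - + 2 * p)) (sym (ℤ.*-zeroʳ (+ 2 * (f - p - q))))

    shift-ratio : ∀ κ f (g : ℕ → ℤ) {N} →
      (∀ a → a ≤ suc N → (κ - + 2 * + a) * g a ≡ + 2 * (f - + a) * g (suc a)) →
      ∀ a → a ≤ N → (κ - + 2 - + 2 * + a) * g (suc a) ≡ + 2 * (f - + 1 - + a) * g (suc (suc a))
    shift-ratio κ f g h a a≤ = trans (left κ (+ a) (g (suc a))) (trans (h (suc a) (ℕ.s≤s a≤)) (right f (+ a) (g (suc (suc a)))))
      where
      left : ∀ κ a x → (κ - + 2 - + 2 * a) * x ≡ (κ - + 2 * (+ 1 + a)) * x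
      left = solve-∀
      right : ∀ f a x → + 2 * (f - (+ 1 + a)) * x ≡ + 2 * (f - + 1 - a) * x
      right = solve-∀

  -- Carries the recursion of the moments over to monomials with negated literals. A positive
  -- literal shifts `g`, which replaces (κ, f) by (κ - 2, f - 1); for a negated literal the shifted
  -- instance is subtracted from the unshifted one.
  E-ratio : ∀ {n} (ρ : Vec Assign n) z κ f g →
    (∀ a → a ≤ deg ρ z → (κ - + 2 * + a) * g a ≡ + 2 * (f - + a) * g (suc a)) →
    (κ - + 2 * + count isPos ρ z) * E ρ g z
      ≡ + 2 * (f - + count isPos ρ z - + count isNeg ρ z) * E ρ (shift g) z
  E-ratio []           []         κ f g h = trans (h 0 ℕ.z≤n) (step f (g 1))
    where
    step : ∀ f x → + 2 * (f - + 0) * x ≡ + 2 * (f - + 0 - + 0) * x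
    step = solve-∀
  E-ratio (free   ∷ ρ) (none ∷ z) κ f g h = E-ratio ρ z κ f g h
  E-ratio (free   ∷ ρ) (pos  ∷ z) κ f g h =
    trans (left κ (+ count isPos ρ z) (E ρ (shift g) z))
    (trans (E-ratio ρ z (κ - + 2) (f - + 1) (shift g) (shift-ratio κ f g h))
    (right f (+ count isPos ρ z) (+ count isNeg ρ z) (E ρ (shift (shift g)) z)))
    where
    left : ∀ κ p e → (κ - + 2 * (+ 1 + p)) * e ≡ (κ - + 2 - + 2 * p) * e
    left = solve-∀
    right : ∀ f p q e → + 2 * (f - + 1 - p - q) * e ≡ + 2 * (f - (+ 1 + p) - q) * e
    right = solve-∀
  E-ratio (free   ∷ ρ) (neg  ∷ z) κ f g h = combine κ f (+ count isPos ρ z) (+ count isNeg ρ z)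
    (E ρ g z) (E ρ (shift g) z) (E ρ (shift (shift g)) z)
    (E-ratio ρ z κ f g λ a a≤ → h a (ℕ.m≤n⇒m≤1+n a≤))
    (E-ratio ρ z (κ - + 2) (f - + 1) (shift g) (shift-ratio κ f g h))
    where
    combine : ∀ κ f p q e e′ e″ → (κ - + 2 * p) * e ≡ + 2 * (f - p - q) * e′ →
      (κ - + 2 - + 2 * p) * e′ ≡ + 2 * (f - + 1 - p - q) * e″ →
      (κ - + 2 * p) * (e - e′) ≡ + 2 * (f - p - (+ 1 + q)) * (e′ - e″)
    combine κ f p q e e′ e″ h₁ h₂ = trans (split κ p e e′)
      (trans (cong₂ (λ u v → u - v - + 2 * e′) h₁ h₂) (join f p q e′ e″))
      where
      split : ∀ κ p e e′ → (κ - + 2 * p) * (e - e′) ≡ (κ - + 2 * p) * e - (κ - + 2 - + 2 * p) * e′ - + 2 * e′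
      split = solve-∀
      join : ∀ f p q e′ e″ → + 2 * (f - p - q) * e′ - + 2 * (f - + 1 - p - q) * e″ - + 2 * e′
        ≡ + 2 * (f - p - (+ 1 + q)) * (e′ - e″)
      join = solve-∀
  E-ratio (free   ∷ ρ) (both ∷ z) κ f g h = dead-ratio κ f (+ count isPos ρ z) (+ count isNeg ρ z)
  E-ratio (fixed0 ∷ ρ) (none ∷ z) κ f g h = E-ratio ρ z κ f g h
  E-ratio (fixed0 ∷ ρ) (pos  ∷ z) κ f g h = dead-ratio κ f (+ count isPos ρ z) (+ count isNeg ρ z)
  E-ratio (fixed0 ∷ ρ) (neg  ∷ z) κ f g h = E-ratio ρ z κ f g h
  E-ratio (fixed0 ∷ ρ) (both ∷ z) κ f g h = dead-ratio κ f (+ count isPos ρ z) (+ count isNeg ρ z)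
  E-ratio (fixed1 ∷ ρ) (none ∷ z) κ f g h = E-ratio ρ z κ f g h
  E-ratio (fixed1 ∷ ρ) (pos  ∷ z) κ f g h = E-ratio ρ z κ f g h
  E-ratio (fixed1 ∷ ρ) (neg  ∷ z) κ f g h = dead-ratio κ f (+ count isPos ρ z) (+ count isNeg ρ z)
  E-ratio (fixed1 ∷ ρ) (both ∷ z) κ f g h = dead-ratio κ f (+ count isPos ρ z) (+ count isNeg ρ z)

  -- `∑-E` leaves the unshifted and the shifted value, and `E-ratio` expresses the latter through
  -- the former.
  E-knapsack : ∀ {n} (ρ : Vec Assign n) z κ g →
    (∀ a → a ≤ deg ρ z → (κ - + 2 * + a) * g a ≡ + 2 * (+ #free ρ - + a) * g (suc a)) →
    + 2 * ∑ᶠ (λ i → E ρ g (z ⊕ i)) ≡ (κ + + 2 * + #ones ρ) * E ρ g z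
  E-knapsack ρ z κ g h = trans (cong (+ 2 *_) (∑-E ρ g z))
    (combine κ (+ #ones ρ) (+ count isPos ρ z) (+ #free ρ) (+ count isNeg ρ z) (E ρ g z) (E ρ (shift g) z)
      (E-ratio ρ z κ (+ #free ρ) g h))
    where
    combine : ∀ κ o p f q e e′ → (κ - + 2 * p) * e ≡ + 2 * (f - p - q) * e′ →
      + 2 * ((o + p) * e + (f - p - q) * e′) ≡ (κ + + 2 * o) * e
    combine κ o p f q e e′ h = trans (split o p f q e e′) (trans (cong (λ u → + 2 * (o + p) * e + u) (sym h)) (join κ o p e))
      where
      split : ∀ o p f q e e′ → + 2 * ((o + p) * e + (f - p - q) * e′) ≡ + 2 * (o + p) * e + + 2 * (f - p - q) * e′
      split = solve-∀
      join : ∀ κ o p e → + 2 * (o + p) * e + (κ - + 2 * p) * e ≡ (κ + + 2 * o) * e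
      join = solve-∀

  -- Functionals that respect the Boolean axioms and the restriction.

  Local : Assign → (State → ℤ) → Set
  Local free   f = f neg ≡ f none - f pos × f both ≡ + 0
  Local fixed0 f = f pos ≡ + 0 × f neg ≡ f none × f both ≡ + 0
  Local fixed1 f = f pos ≡ f none × f neg ≡ + 0 × f both ≡ + 0

  -- Such a functional vanishes on the ideal of the Boolean axioms and the fixed values. Stating
  -- this index by index suits induction on the vector. The class is closed under linear
  -- combinations and under multiplication by a monomial, so it contains the error term `defect`
  -- below.
  Consistent : ∀ {n} → Vec Assign n → (Vec State n → ℤ) → Set
  Consistent []      Φ = ⊤
  Consistent (r ∷ ρ) Φ = (∀ z → Local r (λ s → Φ (s ∷ z))) × (∀ s → Consistent ρ (λ z → Φ (s ∷ z)))

  private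
    sub-self : ∀ a → + 0 ≡ a - a
    sub-self a = sym (ℤ.+-inverseʳ a)

    minus-0 : ∀ a → a ≡ a - + 0
    minus-0 a = sym (ℤ.+-identityʳ a)

  consistent-0 : ∀ {n} (ρ : Vec Assign n) → Consistent ρ (λ _ → + 0)
  consistent-0 []           = tt
  consistent-0 (free   ∷ ρ) = (λ _ → refl , refl) , λ _ → consistent-0 ρ
  consistent-0 (fixed0 ∷ ρ) = (λ _ → refl , refl , refl) , λ _ → consistent-0 ρ
  consistent-0 (fixed1 ∷ ρ) = (λ _ → refl , refl , refl) , λ _ → consistent-0 ρ

  consistent-- : ∀ {n} (ρ : Vec Assign n) {Φ Ψ} → Consistent ρ Φ → Consistent ρ Ψ →
    Consistent ρ (λ z → Φ z - Ψ z)
  consistent-- []      _        _        = tt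
  consistent-- (r ∷ ρ) {Φ} {Ψ} (l₁ , c₁) (l₂ , c₂) =
    (λ z → local r _ _ (l₁ z) (l₂ z)) , λ s → consistent-- ρ (c₁ s) (c₂ s)
    where
    rearrange : ∀ a b c d → (a - b) - (c - d) ≡ (a - c) - (b - d)
    rearrange = solve-∀
    local : ∀ r f g → Local r f → Local r g → Local r (λ s → f s - g s)
    local free   f g (p , q)     (p′ , q′)      =
      trans (cong₂ _-_ p p′) (rearrange (f none) (f pos) (g none) (g pos)) , cong₂ _-_ q q′
    local fixed0 f g (p , q , r) (p′ , q′ , r′) = cong₂ _-_ p p′ , cong₂ _-_ q q′ , cong₂ _-_ r r′
    local fixed1 f g (p , q , r) (p′ , q′ , r′) = cong₂ _-_ p p′ , cong₂ _-_ q q′ , cong₂ _-_ r r′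

  consistent-* : ∀ {n} (ρ : Vec Assign n) {Φ} c → Consistent ρ Φ → Consistent ρ (λ z → c * Φ z)
  consistent-* []      c _       = tt
  consistent-* (r ∷ ρ) {Φ} c (l , k) =
    (λ z → local r _ (l z)) , λ s → consistent-* ρ c (k s)
    where
    distrib : ∀ c a b → c * (a - b) ≡ c * a - c * b
    distrib = solve-∀
    local : ∀ r f → Local r f → Local r (λ s → c * f s)
    local free   f (p , q)     = trans (cong (c *_) p) (distrib c (f none) (f pos)) , trans (cong (c *_) q) (ℤ.*-zeroʳ c)
    local fixed0 f (p , q , r) = trans (cong (c *_) p) (ℤ.*-zeroʳ c) , cong (c *_) q , trans (cong (c *_) r) (ℤ.*-zeroʳ c)
    local fixed1 f (p , q , r) = cong (c *_) p , trans (cong (c *_) q) (ℤ.*-zeroʳ c) , trans (cong (c *_) r) (ℤ.*-zeroʳ c)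

  consistent-+ : ∀ {n} (ρ : Vec Assign n) {Φ Ψ} → Consistent ρ Φ → Consistent ρ Ψ →
    Consistent ρ (λ z → Φ z + Ψ z)
  consistent-+ []      _        _        = tt
  consistent-+ (r ∷ ρ) {Φ} {Ψ} (l₁ , c₁) (l₂ , c₂) =
    (λ z → local r _ _ (l₁ z) (l₂ z)) , λ s → consistent-+ ρ (c₁ s) (c₂ s)
    where
    rearrange : ∀ a b c d → (a - b) + (c - d) ≡ (a + c) - (b + d)
    rearrange = solve-∀
    local : ∀ r f g → Local r f → Local r g → Local r (λ s → f s + g s)
    local free   f g (p , q)     (p′ , q′)      =
      trans (cong₂ _+_ p p′) (rearrange (f none) (f pos) (g none) (g pos)) , cong₂ _+_ q q′
    local fixed0 f g (p , q , r) (p′ , q′ , r′) = cong₂ _+_ p p′ , cong₂ _+_ q q′ , cong₂ _+_ r r′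
    local fixed1 f g (p , q , r) (p′ , q′ , r′) = cong₂ _+_ p p′ , cong₂ _+_ q q′ , cong₂ _+_ r r′

  consistent-∑ : ∀ {n} (ρ : Vec Assign n) {a} {A : Set a} (as : List A) {Φ : A → Vec State n → ℤ} →
    (∀ a → Consistent ρ (Φ a)) → Consistent ρ (λ z → ∑[ as ] (λ a → Φ a z))
  consistent-∑ ρ []       h = consistent-0 ρ
  consistent-∑ ρ (a ∷ as) h = consistent-+ ρ (h a) (consistent-∑ ρ as h)

  -- A local relation multiplied by a literal of the same pair is again a consequence of the local
  -- relations: x̄ᵢ = 1 - xᵢ times xᵢ reads xᵢx̄ᵢ = xᵢ - xᵢ, for instance.
  consistent-∨ : ∀ {n} (ρ : Vec Assign n) {Φ} y → Consistent ρ Φ → Consistent ρ (λ z → Φ (z ∨ y))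
  consistent-∨ []      []      _       = tt
  consistent-∨ (r ∷ ρ) {Φ} (t ∷ y) (l , c) =
    (λ z → local r t (λ s → Φ (s ∷ z ∨ y)) (l (z ∨ y))) , λ s → consistent-∨ ρ y (c (s ⊔ˢ t))
    where
    local : ∀ r t f → Local r f → Local r (λ s → f (s ⊔ˢ t))
    local free   none f (p , q)     = p , q
    local free   pos  f (p , q)     = trans q (sub-self (f pos)) , q
    local free   neg  f (p , q)     = trans (minus-0 (f neg)) (cong (λ u → f neg - u) (sym q)) , q
    local free   both f (p , q)     = trans q (sub-self (f both)) , q
    local fixed0 none f h           = h
    local fixed0 pos  f (p , q , r) = p , trans r (sym p) , r
    local fixed0 neg  f (p , q , r) = r , refl , r
    local fixed0 both f (p , q , r) = r , refl , r
    local fixed1 none f h           = h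
    local fixed1 pos  f (p , q , r) = refl , r , r
    local fixed1 neg  f (p , q , r) = trans r (sym q) , q , r
    local fixed1 both f (p , q , r) = refl , r , r

  consistent-E : ∀ {n} (ρ : Vec Assign n) g → Consistent ρ (E ρ g)
  consistent-E []           g = tt
  consistent-E (free   ∷ ρ) g = (λ _ → refl , refl) , λ where
    none → consistent-E ρ g
    pos  → consistent-E ρ (shift g)
    neg  → consistent-- ρ (consistent-E ρ g) (consistent-E ρ (shift g))
    both → consistent-0 ρ
  consistent-E (fixed0 ∷ ρ) g = (λ _ → refl , refl , refl) , λ where
    none → consistent-E ρ g
    pos  → consistent-0 ρ
    neg  → consistent-E ρ g
    both → consistent-0 ρ
  consistent-E (fixed1 ∷ ρ) g = (λ _ → refl , refl , refl) , λ where
    none → consistent-E ρ g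
    pos  → consistent-E ρ g
    neg  → consistent-0 ρ
    both → consistent-0 ρ

  lit : Bool → State
  lit false = none
  lit true  = pos

  lits : ∀ {n} → Vec Bool n → Vec State n
  lits = Vec.map lit

  data Sub : ∀ {n} → Vec Assign n → ℕ → Vec Bool n → Set where
    []   : Sub [] 0 []
    skip : ∀ {n} {ρ : Vec Assign n} {p A} r → Sub ρ p A → Sub (r ∷ ρ) p (false ∷ A)
    take : ∀ {n} {ρ : Vec Assign n} {p A} → Sub ρ p A → Sub (free ∷ ρ) (suc p) (true ∷ A)

  -- Modulo the local relations, each monomial of degree at most d is a combination of products of
  -- at most d distinct free variables, obtained by expanding every x̄ᵢ as 1 - xᵢ.
  consistent-vanish : ∀ {n} (ρ : Vec Assign n) {Φ} d → Consistent ρ Φ →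
    (∀ p A → p ≤ d → Sub ρ p A → Φ (lits A) ≡ + 0) → ∀ z → deg ρ z ≤ d → Φ z ≡ + 0
  consistent-vanish []           d _       h []         _  = h 0 [] ℕ.z≤n []
  consistent-vanish (free   ∷ ρ) d (l , c) h (none ∷ z) z≤ =
    consistent-vanish ρ d (c none) (λ p A p≤ s → h p (false ∷ A) p≤ (skip free s)) z z≤
  consistent-vanish (free   ∷ ρ) (suc d) (l , c) h (pos  ∷ z) (ℕ.s≤s z≤) =
    consistent-vanish ρ d (c pos) (λ p A p≤ s → h (suc p) (true ∷ A) (ℕ.s≤s p≤) (take s)) z z≤
  consistent-vanish (free   ∷ ρ) (suc d) (l , c) h (neg  ∷ z) (ℕ.s≤s z≤) = trans (proj₁ (l z)) (cong₂ _-_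
    (consistent-vanish ρ d (c none) (λ p A p≤ s → h p (false ∷ A) (ℕ.m≤n⇒m≤1+n p≤) (skip free s)) z z≤)
    (consistent-vanish ρ d (c pos) (λ p A p≤ s → h (suc p) (true ∷ A) (ℕ.s≤s p≤) (take s)) z z≤))
  consistent-vanish (free   ∷ ρ) d (l , c) h (both ∷ z) z≤ = proj₂ (l z)
  consistent-vanish (fixed0 ∷ ρ) d (l , c) h (none ∷ z) z≤ =
    consistent-vanish ρ d (c none) (λ p A p≤ s → h p (false ∷ A) p≤ (skip fixed0 s)) z z≤
  consistent-vanish (fixed0 ∷ ρ) d (l , c) h (pos  ∷ z) z≤ = proj₁ (l z)
  consistent-vanish (fixed0 ∷ ρ) d (l , c) h (neg  ∷ z) z≤ = trans (proj₁ (proj₂ (l z)))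
    (consistent-vanish ρ d (c none) (λ p A p≤ s → h p (false ∷ A) p≤ (skip fixed0 s)) z z≤)
  consistent-vanish (fixed0 ∷ ρ) d (l , c) h (both ∷ z) z≤ = proj₂ (proj₂ (l z))
  consistent-vanish (fixed1 ∷ ρ) d (l , c) h (none ∷ z) z≤ =
    consistent-vanish ρ d (c none) (λ p A p≤ s → h p (false ∷ A) p≤ (skip fixed1 s)) z z≤
  consistent-vanish (fixed1 ∷ ρ) d (l , c) h (pos  ∷ z) z≤ = trans (proj₁ (l z))
    (consistent-vanish ρ d (c none) (λ p A p≤ s → h p (false ∷ A) p≤ (skip fixed1 s)) z z≤)
  consistent-vanish (fixed1 ∷ ρ) d (l , c) h (neg  ∷ z) z≤ = proj₁ (proj₂ (l z))
  consistent-vanish (fixed1 ∷ ρ) d (l , c) h (both ∷ z) z≤ = proj₂ (proj₂ (l z))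

  -- The terms with i in A or fixed to 1 reproduce x_A, those fixed to 0 vanish, and the remaining
  -- ones have p + 1 variables, where Φ is assumed to vanish.
  ∑-consistent : ∀ {n} {ρ : Vec Assign n} {Φ p A} → Consistent ρ Φ → Sub ρ p A →
    (∀ A′ → Sub ρ (suc p) A′ → Φ (lits A′) ≡ + 0) →
    ∑ᶠ (λ i → Φ (lits A ⊕ i)) ≡ (+ #ones ρ + + p) * Φ (lits A)
  ∑-consistent {ρ = []}     {Φ} _ [] h = refl
  ∑-consistent {ρ = _ ∷ ρ} {Φ} {p} {_ ∷ A} (l , c) (skip free s) h = trans (cong₂ _+_
    (h (true ∷ A) (take s)) (∑-consistent (c none) s λ A′ s′ → h (false ∷ A′) (skip free s′))) (ℤ.+-identityˡ _)
  ∑-consistent {ρ = _ ∷ ρ} {Φ} {p} {_ ∷ A} (l , c) (skip fixed0 s) h = trans (cong₂ _+_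
    (proj₁ (l (lits A))) (∑-consistent (c none) s λ A′ s′ → h (false ∷ A′) (skip fixed0 s′))) (ℤ.+-identityˡ _)
  ∑-consistent {ρ = _ ∷ ρ} {Φ} {p} {_ ∷ A} (l , c) (skip fixed1 s) h = trans (cong₂ _+_
    (proj₁ (l (lits A))) (∑-consistent (c none) s λ A′ s′ → h (false ∷ A′) (skip fixed1 s′)))
    (step (+ #ones ρ) (+ p) (Φ (none ∷ lits A)))
    where
    step : ∀ o p e → e + (o + p) * e ≡ (+ 1 + o + p) * e
    step = solve-∀
  ∑-consistent {ρ = _ ∷ ρ} {Φ} {suc p} {_ ∷ A} (l , c) (take s) h = trans (cong (λ u → Φ (pos ∷ lits A) + u)
    (∑-consistent (c pos) s λ A′ s′ → h (true ∷ A′) (take s′)))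
    (step (+ #ones ρ) (+ p) (Φ (pos ∷ lits A)))
    where
    step : ∀ o p e → e + (o + p) * e ≡ (o + (+ 1 + p)) * e
    step = solve-∀

  -- mask ρ I sets the free variables outside I to 0.
  restrict : Assign → Bool → Assign
  restrict free   false = fixed0
  restrict free   true  = free
  restrict fixed0 _     = fixed0
  restrict fixed1 _     = fixed1

  mask : ∀ {n} → Vec Assign n → Vec Bool n → Vec Assign n
  mask = zipWith restrict

  -- A variable set to 0 also obeys the relations of a free one: there x̄ᵢ = 1 = 1 - 0.
  consistent-mask : ∀ {n} (ρ : Vec Assign n) I {Φ} → Consistent (mask ρ I) Φ → Consistent ρ Φ
  consistent-mask []           []          _       = tt
  consistent-mask (free   ∷ ρ) (false ∷ I) {Φ} (l , c) =
    (λ z → let (p , q , r) = l z in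
      trans q (trans (minus-0 (Φ (none ∷ z))) (cong (λ u → Φ (none ∷ z) - u) (sym p))) , r)
    , λ s → consistent-mask ρ I (c s)
  consistent-mask (free   ∷ ρ) (true  ∷ I) (l , c) = l , λ s → consistent-mask ρ I (c s)
  consistent-mask (fixed0 ∷ ρ) (_     ∷ I) (l , c) = l , λ s → consistent-mask ρ I (c s)
  consistent-mask (fixed1 ∷ ρ) (_     ∷ I) (l , c) = l , λ s → consistent-mask ρ I (c s)

  #free-mask : ∀ {n} {ρ : Vec Assign n} {p I} → Sub ρ p I → #free (mask ρ I) ≡ p
  #free-mask []              = refl
  #free-mask (skip free s)   = #free-mask s
  #free-mask (skip fixed0 s) = #free-mask s
  #free-mask (skip fixed1 s) = #free-mask s
  #free-mask (take s)        = cong suc (#free-mask s)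

  #ones-mask : ∀ {n} (ρ : Vec Assign n) I → #ones (mask ρ I) ≡ #ones ρ
  #ones-mask []           []          = refl
  #ones-mask (free   ∷ ρ) (false ∷ I) = #ones-mask ρ I
  #ones-mask (free   ∷ ρ) (true  ∷ I) = #ones-mask ρ I
  #ones-mask (fixed0 ∷ ρ) (_     ∷ I) = #ones-mask ρ I
  #ones-mask (fixed1 ∷ ρ) (_     ∷ I) = cong suc (#ones-mask ρ I)

  subsets : ∀ {n} → Vec Assign n → ℕ → List (Vec Bool n)
  subsets []           zero    = [] ∷ []
  subsets []           (suc _) = []
  subsets (free   ∷ ρ) zero    = map (false ∷_) (subsets ρ zero)
  subsets (free   ∷ ρ) (suc p) = map (false ∷_) (subsets ρ (suc p)) ++ map (true ∷_) (subsets ρ p)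
  subsets (fixed0 ∷ ρ) p       = map (false ∷_) (subsets ρ p)
  subsets (fixed1 ∷ ρ) p       = map (false ∷_) (subsets ρ p)

  subsets-Sub : ∀ {n} (ρ : Vec Assign n) p → All (Sub ρ p) (subsets ρ p)
  subsets-Sub []           zero    = [] ∷ []
  subsets-Sub []           (suc _) = []
  subsets-Sub (free   ∷ ρ) zero    = map⁺ (All.map (skip free) (subsets-Sub ρ zero))
  subsets-Sub (free   ∷ ρ) (suc p) = ++⁺
    (map⁺ (All.map (skip free) (subsets-Sub ρ (suc p)))) (map⁺ (All.map take (subsets-Sub ρ p)))
  subsets-Sub (fixed0 ∷ ρ) p       = map⁺ (All.map (skip fixed0) (subsets-Sub ρ p))
  subsets-Sub (fixed1 ∷ ρ) p       = map⁺ (All.map (skip fixed1) (subsets-Sub ρ p))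

  -- More than p variables do not fit into I, so one of them is set to 0 by the mask.
  E-mask-small : ∀ {n} {ρ : Vec Assign n} {p q I A} h → Sub ρ p I → Sub ρ q A → p ℕ.< q →
    E (mask ρ I) h (lits A) ≡ + 0
  E-mask-small h []              []              ()
  E-mask-small h (skip free s)   (skip _ s′)     p<q         = E-mask-small h s s′ p<q
  E-mask-small h (skip fixed0 s) (skip _ s′)     p<q         = E-mask-small h s s′ p<q
  E-mask-small h (skip fixed1 s) (skip _ s′)     p<q         = E-mask-small h s s′ p<q
  E-mask-small h (skip _ s)      (take s′)       p<q         = refl
  E-mask-small h (take s)        (skip _ s′)     p<q         = E-mask-small h s s′ (ℕ.<-trans (ℕ.n<1+n _) p<q)
  E-mask-small h (take s)        (take s′)       (ℕ.s≤s p<q) = E-mask-small (shift h) s s′ p<q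

  -- On sets of the same size p, the masked functional is `h p` times the indicator of I = A, since
  -- a different A contains a variable outside I.
  ∑-mask : ∀ {n} {ρ : Vec Assign n} {p A} h (F : Vec Bool n → ℤ) → Sub ρ p A →
    ∑[ subsets ρ p ] (λ I → E (mask ρ I) h (lits A) * F I) ≡ h p * F A
  ∑-mask h F [] = ℤ.+-identityʳ (h 0 * F [])
  ∑-mask {ρ = _ ∷ ρ} {zero} {_ ∷ A} h F (skip free s) = trans
    (∑-map (false ∷_) (subsets ρ zero) (λ I → E (mask (free ∷ ρ) I) h (lits (false ∷ A)) * F I))
    (∑-mask h (λ I → F (false ∷ I)) s)
  ∑-mask {ρ = _ ∷ ρ} {suc p} {_ ∷ A} h F (skip free s) = trans
    (∑-++ (map (false ∷_) (subsets ρ (suc p))) (map (true ∷_) (subsets ρ p)) G)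
    (trans (cong₂ _+_
      (trans (∑-map (false ∷_) (subsets ρ (suc p)) G) (∑-mask h (λ I → F (false ∷ I)) s))
      (trans (∑-map (true ∷_) (subsets ρ p) G) (trans (∑-congAll (All.map vanish (subsets-Sub ρ p))) (∑-zero (subsets ρ p) λ _ → refl))))
    (ℤ.+-identityʳ (h (suc p) * F (false ∷ A))))
    where
    G : Vec Bool _ → ℤ
    G I = E (mask (free ∷ ρ) I) h (lits (false ∷ A)) * F I
    vanish : ∀ {I} → Sub ρ p I → G (true ∷ I) ≡ + 0
    vanish {I} s′ = cong (_* F (true ∷ I)) (E-mask-small h s′ s (ℕ.n<1+n p))
  ∑-mask {ρ = _ ∷ ρ} {p} {_ ∷ A} h F (skip fixed0 s) = trans
    (∑-map (false ∷_) (subsets ρ p) (λ I → E (mask (fixed0 ∷ ρ) I) h (lits (false ∷ A)) * F I))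
    (∑-mask h (λ I → F (false ∷ I)) s)
  ∑-mask {ρ = _ ∷ ρ} {p} {_ ∷ A} h F (skip fixed1 s) = trans
    (∑-map (false ∷_) (subsets ρ p) (λ I → E (mask (fixed1 ∷ ρ) I) h (lits (false ∷ A)) * F I))
    (∑-mask h (λ I → F (false ∷ I)) s)
  ∑-mask {ρ = _ ∷ ρ} {suc p} {_ ∷ A} h F (take s) = trans
    (∑-++ (map (false ∷_) (subsets ρ (suc p))) (map (true ∷_) (subsets ρ p)) G)
    (trans (cong₂ _+_
      (trans (∑-map (false ∷_) (subsets ρ (suc p)) G) (∑-zero (subsets ρ (suc p)) λ _ → refl))
      (trans (∑-map (true ∷_) (subsets ρ p) G) (∑-mask (shift h) (λ I → F (true ∷ I)) s)))
    (ℤ.+-identityˡ (h (suc p) * F (true ∷ A))))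
    where
    G : Vec Bool _ → ℤ
    G I = E (mask (free ∷ ρ) I) h (lits (true ∷ A)) * F I


  -- The moments, and homogenization modulo the knapsack equation.

  -- This is 2^j j!, the factor that clears denominators.
  W : ℕ → ℤ
  W zero    = + 1
  W (suc j) = + 2 * + suc j * W j

  -- This is 2^a times the falling factorial of κ/2 with a factors.
  P : ℤ → ℕ → ℤ
  P κ zero    = + 1
  P κ (suc a) = P κ a * (κ - + 2 * + a)

  -- The Grigoriev functional x_A ↦ ∏ (κ/2 − i) / (N − i), i < |A|, for Σ xᵢ = κ/2 in N variables,
  -- scaled by 2ᴺ N! to be integral.
  moment : ℤ → ℕ → ℕ → ℤ
  moment κ N a = P κ a * W (N ℕ.∸ a)

  moment-top : ∀ κ N → moment κ N N ≡ P κ N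
  moment-top κ N = trans (cong (λ j → P κ N * W j) (ℕ.n∸n≡0 N)) (ℤ.*-identityʳ (P κ N))

  -- At a = N the right side is 0 while the left side is in general not, so the knapsack relation is
  -- available only below degree N.
  moment-ratio : ∀ κ N a → a ℕ.< N → (κ - + 2 * + a) * moment κ N a ≡ + 2 * (+ N - + a) * moment κ N (suc a)
  moment-ratio κ N a a<N with ℕ.m≤n⇒∃[o]m+o≡n a<N
  ... | j , refl = trans
    (cong (λ m → (κ - + 2 * + a) * (P κ a * W m)) (trans (cong (ℕ._∸ a) (sym (ℕ.+-suc a j))) (ℕ.m+n∸m≡n a (suc j))))
    (trans (step κ (+ a) (+ j) (P κ a) (W j))
    (cong (λ m → + 2 * (+ N - + a) * (P κ (suc a) * W m)) (sym (ℕ.m+n∸m≡n (suc a) j))))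
    where
    step : ∀ κ a j p w → (κ - + 2 * a) * (p * (+ 2 * (+ 1 + j) * w)) ≡ + 2 * (+ 1 + (a + j) - a) * (p * (κ - + 2 * a) * w)
    step = solve-∀

  deg-lits : ∀ {n} {ρ : Vec Assign n} {p A} → Sub ρ p A → deg ρ (lits A) ≤ p
  deg-lits []              = ℕ.z≤n
  deg-lits (skip free s)   = deg-lits s
  deg-lits (skip fixed0 s) = deg-lits s
  deg-lits (skip fixed1 s) = deg-lits s
  deg-lits (take s)        = ℕ.s≤s (deg-lits s)

  deg-mask-lits : ∀ {n} {ρ : Vec Assign n} {p A} I → Sub ρ p A → deg (mask ρ I) (lits A) ≤ p
  deg-mask-lits []          []              = ℕ.z≤n
  deg-mask-lits (false ∷ I) (skip free s)   = deg-mask-lits I s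
  deg-mask-lits (true  ∷ I) (skip free s)   = deg-mask-lits I s
  deg-mask-lits (_     ∷ I) (skip fixed0 s) = deg-mask-lits I s
  deg-mask-lits (_     ∷ I) (skip fixed1 s) = deg-mask-lits I s
  deg-mask-lits (false ∷ I) (take s)        = ℕ.m≤n⇒m≤1+n (deg-mask-lits I s)
  deg-mask-lits (true  ∷ I) (take s)        = ℕ.s≤s (deg-mask-lits I s)

  deg-lits-∨ : ∀ {n} {ρ : Vec Assign n} {p A} y → Sub ρ p A → deg ρ (lits A ∨ y) ≤ p ℕ.+ deg ρ y
  deg-lits-∨ []      [] = ℕ.z≤n
  deg-lits-∨ {ρ = _ ∷ ρ} {p} {_ ∷ A} (t ∷ y) (skip r s) = begin
    isLit r t ℕ.+ deg ρ (lits A ∨ y)       ≤⟨ ℕ.+-monoʳ-≤ (isLit r t) (deg-lits-∨ y s) ⟩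
    isLit r t ℕ.+ (p ℕ.+ deg ρ y)          ≡⟨ ℕ.+-comm (isLit r t) _ ⟩
    p ℕ.+ deg ρ y ℕ.+ isLit r t            ≡⟨ ℕ.+-assoc p _ _ ⟩
    p ℕ.+ (deg ρ y ℕ.+ isLit r t)          ≡⟨ cong (p ℕ.+_) (ℕ.+-comm (deg ρ y) (isLit r t)) ⟩
    p ℕ.+ (isLit r t ℕ.+ deg ρ y)          ∎
    where open ℕ.≤-Reasoning
  deg-lits-∨ {ρ = _ ∷ ρ} {suc p} {_ ∷ A} (t ∷ y) (take s) = begin
    isLit free (pos ⊔ˢ t) ℕ.+ deg ρ (lits A ∨ y)  ≤⟨ ℕ.+-mono-≤ (≤1 t) (deg-lits-∨ y s) ⟩
    suc (p ℕ.+ deg ρ y)                           ≤⟨ ℕ.s≤s (ℕ.+-monoʳ-≤ p (ℕ.m≤n+m (deg ρ y) (isLit free t))) ⟩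
    suc p ℕ.+ (isLit free t ℕ.+ deg ρ y)          ∎
    where
    open ℕ.≤-Reasoning
    ≤1 : ∀ t → isLit free (pos ⊔ˢ t) ≤ 1
    ≤1 none = ℕ.≤-refl
    ≤1 pos  = ℕ.≤-refl
    ≤1 neg  = ℕ.z≤n
    ≤1 both = ℕ.z≤n

  module Homogenization {n} (ρ : Vec Assign n) (κ : ℤ) (d : ℕ)
    (2d≤N : d ℕ.+ d ≤ #free ρ) (κ≢ : ∀ p → p ℕ.< d → κ - + 2 * + p ≢ + 0) where

    N : ℕ
    N = #free ρ

    L : Vec State n → ℤ
    L = E ρ (moment κ N)

    -- The coefficients in m ≡ Σ_{|I| = d} v_I(m) x_I modulo the knapsack relation, scaled by P κ d.
    v : Vec Bool n → Vec State n → ℤ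
    v I = E (mask ρ I) (moment κ d)

    -- The right-hand side before the restriction: for κ = k - 2 · `#ones ρ` it equals k.
    κ′ : ℤ
    κ′ = κ + + 2 * + #ones ρ

    L-knapsack : ∀ z → deg ρ z ℕ.< N → + 2 * ∑ᶠ (λ i → L (z ⊕ i)) ≡ κ′ * L z
    L-knapsack z z<N = E-knapsack ρ z κ (moment κ N) λ a a≤ → moment-ratio κ N a (ℕ.≤-<-trans a≤ z<N)

    v-knapsack : ∀ {p A I} → Sub ρ d I → Sub ρ p A → p ℕ.< d →
      + 2 * ∑ᶠ (λ i → v I (lits A ⊕ i)) ≡ κ′ * v I (lits A)
    v-knapsack {p} {A} {I} sI sA p<d = trans
      (E-knapsack (mask ρ I) (lits A) κ (moment κ d) λ a a≤ →
        subst (λ m → (κ - + 2 * + a) * moment κ d a ≡ + 2 * (+ m - + a) * moment κ d (suc a)) (sym (#free-mask sI))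
          (moment-ratio κ d a (ℕ.≤-<-trans (ℕ.≤-trans a≤ (deg-mask-lits I sA)) p<d)))
      (cong (λ o → (κ + + 2 * + o) * v I (lits A)) (#ones-mask ρ I))

    -- The error of homogenizing the factor z while y is kept. As a functional of z it respects the
    -- Boolean axioms and satisfies the knapsack relation in low degree, so it is determined by its
    -- values on d-element sets, and those are 0.
    defect : Vec State n → Vec State n → ℤ
    defect y z = P κ d * L (z ∨ y) - ∑[ subsets ρ d ] (λ I → L (lits I ∨ y) * v I z)

    defect-consistent : ∀ y → Consistent ρ (defect y)
    defect-consistent y = consistent-- ρ
      (consistent-* ρ (P κ d) (consistent-∨ ρ y (consistent-E ρ (moment κ N))))
      (consistent-∑ ρ (subsets ρ d) λ I → consistent-* ρ (L (lits I ∨ y)) (consistent-mask ρ I (consistent-E (mask ρ I) (moment κ d))))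

    -- `L` and all the `v I` obey the relation with the same constant `κ′`, because a mask does not
    -- change the number of ones; hence so does their combination.
    defect-knapsack : ∀ y {p A} → Sub ρ p A → p ℕ.< d → deg ρ y ≤ d →
      + 2 * ∑ᶠ (λ i → defect y (lits A ⊕ i)) ≡ κ′ * defect y (lits A)
    defect-knapsack y {p} {A} sA p<d y≤d = begin
      + 2 * ∑ᶠ (λ i → defect y (lits A ⊕ i))
        ≡⟨ cong (+ 2 *_) (∑ᶠ-- (λ i → P κ d * X i) (λ i → ∑[ S ] (λ I → F I * Y I i))) ⟩
      + 2 * (∑ᶠ (λ i → P κ d * X i) - ∑ᶠ (λ i → ∑[ S ] (λ I → F I * Y I i)))
        ≡⟨ cong (+ 2 *_) (cong₂ _-_ (∑ᶠ-*ˡ (P κ d) X)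
             (trans (∑ᶠ-∑ S (λ I i → F I * Y I i)) (∑-cong S λ I → ∑ᶠ-*ˡ (F I) (Y I)))) ⟩
      + 2 * (P κ d * ∑ᶠ X - ∑[ S ] (λ I → F I * ∑ᶠ (Y I)))
        ≡⟨ distrib (P κ d) (∑ᶠ X) _ ⟩
      P κ d * (+ 2 * ∑ᶠ X) - + 2 * ∑[ S ] (λ I → F I * ∑ᶠ (Y I))
        ≡⟨ cong (λ u → P κ d * (+ 2 * ∑ᶠ X) - u) (sym (∑-*ˡ S (λ I → F I * ∑ᶠ (Y I)) (+ 2))) ⟩
      P κ d * (+ 2 * ∑ᶠ X) - ∑[ S ] (λ I → + 2 * (F I * ∑ᶠ (Y I)))
        ≡⟨ cong₂ (λ u w → P κ d * u - w) X-knapsack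
             (trans (∑-congAll (All.map Y-knapsack (subsets-Sub ρ d))) (∑-*ˡ S (λ I → F I * v I (lits A)) κ′)) ⟩
      P κ d * (κ′ * L (lits A ∨ y)) - κ′ * ∑[ S ] (λ I → F I * v I (lits A))
        ≡⟨ factor (P κ d) κ′ (L (lits A ∨ y)) _ ⟩
      κ′ * defect y (lits A)
        ∎
      where
      open ≡-Reasoning
      S : List (Vec Bool n)
      S = subsets ρ d
      F : Vec Bool n → ℤ
      F I = L (lits I ∨ y)
      X : Fin n → ℤ
      X i = L ((lits A ⊕ i) ∨ y)
      Y : Vec Bool n → Fin n → ℤ
      Y I i = v I (lits A ⊕ i)
      distrib : ∀ p x s → + 2 * (p * x - s) ≡ p * (+ 2 * x) - + 2 * s
      distrib = solve-∀
      factor : ∀ p k x s → p * (k * x) - k * s ≡ k * (p * x - s)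
      factor = solve-∀
      X-knapsack : + 2 * ∑ᶠ X ≡ κ′ * L (lits A ∨ y)
      X-knapsack = trans (cong (+ 2 *_) (∑ᶠ-cong λ i → cong L (sym (⊕-∨ (lits A) y i))))
        -- |A| < d and deg y ≤ d keep the product below degree 2d, hence below N.
        (L-knapsack (lits A ∨ y) (ℕ.≤-<-trans (deg-lits-∨ y sA) (ℕ.<-≤-trans (ℕ.+-mono-<-≤ p<d y≤d) 2d≤N)))
      Y-knapsack : ∀ {I} → Sub ρ d I → + 2 * (F I * ∑ᶠ (Y I)) ≡ κ′ * (F I * v I (lits A))
      Y-knapsack {I} sI = trans (swap (+ 2) (F I) (∑ᶠ (Y I)))
        (trans (cong (F I *_) (v-knapsack sI sA p<d)) (swap (F I) κ′ (v I (lits A))))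
        where
        swap : ∀ a b c → a * (b * c) ≡ b * (a * c)
        swap = solve-∀

    -- The relation Σ xᵢ = k/2 expresses x_A through the x_B with |B| = |A| + 1.
    defect-lits : ∀ y → deg ρ y ≤ d → ∀ j p A → j ℕ.+ p ≡ d → Sub ρ p A → defect y (lits A) ≡ + 0
    defect-lits y y≤d zero p A refl sA = trans
      (cong (λ u → P κ d * L (lits A ∨ y) - u)
        (trans (∑-cong (subsets ρ d) λ I → ℤ.*-comm (L (lits I ∨ y)) (v I (lits A)))
        (trans (∑-mask (moment κ d) (λ I → L (lits I ∨ y)) sA) (cong (_* L (lits A ∨ y)) (moment-top κ d)))))
      (ℤ.+-inverseʳ (P κ d * L (lits A ∨ y)))
    defect-lits y y≤d (suc j) p A e sA = cancel
      (ℤ.i*j≡0⇒i≡0∨j≡0 (κ - + 2 * + p) (collect κ (+ #ones ρ) (+ p) (defect y (lits A)) (trans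
        (sym (defect-knapsack y sA p<d y≤d))
        (cong (+ 2 *_) (∑-consistent (defect-consistent y) sA λ A′ s′ →
          defect-lits y y≤d j (suc p) A′ (trans (ℕ.+-suc j p) e) s′)))))
      where
      p<d : p ℕ.< d
      p<d = subst (p ℕ.<_) e (ℕ.s≤s (ℕ.m≤n+m p j))
      collect : ∀ κ o p x → (κ + + 2 * o) * x ≡ + 2 * ((o + p) * x) → (κ - + 2 * p) * x ≡ + 0
      collect κ o p x h = trans (split κ o p x) (trans (cong (_- + 2 * ((o + p) * x)) h) (ℤ.+-inverseʳ (+ 2 * ((o + p) * x))))
        where
        split : ∀ κ o p x → (κ - + 2 * p) * x ≡ (κ + + 2 * o) * x - + 2 * ((o + p) * x)
        split = solve-∀
      cancel : κ - + 2 * + p ≡ + 0 ⊎ defect y (lits A) ≡ + 0 → defect y (lits A) ≡ + 0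
      cancel (inj₁ κ≡) = ⊥-elim (κ≢ p p<d κ≡)
      cancel (inj₂ z)  = z

    -- `defect-lits` settles products of variables by descending from size d; `consistent-vanish`
    -- extends this to monomials with negated literals.
    homogenize : ∀ z y → deg ρ z ≤ d → deg ρ y ≤ d →
      P κ d * L (z ∨ y) ≡ ∑[ subsets ρ d ] (λ I → L (lits I ∨ y) * v I z)
    homogenize z y z≤d y≤d = ℤ.i-j≡0⇒i≡j _ _ (consistent-vanish ρ d (defect-consistent y)
      (λ p A p≤d sA → defect-lits y y≤d (d ℕ.∸ p) p A (ℕ.m∸n+n≡m p≤d) sA) z z≤d)


  -- Finite differences of the moments and the Gram form.

  -- The value of the functional with moments `g` on a product of a variables and j other, negated
  -- ones.
  diff : ℕ → (ℕ → ℤ) → ℕ → ℤ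
  diff zero    g a = g a
  diff (suc j) g a = diff j g a - diff j g (suc a)

  diff-shift : ∀ j g a → diff j (shift g) a ≡ diff j g (suc a)
  diff-shift zero    g a = refl
  diff-shift (suc j) g a = cong₂ _-_ (diff-shift j g a) (diff-shift j g (suc a))

  card : ∀ {n} → Vec Bool n → ℕ
  card []          = 0
  card (false ∷ K) = card K
  card (true  ∷ K) = suc (card K)

  [_⊆_] : ∀ {n} → Vec Bool n → Vec Bool n → ℤ
  [ []        ⊆ []        ] = + 1
  [ false ∷ K ⊆ _     ∷ I ] = [ K ⊆ I ]
  [ true  ∷ K ⊆ true  ∷ I ] = [ K ⊆ I ]
  [ true  ∷ K ⊆ false ∷ I ] = + 0

  ∣_∖_∣ : ∀ {n} → Vec Bool n → Vec Bool n → ℕ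
  ∣ []        ∖ []        ∣ = 0
  ∣ true  ∷ I ∖ false ∷ K ∣ = suc ∣ I ∖ K ∣
  ∣ true  ∷ I ∖ true  ∷ K ∣ = ∣ I ∖ K ∣
  ∣ false ∷ I ∖ _     ∷ K ∣ = ∣ I ∖ K ∣

  allSubsets : ∀ n → List (Vec Bool n)
  allSubsets zero    = [] ∷ []
  allSubsets (suc n) = map (false ∷_) (allSubsets n) ++ map (true ∷_) (allSubsets n)

  ∑-allSubsets : ∀ n f → ∑[ allSubsets (suc n) ] f
    ≡ ∑[ allSubsets n ] (λ K → f (false ∷ K)) + ∑[ allSubsets n ] (λ K → f (true ∷ K))
  ∑-allSubsets n f = trans (∑-++ (map (false ∷_) (allSubsets n)) (map (true ∷_) (allSubsets n)) f)
    (cong₂ _+_ (∑-map (false ∷_) (allSubsets n) f) (∑-map (true ∷_) (allSubsets n) f))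

  -- Here q stands for |J|. With independent copies of the common variables, an index of K has its
  -- I-copy negated; what stays positive are the elements of I outside K and all of J.
  term : ∀ {n} → (ℕ → ℤ) → ℕ → Vec Bool n → Vec Bool n → Vec Bool n → ℤ
  term g q I J K = [ K ⊆ I ] * [ K ⊆ J ] * diff (card K) g (∣ I ∖ K ∣ ℕ.+ q)

  private
    ∑-false : ∀ n f {g x} → (∀ K → f (true ∷ K) ≡ + 0) → (∀ K → f (false ∷ K) ≡ g K) → x ≡ ∑[ allSubsets n ] g → x ≡ ∑[ allSubsets (suc n) ] f
    ∑-false n f {g} {x} f0 fg e = sym (trans (∑-allSubsets n f) (trans
      (cong₂ _+_ (trans (∑-cong (allSubsets n) fg) (sym e)) (∑-zero (allSubsets n) f0)) (ℤ.+-identityʳ x)))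

    *0* : ∀ a b → a * + 0 * b ≡ + 0
    *0* a b = cong (_* b) (ℤ.*-zeroʳ a)

  -- Each index in I ∩ J is expanded by g a = g (a + 1) + diff 1 g a, as if the second copy of
  -- the variable were fresh; K collects the indices where the second summand is chosen.
  E-lits-∨ : ∀ {n} {ρ : Vec Assign n} {p q I J} g → Sub ρ p I → Sub ρ q J →
    E ρ g (lits I ∨ lits J) ≡ ∑[ allSubsets n ] (term g q I J)
  E-lits-∨ g [] [] = sym (trans (ℤ.+-identityʳ _) (ℤ.*-identityˡ (g 0)))
  E-lits-∨ {suc n} {q = q} {false ∷ I} {false ∷ J} g (skip free s) (skip _ s′) =
    ∑-false n (term g q (false ∷ I) (false ∷ J)) (λ _ → refl) (λ _ → refl) (E-lits-∨ g s s′)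
  E-lits-∨ {suc n} {q = q} {false ∷ I} {false ∷ J} g (skip fixed0 s) (skip _ s′) =
    ∑-false n (term g q (false ∷ I) (false ∷ J)) (λ _ → refl) (λ _ → refl) (E-lits-∨ g s s′)
  E-lits-∨ {suc n} {q = q} {false ∷ I} {false ∷ J} g (skip fixed1 s) (skip _ s′) =
    ∑-false n (term g q (false ∷ I) (false ∷ J)) (λ _ → refl) (λ _ → refl) (E-lits-∨ g s s′)
  E-lits-∨ {suc n} {q = q} {true ∷ I} {false ∷ J} g (take s) (skip _ s′) =
    ∑-false n (term g q (true ∷ I) (false ∷ J))
      (λ K → *0* [ K ⊆ I ] (diff (suc (card K)) g (∣ I ∖ K ∣ ℕ.+ q)))
      (λ K → cong ([ K ⊆ I ] * [ K ⊆ J ] *_) (sym (diff-shift (card K) g (∣ I ∖ K ∣ ℕ.+ q))))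
      (E-lits-∨ (shift g) s s′)
  E-lits-∨ {suc n} {q = suc q} {false ∷ I} {true ∷ J} g (skip _ s) (take s′) =
    ∑-false n (term g (suc q) (false ∷ I) (true ∷ J)) (λ _ → refl)
      (λ K → cong ([ K ⊆ I ] * [ K ⊆ J ] *_) (trans (cong (diff (card K) g) (ℕ.+-suc ∣ I ∖ K ∣ q)) (sym (diff-shift (card K) g (∣ I ∖ K ∣ ℕ.+ q)))))
      (E-lits-∨ (shift g) s s′)
  E-lits-∨ {suc n} {q = suc q} {true ∷ I} {true ∷ J} g (take s) (take s′) = trans (E-lits-∨ (shift g) s s′) (sym (begin
    ∑[ allSubsets (suc n) ] t
      ≡⟨ ∑-allSubsets n t ⟩
    ∑[ allSubsets n ] (λ K → t (false ∷ K)) + ∑[ allSubsets n ] (λ K → t (true ∷ K))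
      ≡⟨ ∑-+ (allSubsets n) (λ K → t (false ∷ K)) (λ K → t (true ∷ K)) ⟨
    ∑[ allSubsets n ] (λ K → t (false ∷ K) + t (true ∷ K))
      ≡⟨ ∑-cong (allSubsets n) merge ⟩
    ∑[ allSubsets n ] (term (shift g) q I J)
      ∎))
    where
    open ≡-Reasoning
    t : Vec Bool (suc n) → ℤ
    t = term g (suc q) (true ∷ I) (true ∷ J)
    cancel : ∀ c a b → c * a + c * (b - a) ≡ c * b
    cancel = solve-∀
    merge : ∀ K → t (false ∷ K) + t (true ∷ K) ≡ term (shift g) q I J K
    merge K = trans
      (cancel ([ K ⊆ I ] * [ K ⊆ J ]) (diff (card K) g (suc (∣ I ∖ K ∣ ℕ.+ suc q))) (diff (card K) g (∣ I ∖ K ∣ ℕ.+ suc q)))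
      (cong ([ K ⊆ I ] * [ K ⊆ J ] *_) (trans (cong (diff (card K) g) (ℕ.+-suc ∣ I ∖ K ∣ q)) (sym (diff-shift (card K) g (∣ I ∖ K ∣ ℕ.+ q)))))

  ⊆-card : ∀ {n} {ρ : Vec Assign n} {p I} → Sub ρ p I → ∀ K → [ K ⊆ I ] ≡ + 0 ⊎ card K ℕ.+ ∣ I ∖ K ∣ ≡ p
  ⊆-card []         []          = inj₂ refl
  ⊆-card (skip _ s) (false ∷ K) = ⊆-card s K
  ⊆-card (skip _ s) (true  ∷ K) = inj₁ refl
  ⊆-card (take s)   (false ∷ K) with ⊆-card s K
  ... | inj₁ z = inj₁ z
  ... | inj₂ e = inj₂ (trans (ℕ.+-suc (card K) _) (cong suc e))
  ⊆-card (take s)   (true  ∷ K) with ⊆-card s K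
  ... | inj₁ z = inj₁ z
  ... | inj₂ e = inj₂ (cong suc e)

  positive-* : ∀ {a b} → + 0 ℤ.< a → + 0 ℤ.< b → + 0 ℤ.< a * b
  positive-* {+ suc a} {+ suc b} _         _         = ℤ.+<+ (ℕ.s≤s ℕ.z≤n)
  positive-* {+ suc a} {+ zero}  _         (ℤ.+<+ ())
  positive-* {+ zero}            (ℤ.+<+ ())

  W-pos : ∀ j → + 0 ℤ.< W j
  W-pos zero    = ℤ.+<+ (ℕ.s≤s ℕ.z≤n)
  W-pos (suc j) = positive-* {+ 2 * + suc j} {W j} (ℤ.+<+ (ℕ.s≤s ℕ.z≤n)) (W-pos j)

  nonneg-* : ∀ {a b} → + 0 ℤ.≤ a → + 0 ℤ.≤ b → + 0 ℤ.≤ a * b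
  nonneg-* {+ a} {+ b} _ _ = subst (+ 0 ℤ.≤_) (ℤ.pos-* a b) (ℤ.+≤+ ℕ.z≤n)

  P-nonneg : ∀ κ a → (∀ i → i ℕ.< a → + 2 * + i ℤ.≤ κ) → + 0 ℤ.≤ P κ a
  P-nonneg κ zero    h = ℤ.+≤+ ℕ.z≤n
  P-nonneg κ (suc a) h = nonneg-* (P-nonneg κ a λ i i<a → h i (ℕ.m≤n⇒m≤1+n i<a)) (ℤ.i≤j⇒0≤j-i (h a ℕ.≤-refl))

  P-nonzero : ∀ κ a → (∀ i → i ℕ.< a → κ - + 2 * + i ≢ + 0) → P κ a ≢ + 0
  P-nonzero κ zero    h ()
  P-nonzero κ (suc a) h e with ℤ.i*j≡0⇒i≡0∨j≡0 (P κ a) e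
  ... | inj₁ z = P-nonzero κ a (λ i i<a → h i (ℕ.m≤n⇒m≤1+n i<a)) z
  ... | inj₂ z = h a ℕ.≤-refl z

  -- The product form exposes the sign: the negated variables behave like variables of a knapsack
  -- with sum N - κ/2. In the induction on j the two summands share all factors but one, and 2(N - a
  -- - j) - (κ - 2a) = (2N - κ) - 2j.
  diff-moment : ∀ κ N j a → a ℕ.+ j ≤ N →
    diff j (moment κ N) a ≡ P κ a * P (+ 2 * + N - κ) j * W (N ℕ.∸ (a ℕ.+ j))
  diff-moment κ N zero    a _ = trans (cong (λ m → P κ a * W (N ℕ.∸ m)) (sym (ℕ.+-identityʳ a)))
    (cong (_* W (N ℕ.∸ (a ℕ.+ 0))) (sym (ℤ.*-identityʳ (P κ a))))
  diff-moment κ N (suc j) a le with ℕ.m≤n⇒∃[o]m+o≡n le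
  ... | o , refl = trans
    (cong₂ _-_ (diff-moment κ N j a (ℕ.≤-trans (ℕ.+-monoʳ-≤ a (ℕ.n≤1+n j)) le))
               (diff-moment κ N j (suc a) (subst (_≤ N) (ℕ.+-suc a j) le)))
    (trans (cong₂ (λ x y → P κ a * Q * W x - P κ (suc a) * Q * W y) e₁ e₂)
    (trans (step κ (+ a) (+ j) (+ o) (P κ a) Q (W o))
    (cong₂ (λ x y → P κ a * (Q * (+ 2 * + x - κ - + 2 * + j)) * W y) (cong (ℕ._+ o) (sym (ℕ.+-suc a j))) (sym (ℕ.m+n∸m≡n (a ℕ.+ suc j) o)))))
    where
    Q = P (+ 2 * + N - κ) j
    e₁ : N ℕ.∸ (a ℕ.+ j) ≡ suc o
    e₁ = trans (cong (λ m → m ℕ.+ o ℕ.∸ (a ℕ.+ j)) (ℕ.+-suc a j))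
      (trans (cong (ℕ._∸ (a ℕ.+ j)) (sym (ℕ.+-suc (a ℕ.+ j) o))) (ℕ.m+n∸m≡n (a ℕ.+ j) (suc o)))
    e₂ : N ℕ.∸ (suc a ℕ.+ j) ≡ o
    e₂ = trans (cong (λ m → m ℕ.+ o ℕ.∸ (suc a ℕ.+ j)) (ℕ.+-suc a j)) (ℕ.m+n∸m≡n (suc a ℕ.+ j) o)
    step : ∀ κ a j o p q w → p * q * (+ 2 * (+ 1 + o) * w) - p * (κ - + 2 * a) * q * w
      ≡ p * (q * (+ 2 * (+ 1 + (a + j) + o) - κ - + 2 * j)) * w
    step = solve-∀

  module Positivity {n} (ρ : Vec Assign n) (κ : ℤ) (d : ℕ)
    (2d≤N : d ℕ.+ d ≤ #free ρ) (κ≢ : ∀ p → p ℕ.< d → κ - + 2 * + p ≢ + 0)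
    (κ≥ : ∀ i → i ℕ.< d ℕ.+ d → + 2 * + i ℤ.≤ κ)
    (κ≤ : ∀ i → i ℕ.< d → + 2 * + i ℤ.≤ + 2 * + #free ρ - κ) where

    open Homogenization ρ κ d 2d≤N κ≢ public

    -- For d-element sets I and J, `d ∸ j + d` is the number of positive variables when |K| = j. A K
    -- with more than d elements lies in no such I; the default 0 makes the weight nonnegative for
    -- it too.
    weight : ℕ → ℤ
    weight j with j ℕ.≤? d
    ... | yes _ = diff j (moment κ N) (d ℕ.∸ j ℕ.+ d)
    ... | no  _ = + 0

    -- By `diff-moment` the signs come from at most 2d factors κ - 2i and at most d factors 2N - κ -
    -- 2i, which is what `κ≥` and `κ≤` cover.
    weight-nonneg : ∀ j → + 0 ℤ.≤ weight j
    weight-nonneg j with j ℕ.≤? d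
    ... | no  _   = ℤ.≤-refl
    ... | yes j≤d = subst (+ 0 ℤ.≤_) (sym (diff-moment κ N j (d ℕ.∸ j ℕ.+ d) (ℕ.≤-trans (ℕ.≤-reflexive sum≡2d) 2d≤N)))
      (nonneg-* (nonneg-*
        (P-nonneg κ (d ℕ.∸ j ℕ.+ d) λ i i< → κ≥ i (ℕ.<-≤-trans i< (ℕ.+-monoˡ-≤ d (ℕ.m∸n≤m d j))))
        (P-nonneg (+ 2 * + N - κ) j λ i i< → κ≤ i (ℕ.<-≤-trans i< j≤d)))
        (ℤ.<⇒≤ (W-pos (N ℕ.∸ (d ℕ.∸ j ℕ.+ d ℕ.+ j)))))
      where
      sum≡2d : d ℕ.∸ j ℕ.+ d ℕ.+ j ≡ d ℕ.+ d
      sum≡2d = trans (ℕ.+-assoc (d ℕ.∸ j) d j) (trans (cong (d ℕ.∸ j ℕ.+_) (ℕ.+-comm d j))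
        (trans (sym (ℕ.+-assoc (d ℕ.∸ j) j d)) (cong (ℕ._+ d) (ℕ.m∸n+n≡m j≤d))))

    term-weight : ∀ {I} → Sub ρ d I → ∀ J K →
      term (moment κ N) d I J K ≡ weight (card K) * ([ K ⊆ I ] * [ K ⊆ J ])
    term-weight {I} sI J K with ⊆-card sI K
    ... | inj₁ z = trans (cong (λ u → u * [ K ⊆ J ] * diff (card K) (moment κ N) (∣ I ∖ K ∣ ℕ.+ d)) z)
      (sym (trans (cong (λ u → weight (card K) * (u * [ K ⊆ J ])) z) (ℤ.*-zeroʳ (weight (card K)))))
    ... | inj₂ e with card K ℕ.≤? d
    ...   | yes _ = trans (ℤ.*-comm ([ K ⊆ I ] * [ K ⊆ J ]) (diff (card K) (moment κ N) (∣ I ∖ K ∣ ℕ.+ d)))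
      (cong (λ m → diff (card K) (moment κ N) (m ℕ.+ d) * ([ K ⊆ I ] * [ K ⊆ J ]))
        (sym (trans (cong (ℕ._∸ card K) (sym e)) (ℕ.m+n∸m≡n (card K) ∣ I ∖ K ∣))))
    ...   | no c≰d = ⊥-elim (c≰d (subst (card K ≤_) e (ℕ.m≤m+n (card K) ∣ I ∖ K ∣)))

    w : Vec Bool n → Vec State n → ℤ
    w K z = ∑[ subsets ρ d ] (λ I → [ K ⊆ I ] * v I z)

    private
      S = subsets ρ d
      T = allSubsets n

      ∑-product : ∀ c (a b : Vec Bool n → ℤ) →
        ∑[ S ] (λ I → ∑[ S ] (λ J → c * (a I * b J))) ≡ c * (∑[ S ] a * ∑[ S ] b)
      ∑-product c a b = trans (∑-cong S λ I → trans (∑-*ˡ S (λ J → a I * b J) c) (cong (c *_) (∑-*ˡ S b (a I))))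
        (trans (∑-*ˡ S (λ I → a I * ∑[ S ] b) c)
        (cong (c *_) (trans (∑-cong S λ I → ℤ.*-comm (a I) (∑[ S ] b)) (trans (∑-*ˡ S a (∑[ S ] b)) (ℤ.*-comm (∑[ S ] b) (∑[ S ] a))))))

      L-lits : ∀ {I J} → Sub ρ d I → Sub ρ d J → ∀ x y →
        L (lits J ∨ lits I) * x * y ≡ ∑[ T ] (λ K → weight (card K) * ([ K ⊆ I ] * y * ([ K ⊆ J ] * x)))
      L-lits {I} {J} sI sJ x y = begin
        L (lits J ∨ lits I) * x * y
          ≡⟨ cong (λ u → u * x * y) (trans (E-lits-∨ (moment κ N) sJ sI) (∑-cong T (term-weight sJ I))) ⟩
        ∑[ T ] (λ K → weight (card K) * ([ K ⊆ J ] * [ K ⊆ I ])) * x * y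
          ≡⟨ regroup _ x y ⟩
        x * y * ∑[ T ] (λ K → weight (card K) * ([ K ⊆ J ] * [ K ⊆ I ]))
          ≡⟨ ∑-*ˡ T (λ K → weight (card K) * ([ K ⊆ J ] * [ K ⊆ I ])) (x * y) ⟨
        ∑[ T ] (λ K → x * y * (weight (card K) * ([ K ⊆ J ] * [ K ⊆ I ])))
          ≡⟨ ∑-cong T (λ K → regroup′ x y (weight (card K)) [ K ⊆ J ] [ K ⊆ I ]) ⟩
        ∑[ T ] (λ K → weight (card K) * ([ K ⊆ I ] * y * ([ K ⊆ J ] * x)))
          ∎
        where
        open ≡-Reasoning
        regroup : ∀ s x y → s * x * y ≡ x * y * s
        regroup = solve-∀
        regroup′ : ∀ x y c a b → x * y * (c * (a * b)) ≡ c * (b * y * (a * x))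
        regroup′ = solve-∀

    -- Both factors are homogenized in turn, each at the price of one `P κ d`, so nothing has to be
    -- divided. Once the sum over K is outermost, the sums over I and J separate into a product.
    gram : ∀ z y → deg ρ z ≤ d → deg ρ y ≤ d →
      P κ d * (P κ d * L (z ∨ y)) ≡ ∑[ T ] (λ K → weight (card K) * (w K z * w K y))
    gram z y z≤d y≤d = begin
      P κ d * (P κ d * L (z ∨ y))
        ≡⟨ cong (P κ d *_) (homogenize z y z≤d y≤d) ⟩
      P κ d * ∑[ S ] (λ I → L (lits I ∨ y) * v I z)
        ≡⟨ ∑-*ˡ S (λ I → L (lits I ∨ y) * v I z) (P κ d) ⟨
      ∑[ S ] (λ I → P κ d * (L (lits I ∨ y) * v I z))
        ≡⟨ ∑-congAll (All.map inner (subsets-Sub ρ d)) ⟩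
      ∑[ S ] (λ I → ∑[ S ] (λ J → ∑[ T ] (λ K → G I J K)))
        ≡⟨ ∑-cong S (λ I → ∑-swap S T (G I)) ⟩
      ∑[ S ] (λ I → ∑[ T ] (λ K → ∑[ S ] (λ J → G I J K)))
        ≡⟨ ∑-swap S T (λ I K → ∑[ S ] (λ J → G I J K)) ⟩
      ∑[ T ] (λ K → ∑[ S ] (λ I → ∑[ S ] (λ J → G I J K)))
        ≡⟨ ∑-cong T (λ K → ∑-product (weight (card K)) (λ I → [ K ⊆ I ] * v I z) (λ J → [ K ⊆ J ] * v J y)) ⟩
      ∑[ T ] (λ K → weight (card K) * (w K z * w K y))
        ∎
      where
      open ≡-Reasoning
      G : Vec Bool n → Vec Bool n → Vec Bool n → ℤ
      G I J K = weight (card K) * ([ K ⊆ I ] * v I z * ([ K ⊆ J ] * v J y))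
      inner : ∀ {I} → Sub ρ d I → P κ d * (L (lits I ∨ y) * v I z) ≡ ∑[ S ] (λ J → ∑[ T ] (G I J))
      inner {I} sI = begin
        P κ d * (L (lits I ∨ y) * v I z)
          ≡⟨ cong (λ u → P κ d * (L u * v I z)) (∨-comm (lits I) y) ⟩
        P κ d * (L (y ∨ lits I) * v I z)
          ≡⟨ ℤ.*-assoc (P κ d) (L (y ∨ lits I)) (v I z) ⟨
        P κ d * L (y ∨ lits I) * v I z
          ≡⟨ cong (_* v I z) (homogenize y (lits I) y≤d (deg-lits sI)) ⟩
        ∑[ S ] (λ J → L (lits J ∨ lits I) * v J y) * v I z
          ≡⟨ ℤ.*-comm _ (v I z) ⟩
        v I z * ∑[ S ] (λ J → L (lits J ∨ lits I) * v J y)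
          ≡⟨ ∑-*ˡ S (λ J → L (lits J ∨ lits I) * v J y) (v I z) ⟨
        ∑[ S ] (λ J → v I z * (L (lits J ∨ lits I) * v J y))
          ≡⟨ ∑-congAll (All.map (λ {J} sJ → trans (ℤ.*-comm (v I z) _) (L-lits sI sJ (v J y) (v I z))) (subsets-Sub ρ d)) ⟩
        ∑[ S ] (λ J → ∑[ T ] (G I J))
          ∎

open PseudoExpectation

-- Monomials killed by a restriction.

module Restriction where

  open import Data.Nat.Base using (_+_; _*_; _∸_; _^_; z≤n; s≤s)
  open import Data.Nat.Properties
  open import Data.Nat.Tactic.RingSolver using (solve-∀)

  open ∑ⁿ

  kills : Assign → State → Bool
  kills free   both = true
  kills fixed0 pos  = true
  kills fixed0 both = true
  kills fixed1 neg  = true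
  kills fixed1 both = true
  kills _      _    = false

  dead : ∀ {n} → Vec Assign n → Vec State n → Bool
  dead []      []      = false
  dead (r ∷ ρ) (s ∷ z) = kills r s Bool.∨ dead ρ z

  E-dead : ∀ {n} (ρ : Vec Assign n) g z → dead ρ z ≡ true → E ρ g z ≡ ℤ.+ 0
  E-dead []           g []         ()
  E-dead (free   ∷ ρ) g (none ∷ z) e = E-dead ρ g z e
  E-dead (free   ∷ ρ) g (pos  ∷ z) e = E-dead ρ (shift g) z e
  E-dead (free   ∷ ρ) g (neg  ∷ z) e = cong₂ ℤ._-_ (E-dead ρ g z e) (E-dead ρ (shift g) z e)
  E-dead (free   ∷ ρ) g (both ∷ z) e = refl
  E-dead (fixed0 ∷ ρ) g (none ∷ z) e = E-dead ρ g z e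
  E-dead (fixed0 ∷ ρ) g (pos  ∷ z) e = refl
  E-dead (fixed0 ∷ ρ) g (neg  ∷ z) e = E-dead ρ g z e
  E-dead (fixed0 ∷ ρ) g (both ∷ z) e = refl
  E-dead (fixed1 ∷ ρ) g (none ∷ z) e = E-dead ρ g z e
  E-dead (fixed1 ∷ ρ) g (pos  ∷ z) e = E-dead ρ g z e
  E-dead (fixed1 ∷ ρ) g (neg  ∷ z) e = refl
  E-dead (fixed1 ∷ ρ) g (both ∷ z) e = refl

  kills-⊔ˢ : ∀ r s t → kills r s Bool.≤ kills r (s ⊔ˢ t)
  kills-⊔ˢ free   none t    = Bool.≤-minimum _
  kills-⊔ˢ free   pos  t    = Bool.≤-minimum _
  kills-⊔ˢ free   neg  t    = Bool.≤-minimum _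
  kills-⊔ˢ free   both t    = Bool.b≤b
  kills-⊔ˢ fixed0 none t    = Bool.≤-minimum _
  kills-⊔ˢ fixed0 pos  none = Bool.b≤b
  kills-⊔ˢ fixed0 pos  pos  = Bool.b≤b
  kills-⊔ˢ fixed0 pos  neg  = Bool.b≤b
  kills-⊔ˢ fixed0 pos  both = Bool.b≤b
  kills-⊔ˢ fixed0 neg  t    = Bool.≤-minimum _
  kills-⊔ˢ fixed0 both t    = Bool.b≤b
  kills-⊔ˢ fixed1 none t    = Bool.≤-minimum _
  kills-⊔ˢ fixed1 pos  t    = Bool.≤-minimum _
  kills-⊔ˢ fixed1 neg  none = Bool.b≤b
  kills-⊔ˢ fixed1 neg  pos  = Bool.b≤b
  kills-⊔ˢ fixed1 neg  neg  = Bool.b≤b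
  kills-⊔ˢ fixed1 neg  both = Bool.b≤b
  kills-⊔ˢ fixed1 both t    = Bool.b≤b

  kills-restrict : ∀ r b s → kills r s Bool.≤ kills (restrict r b) s
  kills-restrict free   true  s    = Bool.≤-refl
  kills-restrict free   false none = Bool.b≤b
  kills-restrict free   false pos  = Bool.f≤t
  kills-restrict free   false neg  = Bool.b≤b
  kills-restrict free   false both = Bool.b≤b
  kills-restrict fixed0 b     s    = Bool.≤-refl
  kills-restrict fixed1 b     s    = Bool.≤-refl

  private
    ∨-true : ∀ {a b c d} → a Bool.≤ c → (b ≡ true → d ≡ true) → a Bool.∨ b ≡ true → c Bool.∨ d ≡ true
    ∨-true {true}          Bool.b≤b h e = refl
    ∨-true {false} {c = c} Bool.f≤t h e = refl
    ∨-true {false}         Bool.b≤b h e = h e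

  dead-∨ : ∀ {n} (ρ : Vec Assign n) z y → dead ρ z ≡ true → dead ρ (z ∨ y) ≡ true
  dead-∨ []      []      []      ()
  dead-∨ (r ∷ ρ) (s ∷ z) (t ∷ y) = ∨-true (kills-⊔ˢ r s t) (dead-∨ ρ z y)

  -- A mask only fixes more variables. Therefore every coefficient `v I` of a dead monomial
  -- vanishes, and the Gram identity reads 0 = 0 for it.
  dead-mask : ∀ {n} (ρ : Vec Assign n) I z → dead ρ z ≡ true → dead (mask ρ I) z ≡ true
  dead-mask []      []      []      ()
  dead-mask (r ∷ ρ) (b ∷ I) (s ∷ z) = ∨-true (kills-restrict r b s) (dead-mask ρ I z)

  addPos≡⊔pos : ∀ s → addPos s ≡ s ⊔ˢ pos
  addPos≡⊔pos none = refl
  addPos≡⊔pos pos  = refl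
  addPos≡⊔pos neg  = refl
  addPos≡⊔pos both = refl

  dead-⊕ : ∀ {n} (ρ : Vec Assign n) z i → dead ρ z ≡ true → dead ρ (z ⊕ i) ≡ true
  dead-⊕ (r ∷ ρ) (s ∷ z) zero    =
    ∨-true (subst (λ u → kills r s Bool.≤ kills r u) (sym (addPos≡⊔pos s)) (kills-⊔ˢ r s pos)) (λ e → e)
  dead-⊕ (r ∷ ρ) (s ∷ z) (suc i) = ∨-true (Bool.≤-refl {kills r s}) (dead-⊕ ρ z i)

  -- Greedy choice of the restriction

  -- A 0/1 value, so that counting and double counting are sums. Dead monomials count 0 whatever
  -- their degree.
  wide : ℕ → ∀ {n} → Vec Assign n → Vec State n → ℕ
  wide D ρ z = if dead ρ z then 0 else if D ℕ.≤ᵇ deg ρ z then 1 else 0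

  ≤ᵇ-true : ∀ {m n} → m ≤ n → (m ℕ.≤ᵇ n) ≡ true
  ≤ᵇ-true {m} {n} m≤n with m ℕ.≤ᵇ n in eq
  ... | true  = refl
  ... | false with () ← subst Bool.T eq (≤⇒≤ᵇ m≤n)

  wide-mono : ∀ D {n} (ρ ρ′ : Vec Assign n) z → (dead ρ z ≡ true → dead ρ′ z ≡ true) → deg ρ′ z ≤ deg ρ z →
    wide D ρ′ z ≤ wide D ρ z
  wide-mono D ρ ρ′ z dead-mono deg-mono with dead ρ z | dead ρ′ z
  ... | _     | true  = z≤n
  ... | true  | false with () ← dead-mono refl
  ... | false | false with D ℕ.≤ᵇ deg ρ′ z in eq
  ...   | false = z≤n
  ...   | true  = ≤-reflexive (cong (if_then 1 else 0) (sym
    (≤ᵇ-true {D} (≤-trans (≤ᵇ⇒≤ D _ (subst Bool.T (sym eq) _)) deg-mono))))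

  wide-dead : ∀ D {n} (ρ : Vec Assign n) z → dead ρ z ≡ true → wide D ρ z ≡ 0
  wide-dead D ρ z e rewrite e = refl

  wide≤1 : ∀ D {n} (ρ : Vec Assign n) z → wide D ρ z ≤ 1
  wide≤1 D ρ z with dead ρ z | D ℕ.≤ᵇ deg ρ z
  ... | true  | _     = z≤n
  ... | false | true  = ≤-refl
  ... | false | false = z≤n

  wide-deg : ∀ D {n} (ρ : Vec Assign n) z → D * wide D ρ z ≤ wide D ρ z * deg ρ z
  wide-deg D ρ z with dead ρ z | D ℕ.≤ᵇ deg ρ z in eq
  ... | true  | _     = ≤-reflexive (*-zeroʳ D)
  ... | false | false = ≤-reflexive (*-zeroʳ D)
  ... | false | true  = ≤-trans (≤-reflexive (*-identityʳ D)) (≤-trans (≤ᵇ⇒≤ D _ (subst Bool.T (sym eq) _)) (≤-reflexive (sym (*-identityˡ _))))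

  wide≡0 : ∀ d {n} (ρ : Vec Assign n) z → wide (suc d) ρ z ≡ 0 → dead ρ z ≡ true ⊎ deg ρ z ≤ d
  wide≡0 d ρ z e with dead ρ z
  ... | true  = inj₁ refl
  ... | false with suc d ≤? deg ρ z
  ...   | no  d≮ = inj₂ (≮⇒≥ d≮)
  ...   | yes d< with () ← trans (sym (cong (if_then 1 else 0) (≤ᵇ-true d<))) e

  data Falsifies : Assign → State → Set where
    fixed0-pos : Falsifies fixed0 pos
    fixed1-neg : Falsifies fixed1 neg

  lit? : State → Assign → State → ℕ
  lit? pos = isPos
  lit? neg = isNeg
  lit? _ _ _ = 0

  lit?-fixed0 : ∀ l s → lit? l fixed0 s ≡ 0
  lit?-fixed0 none s = refl
  lit?-fixed0 pos  s = refl
  lit?-fixed0 neg  s = refl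
  lit?-fixed0 both s = refl

  lit?-fixed1 : ∀ l s → lit? l fixed1 s ≡ 0
  lit?-fixed1 none s = refl
  lit?-fixed1 pos  s = refl
  lit?-fixed1 neg  s = refl
  lit?-fixed1 both s = refl

  kills-fix : ∀ {a l} → Falsifies a l → ∀ s → kills free s Bool.≤ kills a s
  kills-fix fixed0-pos none = Bool.b≤b
  kills-fix fixed0-pos pos  = Bool.f≤t
  kills-fix fixed0-pos neg  = Bool.b≤b
  kills-fix fixed0-pos both = Bool.b≤b
  kills-fix fixed1-neg none = Bool.b≤b
  kills-fix fixed1-neg pos  = Bool.b≤b
  kills-fix fixed1-neg neg  = Bool.f≤t
  kills-fix fixed1-neg both = Bool.b≤b

  isLit-fix : ∀ {a l} → Falsifies a l → ∀ s → isLit a s ≤ isLit free s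
  isLit-fix fixed0-pos s = z≤n
  isLit-fix fixed1-neg s = z≤n

  -- Fixing a free variable kills more monomials and lowers degrees, so no monomial becomes wide.
  fix-mono : ∀ {n a l} → Falsifies a l → (ρ : Vec Assign n) (i : Fin n) → lookup ρ i ≡ free → ∀ z →
    (dead ρ z ≡ true → dead (ρ [ i ]≔ a) z ≡ true) × deg (ρ [ i ]≔ a) z ≤ deg ρ z
  fix-mono f (free ∷ ρ) zero    e (s ∷ z) = ∨-true (kills-fix f s) (λ e → e) , +-monoˡ-≤ (deg ρ z) (isLit-fix f s)
  fix-mono f (r    ∷ ρ) (suc i) e (s ∷ z) =
    let (p , q) = fix-mono f ρ i e z in ∨-true (Bool.≤-refl {kills r s}) p , +-monoʳ-≤ (isLit r s) q

  fix-hit : ∀ {n a l} → Falsifies a l → (ρ : Vec Assign n) (i : Fin n) (z : Vec State n) →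
    lit? l (lookup ρ i) (lookup z i) ≡ 0 ⊎ lit? l (lookup ρ i) (lookup z i) ≡ 1 × dead (ρ [ i ]≔ a) z ≡ true
  fix-hit fixed0-pos (fixed0 ∷ ρ) zero (s    ∷ z) = inj₁ refl
  fix-hit fixed0-pos (fixed1 ∷ ρ) zero (s    ∷ z) = inj₁ refl
  fix-hit fixed0-pos (free   ∷ ρ) zero (none ∷ z) = inj₁ refl
  fix-hit fixed0-pos (free   ∷ ρ) zero (pos  ∷ z) = inj₂ (refl , refl)
  fix-hit fixed0-pos (free   ∷ ρ) zero (neg  ∷ z) = inj₁ refl
  fix-hit fixed0-pos (free   ∷ ρ) zero (both ∷ z) = inj₁ refl
  fix-hit fixed1-neg (fixed0 ∷ ρ) zero (s    ∷ z) = inj₁ refl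
  fix-hit fixed1-neg (fixed1 ∷ ρ) zero (s    ∷ z) = inj₁ refl
  fix-hit fixed1-neg (free   ∷ ρ) zero (none ∷ z) = inj₁ refl
  fix-hit fixed1-neg (free   ∷ ρ) zero (pos  ∷ z) = inj₁ refl
  fix-hit fixed1-neg (free   ∷ ρ) zero (neg  ∷ z) = inj₂ (refl , refl)
  fix-hit fixed1-neg (free   ∷ ρ) zero (both ∷ z) = inj₁ refl
  fix-hit f (r ∷ ρ) (suc i) (s ∷ z) with fix-hit f ρ i z
  ... | inj₁ e       = inj₁ e
  ... | inj₂ (e , p) = inj₂ (e , ∨-true (Bool.≤-minimum (kills r s)) (λ e → e) p)

  #free-fix : ∀ {n} a (ρ : Vec Assign n) i → #free ρ ≤ suc (#free (ρ [ i ]≔ a))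
  #free-fix free   (r      ∷ ρ) zero    = ≤-trans (#free≤ r) (n≤1+n _)
    where
    #free≤ : ∀ r → #free (r ∷ ρ) ≤ suc (#free ρ)
    #free≤ free   = ≤-refl
    #free≤ fixed0 = n≤1+n _
    #free≤ fixed1 = n≤1+n _
  #free-fix fixed0 (free   ∷ ρ) zero    = ≤-refl
  #free-fix fixed0 (fixed0 ∷ ρ) zero    = n≤1+n _
  #free-fix fixed0 (fixed1 ∷ ρ) zero    = n≤1+n _
  #free-fix fixed1 (free   ∷ ρ) zero    = ≤-refl
  #free-fix fixed1 (fixed0 ∷ ρ) zero    = n≤1+n _
  #free-fix fixed1 (fixed1 ∷ ρ) zero    = n≤1+n _
  #free-fix a      (free   ∷ ρ) (suc i) = s≤s (#free-fix a ρ i)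
  #free-fix a      (fixed0 ∷ ρ) (suc i) = #free-fix a ρ i
  #free-fix a      (fixed1 ∷ ρ) (suc i) = #free-fix a ρ i

  #ones-fix : ∀ {n} a (ρ : Vec Assign n) i → #ones (ρ [ i ]≔ a) ≤ suc (#ones ρ)
  #ones-fix a (r ∷ ρ) zero = ≤-trans (upper a) (s≤s (lower r))
    where
    upper : ∀ a → #ones (a ∷ ρ) ≤ suc (#ones ρ)
    upper free   = n≤1+n _
    upper fixed0 = n≤1+n _
    upper fixed1 = ≤-refl
    lower : ∀ r → #ones ρ ≤ #ones (r ∷ ρ)
    lower free   = ≤-refl
    lower fixed0 = ≤-refl
    lower fixed1 = n≤1+n _
  #ones-fix a (free   ∷ ρ) (suc i) = #ones-fix a ρ i
  #ones-fix a (fixed0 ∷ ρ) (suc i) = #ones-fix a ρ i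
  #ones-fix a (fixed1 ∷ ρ) (suc i) = s≤s (#ones-fix a ρ i)

  ∑-≤ : ∀ {A : Set} (as : List A) {f g : A → ℕ} → (∀ a → f a ≤ g a) → ∑[ as ] f ≤ ∑[ as ] g
  ∑-≤ []       h = z≤n
  ∑-≤ (a ∷ as) h = +-mono-≤ (h a) (∑-≤ as h)

  ∑≡0 : ∀ {A : Set} (as : List A) {f : A → ℕ} → ∑[ as ] f ≡ 0 → All (λ a → f a ≡ 0) as
  ∑≡0 []       e = []
  ∑≡0 (a ∷ as) {f} e = m+n≡0⇒m≡0 (f a) e ∷ ∑≡0 as (m+n≡0⇒n≡0 (f a) e)

  pigeonhole : ∀ {n} (f : Fin (suc n) → ℕ) → ∃[ i ] ∑ᶠ f ≤ suc n * f i
  pigeonhole {zero}  f = zero , ≤-refl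
  pigeonhole {suc n} f with pigeonhole (f ∘ suc)
  ... | j , h with ≤-total (f zero) (f (suc j))
  ...   | inj₁ f0≤fj = suc j , +-mono-≤ f0≤fj h
  ...   | inj₂ fj≤f0 = zero , +-monoʳ-≤ (f zero) (≤-trans h (*-monoʳ-≤ (suc n) fj≤f0))

  deg≡∑ : ∀ {n} (ρ : Vec Assign n) z → deg ρ z ≡ ∑ᶠ (λ i → isLit (lookup ρ i) (lookup z i))
  deg≡∑ []      []      = refl
  deg≡∑ (r ∷ ρ) (s ∷ z) = cong (λ u → isLit r s + u) (deg≡∑ ρ z)

  module Greedy {n-1 : ℕ} (D : ℕ) (U : List (Vec State (suc n-1))) where

    n : ℕ
    n = suc n-1

    #wide : Vec Assign n → ℕ
    #wide ρ = ∑[ U ] (wide D ρ)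

    #hit : State → Vec Assign n → Fin n → ℕ
    #hit l ρ i = ∑[ U ] (λ z → wide D ρ z * lit? l (lookup ρ i) (lookup z i))

    private
      unchanged : ∀ ρ (f : Vec State n → ℕ) → (∀ z → f z ≡ 0) → ∃[ ρ′ ]
        #wide ρ′ + ∑[ U ] (λ z → wide D ρ z * f z) ≤ #wide ρ × #free ρ ≤ suc (#free ρ′) × #ones ρ′ ≤ suc (#ones ρ)
      unchanged ρ f f≡0 = ρ , ≤-reflexive (trans
        (cong (λ u → #wide ρ + u) (∑-zero U λ z → trans (cong (wide D ρ z *_) (f≡0 z)) (*-zeroʳ (wide D ρ z))))
        (+-identityʳ (#wide ρ))) , n≤1+n _ , n≤1+n _

    -- If the variable is already fixed, it contributes no literal to any degree, the hit count is 0
    -- and ρ can stay. Otherwise every wide monomial containing the literal dies.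
    fix : ∀ {a l} → Falsifies a l → ∀ ρ i → ∃[ ρ′ ]
      #wide ρ′ + #hit l ρ i ≤ #wide ρ × #free ρ ≤ suc (#free ρ′) × #ones ρ′ ≤ suc (#ones ρ)
    fix {a} {l} f ρ i with lookup ρ i in eq
    ... | fixed0 = unchanged ρ (λ z → lit? l fixed0 (lookup z i)) λ z → lit?-fixed0 l (lookup z i)
    ... | fixed1 = unchanged ρ (λ z → lit? l fixed1 (lookup z i)) λ z → lit?-fixed1 l (lookup z i)
    ... | free = ρ [ i ]≔ a
      , ≤-trans (≤-reflexive (sym (∑-+ U (wide D (ρ [ i ]≔ a)) (λ z → wide D ρ z * lit? l free (lookup z i))))) (∑-≤ U each)
      , #free-fix a ρ i , #ones-fix a ρ i
      where
      open ≤-Reasoning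
      each : ∀ z → wide D (ρ [ i ]≔ a) z + wide D ρ z * lit? l free (lookup z i) ≤ wide D ρ z
      each z with fix-hit f ρ i z
      ... | inj₁ e = begin
        wide D (ρ [ i ]≔ a) z + wide D ρ z * lit? l free (lookup z i)
          ≡⟨ cong (λ u → wide D (ρ [ i ]≔ a) z + wide D ρ z * u) (trans (cong (λ r → lit? l r (lookup z i)) (sym eq)) e) ⟩
        wide D (ρ [ i ]≔ a) z + wide D ρ z * 0
          ≡⟨ trans (cong (λ u → wide D (ρ [ i ]≔ a) z + u) (*-zeroʳ (wide D ρ z))) (+-identityʳ (wide D (ρ [ i ]≔ a) z)) ⟩
        wide D (ρ [ i ]≔ a) z
          ≤⟨ wide-mono D ρ (ρ [ i ]≔ a) z (proj₁ (fix-mono f ρ i eq z)) (proj₂ (fix-mono f ρ i eq z)) ⟩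
        wide D ρ z ∎
      ... | inj₂ (e , p) = ≤-reflexive (cong₂ (λ u w → u + w) (wide-dead D (ρ [ i ]≔ a) z p)
        (trans (cong (wide D ρ z *_) (trans (cong (λ r → lit? l r (lookup z i)) (sym eq)) e)) (*-identityʳ (wide D ρ z))))

    -- Double counting of the pairs of a wide monomial and a free literal in it.
    ∑-hits : ∀ ρ → D * #wide ρ ≤ ∑ᶠ (λ i → #hit pos ρ i + #hit neg ρ i)
    ∑-hits ρ = begin
      D * #wide ρ                                   ≡⟨ ∑-*ˡ U (wide D ρ) D ⟨
      ∑[ U ] (λ z → D * wide D ρ z)                 ≤⟨ ∑-≤ U (wide-deg D ρ) ⟩
      ∑[ U ] (λ z → wide D ρ z * deg ρ z)           ≡⟨ ∑-cong U (λ z → trans (cong (wide D ρ z *_) (deg≡∑ ρ z))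
                                                          (sym (∑ᶠ-*ˡ (wide D ρ z) (λ i → isLit (lookup ρ i) (lookup z i))))) ⟩
      ∑[ U ] (λ z → ∑ᶠ (λ i → wide D ρ z * isLit (lookup ρ i) (lookup z i)))
        ≡⟨ ∑ᶠ-∑ U (λ z i → wide D ρ z * isLit (lookup ρ i) (lookup z i)) ⟨
      ∑ᶠ (λ i → ∑[ U ] (λ z → wide D ρ z * isLit (lookup ρ i) (lookup z i)))
        ≡⟨ ∑ᶠ-cong (λ i → trans (∑-cong U (λ z → *-distribˡ-+ (wide D ρ z) (isPos (lookup ρ i) (lookup z i)) (isNeg (lookup ρ i) (lookup z i))))
             (∑-+ U (λ z → wide D ρ z * isPos (lookup ρ i) (lookup z i)) (λ z → wide D ρ z * isNeg (lookup ρ i) (lookup z i)))) ⟩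
      ∑ᶠ (λ i → #hit pos ρ i + #hit neg ρ i)        ∎
      where open ≤-Reasoning

    -- Some index has at least a 1/n share of all hits, and the more frequent of its two literals at
    -- least half of that. The inequality is the shrinking by 1 - D/2n, cleared of denominators.
    step : ∀ ρ → ∃[ ρ′ ] (2 * n * #wide ρ′ + D * #wide ρ ≤ 2 * n * #wide ρ) ×
      #free ρ ≤ suc (#free ρ′) × #ones ρ′ ≤ suc (#ones ρ)
    step ρ with pigeonhole (λ i → #hit pos ρ i + #hit neg ρ i)
    ... | i , h with ≤-total (#hit pos ρ i) (#hit neg ρ i)
    ...   | inj₁ p≤q = finish (fix fixed1-neg ρ i) (≤-trans (*-monoʳ-≤ n (+-monoˡ-≤ _ p≤q)) (≤-reflexive (double n (#hit neg ρ i))))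
      where
      double : ∀ n q → n * (q + q) ≡ 2 * n * q
      double = solve-∀
      finish : (∃[ ρ′ ] #wide ρ′ + #hit neg ρ i ≤ #wide ρ × #free ρ ≤ suc (#free ρ′) × #ones ρ′ ≤ suc (#ones ρ)) →
        n * (#hit pos ρ i + #hit neg ρ i) ≤ 2 * n * #hit neg ρ i → _
      finish (ρ′ , w , f , o) g = ρ′ , (begin
        2 * n * #wide ρ′ + D * #wide ρ                 ≤⟨ +-monoʳ-≤ (2 * n * #wide ρ′) (≤-trans (∑-hits ρ) (≤-trans h g)) ⟩
        2 * n * #wide ρ′ + 2 * n * #hit neg ρ i        ≡⟨ *-distribˡ-+ (2 * n) (#wide ρ′) (#hit neg ρ i) ⟨
        2 * n * (#wide ρ′ + #hit neg ρ i)              ≤⟨ *-monoʳ-≤ (2 * n) w ⟩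
        2 * n * #wide ρ                                ∎) , f , o
        where open ≤-Reasoning
    ...   | inj₂ q≤p = finish (fix fixed0-pos ρ i) (≤-trans (*-monoʳ-≤ n (+-monoʳ-≤ (#hit pos ρ i) q≤p)) (≤-reflexive (double n (#hit pos ρ i))))
      where
      double : ∀ n q → n * (q + q) ≡ 2 * n * q
      double = solve-∀
      finish : (∃[ ρ′ ] #wide ρ′ + #hit pos ρ i ≤ #wide ρ × #free ρ ≤ suc (#free ρ′) × #ones ρ′ ≤ suc (#ones ρ)) →
        n * (#hit pos ρ i + #hit neg ρ i) ≤ 2 * n * #hit pos ρ i → _
      finish (ρ′ , w , f , o) g = ρ′ , (begin
        2 * n * #wide ρ′ + D * #wide ρ                 ≤⟨ +-monoʳ-≤ (2 * n * #wide ρ′) (≤-trans (∑-hits ρ) (≤-trans h g)) ⟩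
        2 * n * #wide ρ′ + 2 * n * #hit pos ρ i        ≡⟨ *-distribˡ-+ (2 * n) (#wide ρ′) (#hit pos ρ i) ⟨
        2 * n * (#wide ρ′ + #hit pos ρ i)              ≤⟨ *-monoʳ-≤ (2 * n) w ⟩
        2 * n * #wide ρ                                ∎) , f , o
        where open ≤-Reasoning

    #free-replicate : ∀ m → #free (replicate m free) ≡ m
    #free-replicate zero    = refl
    #free-replicate (suc m) = cong suc (#free-replicate m)

    #ones-replicate : ∀ m → #ones (replicate m free) ≡ 0
    #ones-replicate zero    = refl
    #ones-replicate (suc m) = #ones-replicate m

    iterate : ∀ t → ∃[ ρ ] ((2 * n) ^ t * #wide ρ ≤ (2 * n ∸ D) ^ t * length U) ×
      n ≤ #free ρ + t × #ones ρ ≤ t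
    iterate zero = replicate n free
      , *-monoʳ-≤ 1 (≤-trans (∑-≤ U (wide≤1 D (replicate n free))) (≤-reflexive (∑-1 U)))
      , ≤-reflexive (trans (sym (#free-replicate n)) (sym (+-identityʳ _)))
      , ≤-reflexive (#ones-replicate n)
      where
      ∑-1 : ∀ {A : Set} (as : List A) → ∑[ as ] (λ _ → 1) ≡ length as
      ∑-1 []       = refl
      ∑-1 (a ∷ as) = cong suc (∑-1 as)
    iterate (suc t) with iterate t
    ... | ρ , w , f , o with step ρ
    ... | ρ′ , w′ , f′ , o′ = ρ′ , (begin
      2 * n * (2 * n) ^ t * #wide ρ′                    ≡⟨ swap (2 * n) ((2 * n) ^ t) (#wide ρ′) ⟩
      (2 * n) ^ t * (2 * n * #wide ρ′)                  ≤⟨ *-monoʳ-≤ ((2 * n) ^ t) (m+n≤o⇒m≤o∸n (2 * n * #wide ρ′) w′) ⟩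
      (2 * n) ^ t * (2 * n * #wide ρ ∸ D * #wide ρ)     ≡⟨ cong ((2 * n) ^ t *_) (*-distribʳ-∸ (#wide ρ) (2 * n) D) ⟨
      (2 * n) ^ t * ((2 * n ∸ D) * #wide ρ)             ≡⟨ swap (2 * n ∸ D) ((2 * n) ^ t) (#wide ρ) ⟨
      (2 * n ∸ D) * (2 * n) ^ t * #wide ρ               ≡⟨ *-assoc (2 * n ∸ D) _ _ ⟩
      (2 * n ∸ D) * ((2 * n) ^ t * #wide ρ)             ≤⟨ *-monoʳ-≤ (2 * n ∸ D) w ⟩
      (2 * n ∸ D) * ((2 * n ∸ D) ^ t * length U)        ≡⟨ *-assoc (2 * n ∸ D) _ _ ⟨
      (2 * n ∸ D) * (2 * n ∸ D) ^ t * length U          ∎)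
      , ≤-trans f (≤-trans (+-monoˡ-≤ t f′) (≤-reflexive (sym (+-suc (#free ρ′) t))))
      , ≤-trans o′ (s≤s o)
      where
      open ≤-Reasoning
      swap : ∀ a b c → a * b * c ≡ b * (a * c)
      swap = solve-∀

  -- The count of wide monomials left after t steps is an integer that the hypothesis forces below
  -- 1.
  greedy : ∀ {n-1} d (U : List (Vec State (suc n-1))) t → let n = suc n-1 in
    length U * (2 * n ∸ suc d) ^ t ℕ.< (2 * n) ^ t →
    ∃[ ρ ] All (λ z → dead ρ z ≡ true ⊎ deg ρ z ≤ d) U × n ≤ #free ρ + t × #ones ρ ≤ t
  greedy {n-1} d U t small with Greedy.iterate (suc d) U t
  ... | ρ , w , f , o = ρ , All.map (λ {z} → wide≡0 d ρ z) (∑≡0 U none-wide) , f , o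
    where
    none-wide : ∑[ U ] (wide (suc d) ρ) ≡ 0
    none-wide with ∑[ U ] (wide (suc d) ρ)
    ... | zero  = refl
    ... | suc m with () ← <⇒≱ small (≤-trans (≤-trans (m≤m*n _ (suc m)) w) (≤-reflexive (*-comm _ (length U))))

open Restriction

-- From exponent vectors to states, and the degree lower bound.

module DegreeBound where

  open import Data.Integer.Base using (_+_; _-_; _*_)
  open import Data.Integer.Tactic.RingSolver using (solve-∀)

  addNeg : State → State
  addNeg none = neg
  addNeg pos  = both
  addNeg neg  = neg
  addNeg both = both

  -- The axiom xᵢ + x̄ᵢ = 1 multiplied by a monomial that may itself contain literals of the same
  -- pair.
  consistent-split : ∀ {n} (ρ : Vec Assign n) {Φ} → Consistent ρ Φ → ∀ z i →
    Φ (z ⊕ i) + Φ (updateAt z i addNeg) ≡ Φ z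
  consistent-split (r ∷ ρ) {Φ} (l , c) (s ∷ z) (suc i) = consistent-split ρ (c s) z i
  consistent-split (r ∷ ρ) {Φ} (l , c) (s ∷ z) zero    = local r (λ s → Φ (s ∷ z)) (l z) s
    where
    cancel : ∀ a b → a + (b - a) ≡ b
    cancel = solve-∀
    local : ∀ r f → Local r f → ∀ s → f (addPos s) + f (addNeg s) ≡ f s
    local free   f (p , q)     none = trans (cong (λ u → f pos + u) p) (cancel (f pos) (f none))
    local free   f (p , q)     pos  = trans (cong (λ u → f pos + u) q) (ℤ.+-identityʳ (f pos))
    local free   f (p , q)     neg  = trans (cong (_+ f neg) q) (ℤ.+-identityˡ (f neg))
    local free   f (p , q)     both = trans (cong (_+ f both) q) (ℤ.+-identityˡ (f both))
    local fixed0 f (p , q , r) none = trans (cong₂ _+_ p q) (ℤ.+-identityˡ (f none))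
    local fixed0 f (p , q , r) pos  = trans (cong (λ u → f pos + u) r) (ℤ.+-identityʳ (f pos))
    local fixed0 f (p , q , r) neg  = trans (cong (_+ f neg) r) (ℤ.+-identityˡ (f neg))
    local fixed0 f (p , q , r) both = trans (cong (_+ f both) r) (ℤ.+-identityˡ (f both))
    local fixed1 f (p , q , r) none = trans (cong₂ _+_ p q) (ℤ.+-identityʳ (f none))
    local fixed1 f (p , q , r) pos  = trans (cong (λ u → f pos + u) r) (ℤ.+-identityʳ (f pos))
    local fixed1 f (p , q , r) neg  = trans (cong (_+ f neg) r) (ℤ.+-identityˡ (f neg))
    local fixed1 f (p , q , r) both = trans (cong (_+ f both) r) (ℤ.+-identityˡ (f both))

  exponents : ℕ → ℕ → State
  exponents zero    zero    = none
  exponents (suc _) zero    = pos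
  exponents zero    (suc _) = neg
  exponents (suc _) (suc _) = both

  exponents-+ : ∀ a b c d → exponents (a ℕ.+ c) (b ℕ.+ d) ≡ exponents a b ⊔ˢ exponents c d
  exponents-+ zero    zero    c       d       = refl
  exponents-+ zero    (suc b) zero    zero    = refl
  exponents-+ zero    (suc b) zero    (suc d) = refl
  exponents-+ zero    (suc b) (suc c) zero    = refl
  exponents-+ zero    (suc b) (suc c) (suc d) = refl
  exponents-+ (suc a) zero    zero    zero    = refl
  exponents-+ (suc a) zero    zero    (suc d) = refl
  exponents-+ (suc a) zero    (suc c) zero    = refl
  exponents-+ (suc a) zero    (suc c) (suc d) = refl
  exponents-+ (suc a) (suc b) c       d       = refl

  states : ∀ {n} → Monomial (n ℕ.+ n) → Vec State n
  states {n} m = tabulate λ i → exponents (lookup m (i ↑ˡ n)) (lookup m (n ↑ʳ i))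

  lookup-ext : ∀ {A : Set} {n} {u w : Vec A n} → (∀ i → lookup u i ≡ lookup w i) → u ≡ w
  lookup-ext {u = u} {w} e = trans (sym (Vec.tabulate∘lookup u)) (trans (Vec.tabulate-cong e) (Vec.tabulate∘lookup w))

  lookup-states : ∀ {n} (m : Monomial (n ℕ.+ n)) i →
    lookup (states {n} m) i ≡ exponents (lookup m (i ↑ˡ n)) (lookup m (n ↑ʳ i))
  lookup-states m i = Vec.lookup∘tabulate _ i

  states-+ : ∀ {n} (a b : Monomial (n ℕ.+ n)) → states {n} (zipWith ℕ._+_ a b) ≡ states {n} a ∨ states {n} b
  states-+ {n} a b = lookup-ext λ i → begin
    lookup (states {n} (zipWith ℕ._+_ a b)) i
      ≡⟨ lookup-states {n} (zipWith ℕ._+_ a b) i ⟩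
    exponents (lookup (zipWith ℕ._+_ a b) (i ↑ˡ n)) (lookup (zipWith ℕ._+_ a b) (n ↑ʳ i))
      ≡⟨ cong₂ exponents (Vec.lookup-zipWith ℕ._+_ (i ↑ˡ n) a b) (Vec.lookup-zipWith ℕ._+_ (n ↑ʳ i) a b) ⟩
    exponents (lookup a (i ↑ˡ n) ℕ.+ lookup b (i ↑ˡ n)) (lookup a (n ↑ʳ i) ℕ.+ lookup b (n ↑ʳ i))
      ≡⟨ exponents-+ (lookup a (i ↑ˡ n)) (lookup a (n ↑ʳ i)) (lookup b (i ↑ˡ n)) (lookup b (n ↑ʳ i)) ⟩
    exponents (lookup a (i ↑ˡ n)) (lookup a (n ↑ʳ i)) ⊔ˢ exponents (lookup b (i ↑ˡ n)) (lookup b (n ↑ʳ i))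
      ≡⟨ cong₂ _⊔ˢ_ (lookup-states {n} a i) (lookup-states {n} b i) ⟨
    lookup (states {n} a) i ⊔ˢ lookup (states {n} b) i
      ≡⟨ Vec.lookup-zipWith _⊔ˢ_ i (states {n} a) (states {n} b) ⟨
    lookup (states {n} a ∨ states {n} b) i
      ∎
    where open ≡-Reasoning

  ⊔ˢ-idem : ∀ s → s ⊔ˢ s ≡ s
  ⊔ˢ-idem none = refl
  ⊔ˢ-idem pos  = refl
  ⊔ˢ-idem neg  = refl
  ⊔ˢ-idem both = refl

  ∨-idem : ∀ {n} (z : Vec State n) → z ∨ z ≡ z
  ∨-idem []      = refl
  ∨-idem (s ∷ z) = cong₂ _∷_ (⊔ˢ-idem s) (∨-idem z)

  unit : ∀ {v} → Fin v → Monomial v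
  unit {v} j = replicate v 0 [ j ]≔ 1

  module _ {n : ℕ} where

    ↑ˡ≢↑ʳ : ∀ {i j : Fin n} → i ↑ˡ n ≢ n ↑ʳ j
    ↑ˡ≢↑ʳ {i} {j} e with () ← trans (sym (Fin.splitAt-↑ˡ n i n)) (trans (cong (splitAt n) e) (Fin.splitAt-↑ʳ n n j))

    lookup-unit-≡ : ∀ {v} (j : Fin v) → lookup (unit j) j ≡ 1
    lookup-unit-≡ {v} j = Vec.lookup∘update j (replicate v 0) 1

    lookup-unit-≢ : ∀ {v} {j j′ : Fin v} → j ≢ j′ → lookup (unit j) j′ ≡ 0
    lookup-unit-≢ {v} {j} {j′} j≢ = trans (Vec.lookup∘update′ (j≢ ∘ sym) (replicate v 0) 1) (Vec.lookup-replicate j′ 0)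

    states-unit : ∀ (u : State) (f : State → State) (i : Fin n) (j : Fin (n ℕ.+ n)) →
      (∀ s → s ⊔ˢ u ≡ f s) →
      exponents (lookup (unit j) (i ↑ˡ n)) (lookup (unit j) (n ↑ʳ i)) ≡ u →
      (∀ i′ → i ≢ i′ → exponents (lookup (unit j) (i′ ↑ˡ n)) (lookup (unit j) (n ↑ʳ i′)) ≡ none) →
      ∀ a → states {n} (zipWith ℕ._+_ a (unit j)) ≡ updateAt (states {n} a) i f
    states-unit u f i j join hit miss a = trans (states-+ {n} a (unit j)) (lookup-ext each)
      where
      ⊔ˢ-none : ∀ s → s ⊔ˢ none ≡ s
      ⊔ˢ-none s = ⊔ˢ-comm s none
      each : ∀ i′ → lookup (states {n} a ∨ states {n} (unit j)) i′ ≡ lookup (updateAt (states {n} a) i f) i′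
      each i′ = trans (Vec.lookup-zipWith _⊔ˢ_ i′ (states {n} a) (states {n} (unit j)))
        (trans (cong (lookup (states {n} a) i′ ⊔ˢ_) (lookup-states {n} (unit j) i′)) (go (i Fin.≟ i′)))
        where
        go : Dec (i ≡ i′) → lookup (states {n} a) i′ ⊔ˢ exponents (lookup (unit j) (i′ ↑ˡ n)) (lookup (unit j) (n ↑ʳ i′))
          ≡ lookup (updateAt (states {n} a) i f) i′
        go (yes refl) = trans (cong (lookup (states {n} a) i ⊔ˢ_) hit)
          (trans (join _) (sym (Vec.lookup∘updateAt i (states {n} a))))
        go (no i≢i′) = trans (cong (lookup (states {n} a) i′ ⊔ˢ_) (miss i′ i≢i′))
          (trans (⊔ˢ-none _) (sym (Vec.lookup∘updateAt′ i′ i (i≢i′ ∘ sym) (states {n} a))))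

    states-x : ∀ i a → states {n} (zipWith ℕ._+_ a (unit (i ↑ˡ n))) ≡ states {n} a ⊕ i
    states-x i = states-unit pos addPos i (i ↑ˡ n) (sym ∘ addPos≡⊔pos)
      (cong₂ exponents (lookup-unit-≡ (i ↑ˡ n)) (lookup-unit-≢ ↑ˡ≢↑ʳ))
      λ i′ i≢ → cong₂ exponents (lookup-unit-≢ (i≢ ∘ Fin.↑ˡ-injective n i i′)) (lookup-unit-≢ ↑ˡ≢↑ʳ)

    states-x̄ : ∀ i a → states {n} (zipWith ℕ._+_ a (unit (n ↑ʳ i))) ≡ updateAt (states {n} a) i addNeg
    states-x̄ i = states-unit neg addNeg i (n ↑ʳ i) join
      (cong₂ exponents (lookup-unit-≢ (↑ˡ≢↑ʳ ∘ sym)) (lookup-unit-≡ (n ↑ʳ i)))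
      λ i′ i≢ → cong₂ exponents (lookup-unit-≢ (↑ˡ≢↑ʳ ∘ sym)) (lookup-unit-≢ (i≢ ∘ Fin.↑ʳ-injective n i i′))
      where
      join : ∀ s → s ⊔ˢ neg ≡ addNeg s
      join none = refl
      join pos  = refl
      join neg  = refl
      join both = refl

  states-1 : ∀ n → states {n} (replicate (n ℕ.+ n) 0) ≡ replicate n none
  states-1 n = lookup-ext λ i → trans (lookup-states {n} (replicate (n ℕ.+ n) 0) i)
    (trans (cong₂ exponents (Vec.lookup-replicate (i ↑ˡ n) 0) (Vec.lookup-replicate (n ↑ʳ i) 0)) (sym (Vec.lookup-replicate i none)))

  E-1 : ∀ {n} (ρ : Vec Assign n) g → E ρ g (replicate n none) ≡ g 0
  E-1 []           g = refl
  E-1 (free   ∷ ρ) g = E-1 ρ g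
  E-1 (fixed0 ∷ ρ) g = E-1 ρ g
  E-1 (fixed1 ∷ ρ) g = E-1 ρ g

  -- Treats the three blocks of `B n` one at a time; a concatenated family reduces only once
  -- `splitAt` does.
  ++-elim : ∀ {a p} {A : Set a} (Q : A → Set p) {m n} (f : Vector.Vector A m) (g : Vector.Vector A n) →
    (∀ i → Q (f i)) → (∀ j → Q (g j)) → ∀ i → Q ((f Vector.++ g) i)
  ++-elim Q {m} f g hf hg i with splitAt m i
  ... | inj₁ i′ = hf i′
  ... | inj₂ j  = hg j

  module _ {n : ℕ} (Φ : Vec State n → ℤ) where

    private
      shifted : Monomial (n ℕ.+ n) → Monomial (n ℕ.+ n) → ℝ
      shifted a b = fromℤ (Φ (states {n} (zipWith ℕ._+_ a b)))

      -- The polynomial is a concrete list of two terms, so `Lin` computes to an explicit rational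
      -- expression. It is 0 because multiplying by e once or twice gives the same states.
      square : ∀ (a e : Monomial (n ℕ.+ n)) →
        Lin (shifted a) (((1ℝ , e) ∷ []) *ₚ ((1ℝ , e) ∷ []) -ₚ ((1ℝ , e) ∷ [])) ≃ 0ℝ
      square a e = pointwise λ _ → trans
        (cong (λ u → 1ℚ ℚ.* 1ℚ ℚ.* (Φ u / 1) ℚ.+ (ℚ.- 1ℚ ℚ.* (Φ (states {n} (zipWith ℕ._+_ a e)) / 1) ℚ.+ 0ℚ)) same)
        (cancel (Φ (states {n} (zipWith ℕ._+_ a e)) / 1))
        where
        same : states {n} (zipWith ℕ._+_ a (zipWith ℕ._+_ e e)) ≡ states {n} (zipWith ℕ._+_ a e)
        same = trans (states-+ {n} a (zipWith ℕ._+_ e e)) (trans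
          (cong (states {n} a ∨_) (trans (states-+ {n} e e) (∨-idem (states {n} e)))) (sym (states-+ {n} a e)))
        cancel : ∀ y → 1ℚ ℚ.* 1ℚ ℚ.* y ℚ.+ (ℚ.- 1ℚ ℚ.* y ℚ.+ 0ℚ) ≡ 0ℚ
        cancel = solve 1 (λ y → con 1ℚ :* con 1ℚ :* y :+ (:- con 1ℚ :* y :+ con 0ℚ) := con 0ℚ) refl
          where open ℚ.+-*-Solver

    Lin-B : ∀ {ρ} → Consistent ρ Φ → ∀ i a → Lin (shifted a) (B n i) ≃ 0ℝ
    Lin-B {ρ} c i a = ++-elim (λ p → Lin (shifted a) p ≃ 0ℝ)
      (λ i → x {n} i *ₚ x {n} i -ₚ x {n} i) _
      (λ i → square a (unit (i ↑ˡ n)))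
      (++-elim (λ p → Lin (shifted a) p ≃ 0ℝ)
        (λ i → x̄ {n} i *ₚ x̄ {n} i -ₚ x̄ {n} i) (λ i → x {n} i +ₚ x̄ {n} i -ₚ const 1ℝ)
        (λ i → square a (unit (n ↑ʳ i)))
        λ i → pointwise λ _ → trans
          (cong (λ u → 1ℚ ℚ.* (Φ (states {n} (zipWith ℕ._+_ a (unit (i ↑ˡ n)))) / 1)
            ℚ.+ (1ℚ ℚ.* (Φ (states {n} (zipWith ℕ._+_ a (unit (n ↑ʳ i)))) / 1) ℚ.+ (ℚ.- 1ℚ ℚ.* u ℚ.+ 0ℚ)))
            (trans (cong (_/ 1) (split i)) (/1-+ (Φ (states {n} (zipWith ℕ._+_ a (unit (i ↑ˡ n)))))
              (Φ (states {n} (zipWith ℕ._+_ a (unit (n ↑ʳ i))))))))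
          (cancel (Φ (states {n} (zipWith ℕ._+_ a (unit (i ↑ˡ n)))) / 1) (Φ (states {n} (zipWith ℕ._+_ a (unit (n ↑ʳ i)))) / 1)))
      i
      where
      split : ∀ i → Φ (states {n} (zipWith ℕ._+_ a (replicate (n ℕ.+ n) 0)))
        ≡ Φ (states {n} (zipWith ℕ._+_ a (unit (i ↑ˡ n)))) + Φ (states {n} (zipWith ℕ._+_ a (unit (n ↑ʳ i))))
      split i = trans (cong (Φ ∘ states {n}) (Vec.zipWith-identityʳ ℕ.+-identityʳ a))
        (trans (sym (consistent-split ρ c (states {n} a) i))
          (cong₂ (λ u w → Φ u + Φ w) (sym (states-x i a)) (sym (states-x̄ i a))))
      cancel : ∀ y z → 1ℚ ℚ.* y ℚ.+ (1ℚ ℚ.* z ℚ.+ (ℚ.- 1ℚ ℚ.* (y ℚ.+ z) ℚ.+ 0ℚ)) ≡ 0ℚ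
      cancel = solve 2 (λ y z → con 1ℚ :* y :+ (con 1ℚ :* z :+ (:- con 1ℚ :* (y :+ z) :+ con 0ℚ)) := con 0ℚ) refl
        where open ℚ.+-*-Solver

    Lin-knapsack : ∀ k a → + 2 * ∑ℤ.∑ᶠ (λ i → Φ (states {n} a ⊕ i)) ≡ + k * Φ (states {n} a) →
      Lin (shifted a) (knapsack n k) ≃ 0ℝ
    Lin-knapsack k a h = begin
      Lin (shifted a) (∑ summand -ₚ const (fromℕ k))
        ≈⟨ Lin--ₚ (shifted a) (∑ summand) (const (fromℕ k)) ⟩
      Lin (shifted a) (∑ summand) +ℝ -ℝ Lin (shifted a) (const (fromℕ k))
        ≈⟨ +ℝ-cong lhs (-ℝ-cong rhs) ⟩
      fromℤ (∑ℤ.∑ᶠ (λ i → + 2 * Φ (states {n} a ⊕ i))) +ℝ -ℝ fromℤ (+ k * Φ (states {n} a))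
        ≈⟨ pointwise (λ _ → trans (cong (λ u → u / 1 ℚ.- (+ k * Φ (states {n} a)) / 1) h′) (ℚ.+-inverseʳ ((+ k * Φ (states {n} a)) / 1))) ⟩
      0ℝ ∎
      where
      open ℝ-Ring
      summand : Vector.Vector (Poly (n ℕ.+ n)) n
      summand i = const (fromℕ 2) *ₚ x {n} i
      h′ : ∑ℤ.∑ᶠ (λ i → + 2 * Φ (states {n} a ⊕ i)) ≡ + k * Φ (states {n} a)
      h′ = trans (∑ℤ.∑ᶠ-*ˡ (+ 2) (λ i → Φ (states {n} a ⊕ i))) h
      Lin-∑ᶠ : ∀ {m} (p : Vector.Vector (Poly (n ℕ.+ n)) m) (f : Fin m → ℤ) →
        (∀ i → Lin (shifted a) (p i) ≃ fromℤ (f i)) → Lin (shifted a) (∑ p) ≃ fromℤ (∑ℤ.∑ᶠ f)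
      Lin-∑ᶠ {zero}  p f e = ≃-refl
      Lin-∑ᶠ {suc m} p f e = ≃-trans (Lin-+ₚ (shifted a) (p zero) (∑ (p ∘ suc)))
        (≃-trans (+ℝ-cong (e zero) (Lin-∑ᶠ (p ∘ suc) (f ∘ suc) (e ∘ suc)))
          (≃-sym (fromℤ-+ (f zero) (∑ℤ.∑ᶠ (f ∘ suc)))))
      lhs : Lin (shifted a) (∑ summand) ≃ fromℤ (∑ℤ.∑ᶠ (λ i → + 2 * Φ (states {n} a ⊕ i)))
      lhs = Lin-∑ᶠ summand (λ i → + 2 * Φ (states {n} a ⊕ i)) λ i → pointwise λ _ → trans
        (cong (λ u → (+ 2 / 1) ℚ.* 1ℚ ℚ.* (Φ u / 1) ℚ.+ 0ℚ) (trans
          (cong (λ e → states {n} (zipWith ℕ._+_ a e)) (Vec.zipWith-identityˡ ℕ.+-identityˡ (unit (i ↑ˡ n)))) (states-x i a)))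
        (trans (simplify (+ 2 / 1) (Φ (states {n} a ⊕ i) / 1)) (sym (/1-* (+ 2) (Φ (states {n} a ⊕ i)))))
        where
        simplify : ∀ c y → c ℚ.* 1ℚ ℚ.* y ℚ.+ 0ℚ ≡ c ℚ.* y
        simplify = solve 2 (λ c y → c :* con 1ℚ :* y :+ con 0ℚ := c :* y) refl
          where open ℚ.+-*-Solver
      rhs : Lin (shifted a) (const (fromℕ k)) ≃ fromℤ (+ k * Φ (states {n} a))
      rhs = pointwise λ _ → trans
        (cong (λ e → (+ k / 1) ℚ.* (Φ (states {n} e) / 1) ℚ.+ 0ℚ) (Vec.zipWith-identityʳ ℕ.+-identityʳ a))
        (trans (ℚ.+-identityʳ ((+ k / 1) ℚ.* (Φ (states {n} a) / 1))) (sym (/1-* (+ k) (Φ (states {n} a)))))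

  -- The monomials for which the Gram form and the knapsack relation hold: those of low degree by
  -- the algebra above, the dead ones because everything is 0.
  Narrow : ∀ {n} → Vec Assign n → ℕ → Vec State n → Set
  Narrow ρ d z = dead ρ z ≡ true ⊎ deg ρ z ≤ d

  module Degree {n} (ρ : Vec Assign n) (k d : ℕ)
    (2d≤N : d ℕ.+ d ≤ #free ρ) (d<N : d ℕ.< #free ρ)
    (4d≤k : 2 ℕ.* (d ℕ.+ d) ℕ.+ 2 ℕ.* #ones ρ ≤ k ℕ.+ 2)
    (k≤2N : k ℕ.+ 2 ℕ.* d ≤ 2 ℕ.* #free ρ ℕ.+ 2) where

    κ : ℤ
    κ = + k - + 2 * + #ones ρ

    private
      ≤-minus : ∀ a b c → a ℕ.+ b ≤ c → + a ℤ.≤ + c - + b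
      ≤-minus a b c h = subst (ℤ._≤ + c - + b) (cancel (+ a) (+ b)) (ℤ.+-monoˡ-≤ (ℤ.- + b) (ℤ.+≤+ h))
        where
        cancel : ∀ a b → a + b - b ≡ a
        cancel = solve-∀

    -- The largest index is 2d - 1, so κ ≥ 4d - 2 is enough; this is the origin of the `+ 2` in
    -- `4d≤k`.
    κ≥ : ∀ i → i ℕ.< d ℕ.+ d → + 2 * + i ℤ.≤ κ
    κ≥ i i<2d = subst (λ u → + 2 * + i ℤ.≤ + k - u) (ℤ.pos-* 2 (#ones ρ))
      (subst (ℤ._≤ + k - + (2 ℕ.* #ones ρ)) (ℤ.pos-* 2 i) (≤-minus (2 ℕ.* i) (2 ℕ.* #ones ρ) k
        (ℕ.+-cancelʳ-≤ 2 _ _ (ℕ.≤-trans (ℕ.≤-reflexive (rearrange i (#ones ρ)))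
          (ℕ.≤-trans (ℕ.+-monoˡ-≤ (2 ℕ.* #ones ρ) (ℕ.*-monoʳ-≤ 2 i<2d)) 4d≤k)))))
      where
      open import Data.Nat.Tactic.RingSolver renaming (solve-∀ to solve-∀ⁿ)
      rearrange : ∀ i o → 2 ℕ.* i ℕ.+ 2 ℕ.* o ℕ.+ 2 ≡ 2 ℕ.* suc i ℕ.+ 2 ℕ.* o
      rearrange = solve-∀ⁿ

    -- p < d forces d ≥ 1, so p + 1 is still below 2d, and `κ≥` at p + 1 gives κ > 2p.
    κ≢ : ∀ p → p ℕ.< d → κ - + 2 * + p ≢ + 0
    κ≢ p p<d e = ℤ.<-irrefl refl (ℤ.<-≤-trans
      (subst (ℤ._< + 2 * + suc p) (sym (ℤ.i-j≡0⇒i≡j κ (+ 2 * + p) e)) (ℤ.*-monoˡ-<-pos (+ 2) (ℤ.+<+ (ℕ.n<1+n p))))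
      (κ≥ (suc p) (ℕ.+-mono-≤ (ℕ.≤-trans (ℕ.s≤s ℕ.z≤n) p<d) p<d)))

    κ≤ : ∀ i → i ℕ.< d → + 2 * + i ℤ.≤ + 2 * + #free ρ - κ
    κ≤ i i<d = ℤ.≤-trans
      (subst (λ u → + 2 * + i ℤ.≤ u - + k) (ℤ.pos-* 2 (#free ρ))
        (subst (ℤ._≤ + (2 ℕ.* #free ρ) - + k) (ℤ.pos-* 2 i) (≤-minus (2 ℕ.* i) k (2 ℕ.* #free ρ)
          (ℕ.+-cancelʳ-≤ 2 _ _ (ℕ.≤-trans (ℕ.≤-reflexive (rearrange i k)) (ℕ.≤-trans (ℕ.+-monoʳ-≤ k (ℕ.*-monoʳ-≤ 2 i<d)) k≤2N))))))
      (subst (+ 2 * + #free ρ - + k ℤ.≤_) (regroup (+ #free ρ) (+ k) (+ #ones ρ))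
        (ℤ.≤-trans (ℤ.≤-reflexive (sym (ℤ.+-identityʳ _)))
          (ℤ.+-monoʳ-≤ (+ 2 * + #free ρ - + k) (nonneg-* {+ 2} {+ #ones ρ} (ℤ.+≤+ ℕ.z≤n) (ℤ.+≤+ ℕ.z≤n)))))
      where
      open import Data.Nat.Tactic.RingSolver renaming (solve-∀ to solve-∀ⁿ)
      rearrange : ∀ i k → 2 ℕ.* i ℕ.+ k ℕ.+ 2 ≡ k ℕ.+ 2 ℕ.* suc i
      rearrange = solve-∀ⁿ
      regroup : ∀ f k o → + 2 * f - k + + 2 * o ≡ + 2 * f - (k - + 2 * o)
      regroup = solve-∀

    open Positivity ρ κ d 2d≤N κ≢ κ≥ κ≤

    -- A positive multiple of `L`, because `P κ d` is nonzero; the scaling is the one that `gram`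
    -- requires.
    Φ : Vec State n → ℤ
    Φ z = P κ d * (P κ d * L z)

    consistent-Φ : Consistent ρ Φ
    consistent-Φ = consistent-* ρ (P κ d) (consistent-* ρ (P κ d) (consistent-E ρ (moment κ N)))

    dead-Φ : ∀ z → dead ρ z ≡ true → Φ z ≡ + 0
    dead-Φ z e = trans (cong (λ u → P κ d * (P κ d * u)) (E-dead ρ (moment κ N) z e))
      (trans (cong (P κ d *_) (ℤ.*-zeroʳ (P κ d))) (ℤ.*-zeroʳ (P κ d)))

    dead-w : ∀ K z → dead ρ z ≡ true → w K z ≡ + 0
    dead-w K z e = ∑ℤ.∑-zero (subsets ρ d) λ I →
      trans (cong ([ K ⊆ I ] *_) (E-dead (mask ρ I) (moment κ d) z (dead-mask ρ I z e))) (ℤ.*-zeroʳ [ K ⊆ I ])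

    gram-Narrow : ∀ z y → Narrow ρ d z → Narrow ρ d y →
      Φ (z ∨ y) ≡ ∑ℤ.∑[ allSubsets n ] (λ K → weight (card K) * (w K z * w K y))
    gram-Narrow z y (inj₂ z≤d) (inj₂ y≤d) = gram z y z≤d y≤d
    gram-Narrow z y (inj₁ e)   _          = trans (dead-Φ (z ∨ y) (dead-∨ ρ z y e))
      (sym (∑ℤ.∑-zero (allSubsets n) λ K → trans (cong (λ u → weight (card K) * (u * w K y)) (dead-w K z e)) (ℤ.*-zeroʳ (weight (card K)))))
    gram-Narrow z y (inj₂ _)   (inj₁ e)   = trans
      (trans (cong Φ (∨-comm z y)) (dead-Φ (y ∨ z) (dead-∨ ρ y z e)))
      (sym (∑ℤ.∑-zero (allSubsets n) λ K → trans (cong (λ u → weight (card K) * (w K z * u)) (dead-w K y e))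
        (trans (cong (weight (card K) *_) (ℤ.*-zeroʳ (w K z))) (ℤ.*-zeroʳ (weight (card K))))))

    knapsack-Narrow : ∀ z → Narrow ρ d z → + 2 * ∑ℤ.∑ᶠ (λ i → Φ (z ⊕ i)) ≡ + k * Φ z
    knapsack-Narrow z (inj₁ e) = trans
      (cong (+ 2 *_) (trans (∑ℤ.∑ᶠ-cong λ i → dead-Φ (z ⊕ i) (dead-⊕ ρ z i e)) (∑ℤ.∑ᶠ-zero n)))
      (sym (trans (cong (+ k *_) (dead-Φ z e)) (ℤ.*-zeroʳ (+ k))))
    knapsack-Narrow z (inj₂ z≤d) = trans
      (cong (+ 2 *_) (trans (∑ℤ.∑ᶠ-*ˡ (P κ d) (λ i → P κ d * L (z ⊕ i))) (cong (P κ d *_) (∑ℤ.∑ᶠ-*ˡ (P κ d) (λ i → L (z ⊕ i))))))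
      (trans (pull (P κ d) (∑ℤ.∑ᶠ (λ i → L (z ⊕ i))))
      (trans (cong (λ u → P κ d * (P κ d * u)) (L-knapsack z (ℕ.≤-<-trans z≤d d<N)))
      (push (+ k) (+ #ones ρ) (P κ d) (L z))))
      where
      pull : ∀ p s → + 2 * (p * (p * s)) ≡ p * (p * (+ 2 * s))
      pull = solve-∀
      push : ∀ k o p l → p * (p * ((k - + 2 * o + + 2 * o) * l)) ≡ k * (p * (p * l))
      push = solve-∀

    Φ-1 : + 0 ℤ.< Φ (replicate n none)
    Φ-1 = subst (+ 0 ℤ.<_) (trans (ℤ.*-assoc (P κ d) (P κ d) (W N)) (cong (λ u → P κ d * (P κ d * u))
        (trans (sym (ℤ.*-identityˡ (W N))) (sym (E-1 ρ (moment κ N))))))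
      (positive-* {P κ d * P κ d} (square-pos (P κ d) (P-nonzero κ d κ≢)) (W-pos N))
      where
      square-pos : ∀ a → a ≢ + 0 → + 0 ℤ.< a * a
      square-pos (+ zero)     a≢0 = ⊥-elim (a≢0 refl)
      square-pos (+ suc a)    a≢0 = ℤ.+<+ (ℕ.s≤s ℕ.z≤n)
      square-pos (ℤ.-[1+ a ]) a≢0 = ℤ.+<+ (ℕ.s≤s ℕ.z≤n)

    no-narrow-refutation : ∀ (π : KSRefutation n k) → let open SOSRefutation π in
      All (λ r → ∀ m → coeff r m ≃ 0ℝ ⊎ Narrow ρ d (states {n} m)) r₀ →
      (∀ m → coeff (t zero) m ≃ 0ℝ ⊎ Narrow ρ d (states {n} m)) → ⊥
    no-narrow-refutation π r-narrow t-narrow = no-refutation {n} {k}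
      (λ m → fromℤ (Φ (states {n} m))) (allSubsets n) (λ K → fromℤ (weight (card K))) (λ K m → fromℤ (w K (states {n} m)))
      (λ m → Narrow ρ d (states {n} m)) π
      (λ K → fromℤ-nonneg {weight (card K)} (weight-nonneg (card K)))
      gramℝ
      (Lin-B Φ consistent-Φ)
      (λ a a-narrow → Lin-knapsack Φ k a (knapsack-Narrow (states {n} a) a-narrow))
      r-narrow t-narrow
      (Φ (replicate n none) / 1) (0</1 (Φ (replicate n none)) Φ-1)
      (pointwise λ _ → cong (λ z → Φ z / 1) (states-1 n))
      where
      0</1 : ∀ z → + 0 ℤ.< z → 0ℚ ℚ.< z / 1
      0</1 (+ suc z) _ = ℚ.positive⁻¹ _ {{ℚ.normalize-pos (suc z) 1}}
      0</1 (+ zero) (ℤ.+<+ ())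
      gramℝ : ∀ a b → Narrow ρ d (states {n} a) → Narrow ρ d (states {n} b) →
        fromℤ (Φ (states {n} (zipWith ℕ._+_ a b))) ≃
        ∑ℝ.∑[ allSubsets n ] (λ K → fromℤ (weight (card K)) *ℝ (fromℤ (w K (states {n} a)) *ℝ fromℤ (w K (states {n} b))))
      gramℝ a b ha hb = ≃-trans
        (pointwise λ _ → cong (_/ 1) (trans (cong Φ (states-+ {n} a b)) (gram-Narrow (states {n} a) (states {n} b) ha hb)))
        (≃-trans (fromℤ-∑ (allSubsets n) (λ K → weight (card K) * (w K (states {n} a) * w K (states {n} b))))
          (∑ℝ.∑-cong (allSubsets n) λ K → ≃-trans (fromℤ-* (weight (card K)) (w K (states {n} a) * w K (states {n} b)))
            (*ℝ-cong ≃-refl (fromℤ-* (w K (states {n} a)) (w K (states {n} b))))))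

open DegreeBound

-- From monomial size to degree.

open import Data.Integer.Base using (-[1+_])
open import Data.Nat.Base using (_<_; _+_; _*_; _∸_; _^_; z≤n; s≤s)
open import Data.Nat.Properties
open import Data.Nat.Tactic.RingSolver using (solve-∀)

module _ {v : ℕ} where

  private
    _≟ᵐ_ : DecidableEquality (Monomial v)
    _≟ᵐ_ = ≡-dec _≟_

  open DecMembership _≟ᵐ_ using (_∈?_)

  -- Concatenated without merging: a monomial shared by several squared polynomials counts each
  -- time, as it does in the size.
  supports : ∀ {rs : List (Poly v)} {ss} → Pointwise HasSize rs ss → List (Monomial v)
  supports []       = []
  supports (h ∷ hs) = HasSize.support h ++ supports hs

  length-supports : ∀ {rs : List (Poly v)} {ss} (hs : Pointwise HasSize rs ss) → length (supports hs) ≡ sum ss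
  length-supports []       = refl
  length-supports (h ∷ hs) = trans (List.length-++ (HasSize.support h))
    (cong₂ _+_ (sym (HasSize.size≡length h)) (length-supports hs))

  -- Membership in the listed support is decidable although vanishing of the coefficient is not.
  -- Outside the support only the double negation of vanishing is known, and `≃0-stable` removes it.
  support-covers : ∀ {G : Monomial v → Set} {p : Poly v} {s} (h : HasSize p s) → All G (HasSize.support h) →
    ∀ m → coeff p m ≃ 0ℝ ⊎ G m
  support-covers h g m with m ∈? HasSize.support h
  ... | yes m∈ = inj₂ (All.lookup g m∈)
  ... | no  m∉ = inj₁ (≃0-stable (m∉ ∘ Equivalence.from (HasSize.nonzero h m)))

  supports-cover : ∀ {G : Monomial v → Set} {rs : List (Poly v)} {ss} (hs : Pointwise HasSize rs ss) → All G (supports hs) →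
    All (λ r → ∀ m → coeff r m ≃ 0ℝ ⊎ G m) rs
  supports-cover []       g = []
  supports-cover (h ∷ hs) g with ++⁻ (HasSize.support h) g
  ... | gh , ghs = support-covers h gh ∷ supports-cover hs ghs

-- `greedy` leaves at least n - t free variables and at most t ones. The single inequality 4d + 2t ≤
-- k + 2, with k ≤ n and 4 ≤ n, then supplies all four numerical hypotheses of `Degree`.
size-bound : ∀ n-1 k d t → let n = suc n-1 in 4 ≤ n → k ≤ n → 2 * (d + d) + 2 * t ≤ k + 2 →
  ∀ (π : KSRefutation n k) s → HasMonomialSize π s → s * (2 * n ∸ suc d) ^ t < (2 * n) ^ t → ⊥
size-bound n-1 k d t 4≤n k≤n dt≤k π s size small = conclude (greedy d U t (subst (λ l → l * (2 * n ∸ suc d) ^ t < (2 * n) ^ t) s≡ small))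
  where
  open HasMonomialSize size
  open ≤-Reasoning
  n = suc n-1
  monomials : List (Monomial (n + n))
  monomials = supports r₀-size ++ HasSize.support (t-size zero)
  U : List (Vec State n)
  U = map (states {n}) monomials
  s≡ : s ≡ length U
  s≡ = trans total (sym (trans (List.length-map (states {n}) monomials) (trans (List.length-++ (supports r₀-size))
    (cong₂ _+_ (trans (length-supports r₀-size) (sym (+-identityʳ _)))
      (trans (sym (HasSize.size≡length (t-size zero))) (sym (+-identityʳ _)))))))
  -- Absorbs the additive constants below.
  n+4≤2n : n + 4 ≤ 2 * n
  n+4≤2n = ≤-trans (+-monoʳ-≤ n 4≤n) (≤-reflexive (cong (λ u → n + u) (sym (+-identityʳ n))))
  conclude : Σ[ ρ ∈ Vec Assign n ] All (Narrow ρ d) U × n ≤ #free ρ + t × #ones ρ ≤ t → ⊥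
  conclude (ρ , narrow , n≤f+t , o≤t) = Degree.no-narrow-refutation ρ k d
    (+-cancelʳ-≤ t _ _ (≤-trans (*-cancelˡ-≤ 2 2d+t≤n) n≤f+t))
    (+-cancelʳ-≤ t _ _ (≤-trans (*-cancelˡ-≤ 2 d+t<n) n≤f+t))
    (≤-trans (+-monoʳ-≤ (2 * (d + d)) (*-monoʳ-≤ 2 o≤t)) dt≤k)
    (+-cancelʳ-≤ (2 * t) _ _ k≤2f)
    π
    (supports-cover r₀-size (proj₁ split))
    (support-covers (t-size zero) (proj₂ split))
    where
    split : All (Narrow ρ d ∘ states {n}) (supports r₀-size) × All (Narrow ρ d ∘ states {n}) (HasSize.support (t-size zero))
    split = ++⁻ (supports r₀-size) (map⁻ narrow)
    2d+t≤n : 2 * (d + d + t) ≤ 2 * n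
    2d+t≤n = begin
      2 * (d + d + t)          ≡⟨ *-distribˡ-+ 2 (d + d) t ⟩
      2 * (d + d) + 2 * t      ≤⟨ dt≤k ⟩
      k + 2                    ≤⟨ +-mono-≤ k≤n (s≤s (s≤s z≤n)) ⟩
      n + 4                    ≤⟨ n+4≤2n ⟩
      2 * n                    ∎
    d+t<n : 2 * (suc d + t) ≤ 2 * n
    d+t<n = begin
      2 * (suc d + t)          ≡⟨ expand d t ⟩
      2 + (2 * d + 2 * t)      ≤⟨ +-monoʳ-≤ 2 (+-monoˡ-≤ (2 * t) (*-monoʳ-≤ 2 (m≤m+n d d))) ⟩
      2 + (2 * (d + d) + 2 * t) ≤⟨ +-monoʳ-≤ 2 dt≤k ⟩
      2 + (k + 2)              ≡⟨ regroup k ⟩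
      k + 4                    ≤⟨ +-monoˡ-≤ 4 k≤n ⟩
      n + 4                    ≤⟨ n+4≤2n ⟩
      2 * n                    ∎
      where
      expand : ∀ d t → 2 * (suc d + t) ≡ 2 + (2 * d + 2 * t)
      expand = solve-∀
      regroup : ∀ k → 2 + (k + 2) ≡ k + 4
      regroup = solve-∀
    k≤2f : k + 2 * d + 2 * t ≤ 2 * #free ρ + 2 + 2 * t
    k≤2f = begin
      k + 2 * d + 2 * t              ≡⟨ +-assoc k (2 * d) (2 * t) ⟩
      k + (2 * d + 2 * t)            ≤⟨ +-monoʳ-≤ k (+-monoˡ-≤ (2 * t) (*-monoʳ-≤ 2 (m≤m+n d d))) ⟩
      k + (2 * (d + d) + 2 * t)      ≤⟨ +-mono-≤ k≤n (≤-trans dt≤k (+-monoˡ-≤ 2 k≤n)) ⟩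
      n + (n + 2)                    ≡⟨ double n ⟩
      2 * n + 2                      ≤⟨ +-monoˡ-≤ 2 (*-monoʳ-≤ 2 n≤f+t) ⟩
      2 * (#free ρ + t) + 2          ≡⟨ expand (#free ρ) t ⟩
      2 * #free ρ + 2 + 2 * t        ∎
      where
      double : ∀ n → n + (n + 2) ≡ 2 * n + 2
      double = solve-∀
      expand : ∀ f t → 2 * (f + t) + 2 ≡ 2 * f + 2 + 2 * t
      expand = solve-∀

-- Numerical estimates and the constant in the exponent.

-- Bernoulli's inequality for (1 + D/M)^(q+1), multiplied by M^(q+1).
bernoulli : ∀ M D q → M ^ q * (M + suc q * D) ≤ (M + D) ^ suc q
bernoulli M D zero    = ≤-reflexive (base M D)
  where
  base : ∀ M D → 1 * (M + 1 * D) ≡ (M + D) * 1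
  base = solve-∀
bernoulli M D (suc q) = begin
  M * M ^ q * (M + suc (suc q) * D)                       ≤⟨ m≤m+n _ (M ^ q * (suc q * D * D)) ⟩
  M * M ^ q * (M + suc (suc q) * D) + M ^ q * (suc q * D * D)   ≡⟨ regroup M D q (M ^ q) ⟩
  (M + D) * (M ^ q * (M + suc q * D))                     ≤⟨ *-monoʳ-≤ (M + D) (bernoulli M D q) ⟩
  (M + D) * (M + D) ^ suc q                               ∎
  where
  open ≤-Reasoning
  regroup : ∀ M D q x → M * x * (M + suc (suc q) * D) + x * (suc q * D * D) ≡ (M + D) * (x * (M + suc q * D))
  regroup = solve-∀

-- One greedy step keeps at most a fraction M/(M + D) of the wide monomials, with M + D = 2n; so
-- `suc q` steps at least halve their number.
doubling : ∀ M D q → M ≤ suc q * D → 2 * M ^ suc q ≤ (M + D) ^ suc q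
doubling M D q M≤ = begin
  2 * (M * M ^ q)               ≡⟨ regroup M (M ^ q) ⟩
  M ^ q * (M + M)               ≤⟨ *-monoʳ-≤ (M ^ q) (+-monoʳ-≤ M M≤) ⟩
  M ^ q * (M + suc q * D)       ≤⟨ bernoulli M D q ⟩
  (M + D) ^ suc q               ∎
  where
  open ≤-Reasoning
  regroup : ∀ M x → 2 * (M * x) ≡ x * (M + M)
  regroup = solve-∀

^-distribʳ-* : ∀ k m n → (m * n) ^ k ≡ m ^ k * n ^ k
^-distribʳ-* zero    m n = refl
^-distribʳ-* (suc k) m n = trans (cong (m * n *_) (^-distribʳ-* k m n)) (interchange m n (m ^ k) (n ^ k))
  where
  interchange : ∀ a b c d → a * b * (c * d) ≡ a * c * (b * d)
  interchange = solve-∀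

-- Raising to the power b avoids roots. Of the resulting t·b factors M/N, a·q form a blocks that
-- contribute at most 1/2 each; the r left over are bounded by M ≤ N.
power-comparison : ∀ s M N q t a b .{{_ : NonZero M}} → M ≤ N → 2 * M ^ q ≤ N ^ q → a * q ≤ t * b →
  s ^ b < 2 ^ a → s * M ^ t < N ^ t
power-comparison s M N q t a b M≤N double aq≤tb s<2 = ≰⇒> λ N≤ → <⇒≱ powers< (^-monoˡ-≤ b N≤)
  where
  open ≤-Reasoning
  r = t * b ∸ a * q
  tb≡ : t * b ≡ q * a + r
  tb≡ = trans (sym (m+[n∸m]≡n aq≤tb)) (cong (_+ r) (*-comm a q))
  powers< : (s * M ^ t) ^ b < (N ^ t) ^ b
  powers< = begin-strict
    (s * M ^ t) ^ b             ≡⟨ ^-distribʳ-* b s (M ^ t) ⟩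
    s ^ b * (M ^ t) ^ b         <⟨ *-monoˡ-< ((M ^ t) ^ b) {{m^n≢0 (M ^ t) b {{m^n≢0 M t}}}} s<2 ⟩
    2 ^ a * (M ^ t) ^ b         ≡⟨ cong (2 ^ a *_) (trans (^-*-assoc M t b) (trans (cong (M ^_) tb≡) (^-distribˡ-+-* M (q * a) r))) ⟩
    2 ^ a * (M ^ (q * a) * M ^ r)     ≡⟨ cong (λ x → 2 ^ a * (x * M ^ r)) (sym (^-*-assoc M q a)) ⟩
    2 ^ a * ((M ^ q) ^ a * M ^ r)     ≡⟨ *-assoc (2 ^ a) ((M ^ q) ^ a) (M ^ r) ⟨
    2 ^ a * (M ^ q) ^ a * M ^ r       ≡⟨ cong (_* M ^ r) (sym (^-distribʳ-* a 2 (M ^ q))) ⟩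
    (2 * M ^ q) ^ a * M ^ r           ≤⟨ *-mono-≤ (^-monoˡ-≤ a double) (^-monoˡ-≤ r M≤N) ⟩
    (N ^ q) ^ a * N ^ r               ≡⟨ cong (_* N ^ r) (^-*-assoc N q a) ⟩
    N ^ (q * a) * N ^ r               ≡⟨ trans (^-distribˡ-+-* N (q * a) r) refl ⟨
    N ^ (q * a + r)                   ≡⟨ trans (^-*-assoc N t b) (cong (N ^_) tb≡) ⟨
    (N ^ t) ^ b                       ∎

m<[1+m/n]*n : ∀ m n .{{_ : NonZero n}} → m < suc (m ℕ./ n) * n
m<[1+m/n]*n m n = ≤-<-trans (≤-reflexive (m≡m%n+[m/n]*n m n)) (+-monoˡ-< (m ℕ./ n * n) (m%n<n m n))

module Parameters (n-1 k : ℕ) (k≤n : k ≤ suc n-1) (4≤n : 4 ≤ suc n-1) where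

  -- Chosen so that 4d + 2t ≤ k + 2, which positivity needs after t restrictions, while
  -- k² ≤ 32Dt and M ≤ qD ≤ 3n.
  n d D t q M : ℕ
  n = suc n-1
  d = k ℕ./ 8
  D = suc d
  t = suc (k ℕ./ 4)
  q = suc (2 * n ℕ./ D)
  M = 2 * n ∸ D

  open ≤-Reasoning

  dt≤k : 2 * (d + d) + 2 * t ≤ k + 2
  dt≤k = *-cancelˡ-≤ 2 (begin
    2 * (2 * (d + d) + 2 * suc (k ℕ./ 4))       ≡⟨ regroup d (k ℕ./ 4) ⟩
    d * 8 + k ℕ./ 4 * 4 + 4                     ≤⟨ +-monoˡ-≤ 4 (+-mono-≤ (m/n*n≤m k 8) (m/n*n≤m k 4)) ⟩
    k + k + 4                                   ≡⟨ double k ⟩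
    2 * (k + 2)                                 ∎)
    where
    regroup : ∀ d e → 2 * (2 * (d + d) + 2 * suc e) ≡ d * 8 + e * 4 + 4
    regroup = solve-∀
    double : ∀ k → k + k + 4 ≡ 2 * (k + 2)
    double = solve-∀

  D≤n : D ≤ n
  D≤n = *-cancelˡ-≤ 8 (begin
    8 * suc d           ≡⟨ trans (*-comm 8 (suc d)) (+-comm 8 (d * 8)) ⟩
    d * 8 + 8           ≤⟨ +-monoˡ-≤ 8 (≤-trans (m/n*n≤m k 8) k≤n) ⟩
    n + 8               ≤⟨ +-monoʳ-≤ n (≤-trans (m≤m+n 8 20) (*-monoʳ-≤ 7 4≤n)) ⟩
    n + 7 * n           ≡⟨ refl ⟩
    8 * n               ∎)

  D<2n : D < 2 * n
  D<2n = ≤-trans (s≤s D≤n) (≤-trans (+-monoˡ-≤ n (≤-trans (s≤s z≤n) 4≤n)) (≤-reflexive (cong (λ u → n + u) (sym (+-identityʳ n)))))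

  M+D : M + D ≡ 2 * n
  M+D = m∸n+n≡m (<⇒≤ D<2n)

  kk≤32Dt : k * k ≤ 32 * (D * t)
  kk≤32Dt = begin
    k * k                           ≤⟨ *-mono-≤ (<⇒≤ (m<[1+m/n]*n k 8)) (<⇒≤ (m<[1+m/n]*n k 4)) ⟩
    D * 8 * (t * 4)                 ≡⟨ regroup D t ⟩
    32 * (D * t)                    ∎
    where
    regroup : ∀ D t → D * 8 * (t * 4) ≡ 32 * (D * t)
    regroup = solve-∀

  qD≤3n : q * D ≤ 3 * n
  qD≤3n = begin
    D + 2 * n ℕ./ D * D             ≤⟨ +-mono-≤ D≤n (m/n*n≤m (2 * n) D) ⟩
    n + 2 * n                       ≡⟨ refl ⟩
    3 * n                           ∎

  M≤qD : M ≤ q * D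
  M≤qD = ≤-trans (m∸n≤m (2 * n) D) (<⇒≤ (m<[1+m/n]*n (2 * n) D))

  -- The constant is 96 = 32 · 3: 32 is the loss in k² ≤ 32Dt from the divisions by 8 and 4, and 3
  -- comes from rounding 2n/D up, which costs one more D ≤ n.
  exponent : ∀ a b → a * (96 * n) ≤ k * k * b → a * q ≤ t * b
  exponent a b h = *-cancelʳ-≤ _ _ D (*-cancelˡ-≤ 32 (begin
    32 * (a * q * D)                ≡⟨ cong (32 *_) (*-assoc a q D) ⟩
    32 * (a * (q * D))              ≤⟨ *-monoʳ-≤ 32 (*-monoʳ-≤ a qD≤3n) ⟩
    32 * (a * (3 * n))              ≡⟨ regroup a n ⟩
    a * (96 * n)                    ≤⟨ h ⟩
    k * k * b                       ≤⟨ *-monoˡ-≤ b kk≤32Dt ⟩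
    32 * (D * t) * b                ≡⟨ regroup′ D t b ⟩
    32 * (t * b * D)                ∎))
    where
    regroup : ∀ a n → 32 * (a * (3 * n)) ≡ a * (96 * n)
    regroup = solve-∀
    regroup′ : ∀ D t b → 32 * (D * t) * b ≡ 32 * (t * b * D)
    regroup′ = solve-∀

  small : ∀ s a b → a * (96 * n) ≤ k * k * b → s ^ b < 2 ^ a → s * M ^ t < (2 * n) ^ t
  small s a b h = power-comparison s M (2 * n) q t a b {{ℕ.>-nonZero (m<n⇒0<n∸m D<2n)}} (m∸n≤m (2 * n) D)
    (subst (λ N → 2 * M ^ q ≤ N ^ q) M+D (doubling M D (2 * n ℕ./ D) M≤qD)) (exponent a b h)

-- Passing to unnormalised rationals makes the order a comparison of integer cross products, without
-- reducing the fraction k²/n.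
cross-multiply : ∀ t {a} k n-1 → ℚ.↥ t ≡ + a → t ℚ.< (+ 1 / 96) ℚ.* (+ (k * k) / suc n-1) →
  a * (96 * suc n-1) ≤ k * k * ℚ.↧ₙ t
cross-multiply (mkℚ (+ a) b-1 _) k n-1 refl h = extract (ℚᵘ.<-respʳ-≃ simplify (ℚ.toℚᵘ-mono-< h))
  where
  simplify : ℚ.toℚᵘ ((+ 1 / 96) ℚ.* (+ (k * k) / suc n-1)) ℚᵘ.≃ ℚᵘ.mkℚᵘ (+ 1) 95 ℚᵘ.* ℚᵘ.mkℚᵘ (+ (k * k)) n-1
  simplify = ℚᵘ.≃-trans (ℚ.toℚᵘ-homo-* (+ 1 / 96) (+ (k * k) / suc n-1))
    (ℚᵘ.*-cong (ℚ.toℚᵘ-fromℚᵘ (ℚᵘ.mkℚᵘ (+ 1) 95)) (ℚ.toℚᵘ-fromℚᵘ (ℚᵘ.mkℚᵘ (+ (k * k)) n-1)))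
  extract : ℚᵘ.mkℚᵘ (+ a) b-1 ℚᵘ.< ℚᵘ.mkℚᵘ (+ 1) 95 ℚᵘ.* ℚᵘ.mkℚᵘ (+ (k * k)) n-1 → a * (96 * suc n-1) ≤ k * k * suc b-1
  extract (ℚᵘ.*<* h) = ℤ.drop‿+≤+ (ℤ.≤-trans (ℤ.≤-reflexive (ℤ.pos-* a (96 * suc n-1)))
    (ℤ.≤-trans (ℤ.<⇒≤ h) (ℤ.≤-reflexive (trans (cong (ℤ._* + suc b-1) (ℤ.*-identityˡ (+ (k * k)))) (sym (ℤ.pos-* (k * k) (suc b-1)))))))

corollary3 :
    Σ[ ε ∈ ℝ ] (0ℝ <ℝ ε) × Σ[ n₀ ∈ ℕ ]
      (∀ (n : ℕ) .{{_ : NonZero n}} → n₀ ≤ n →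
       ∀ (k : ℕ) → 1 ≤ k → k ≤ n →
       ∀ (π : KSRefutation n k) (s : ℕ) → HasMonomialSize π s →
       2^ ε *ℝ fromℚ (+ (k * k) / n) ≤ s)
corollary3 = fromℚ (+ 1 / 96) 
  -- Half of ε serves as the gap that witnesses ε > 0.
  , (+ 1 / 192 , toWitness {a? = 0ℚ ℚ.<? + 1 / 192} _
    , 0 , λ _ _ → toWitness {a? = 0ℚ ℚ.+ + 1 / 192 ℚ.<? + 1 / 96} _)
  , 4 , bound
  where
  bound : ∀ (n : ℕ) .{{_ : NonZero n}} → 4 ≤ n → ∀ (k : ℕ) → 1 ≤ k → k ≤ n →
    ∀ (π : KSRefutation n k) (s : ℕ) → HasMonomialSize π s →
    2^ fromℚ (+ 1 / 96) *ℝ fromℚ (+ (k * k) / n) ≤ s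
  -- Both factors of the exponent are constant sequences, so `below` at one index is already a
  -- rational inequality.
  bound (suc n-1) 4≤n k _ k≤n π s size t (δ , 0<δ , N , below) = go t (ℚ.≤-<-trans t≤t+δ (below N ≤-refl))
    where
    open Parameters n-1 k k≤n 4≤n using (d; dt≤k; small)
    t≤t+δ : t ℚ.≤ t ℚ.+ δ
    t≤t+δ = subst (ℚ._≤ t ℚ.+ δ) (ℚ.+-identityʳ t) (ℚ.+-monoʳ-≤ t (ℚ.<⇒≤ 0<δ))
    absurd : ∀ a b → a * (96 * suc n-1) ≤ k * k * b → s ^ b < 2 ^ a → ⊥
    absurd a b h s<2 = size-bound n-1 k d (suc (k ℕ./ 4)) 4≤n k≤n dt≤k π s size (small s a b h s<2)
    -- The case of exponent 0 excludes s = 0, as is required for negative t, where a power of s is a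
    -- factor of the larger side.
    s-pos : 1 ≤ s
    s-pos = ≮⇒≥ λ s<1 → absurd 0 1 z≤n (subst (_< 1) (sym (*-identityʳ s)) s<1)
    go : ∀ t → t ℚ.< (+ 1 / 96) ℚ.* (+ (k * k) / suc n-1) → 2^ℚ t ≤ s
    go t@(mkℚ (+ a)    b-1 _) t< = ≮⇒≥ (absurd a (suc b-1) (cross-multiply t k n-1 refl t<))
    go   (mkℚ -[1+ a ] b-1 _) t< = *-mono-≤ (m^n>0 2 (suc a)) (m^n>0 s {{ℕ.>-nonZero s-pos}} (suc b-1))
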